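{- Let $\Gamma_0^{(n)}(N)\backslash\mathfrak{H}_n^*$ be the Satake compactification of $\Gamma_0^{(n)}(N)\backslash\mathfrak{H}_n$, with $N$ squarefree. (1) Let $(l_{n-r},\dots,l_1)$ be an $r$-cusp represented by $\gamma$, and let $0\le s\le r$. Consider two $s$-cusps on the Satake compactification $\Gamma_\gamma^{(r)}\backslash\mathfrak{H}_r^*$ of the boundary component corresponding to $(l_{n-r},\dots,l_1)$. If these two $s$-cusps are equal when viewed as $s$-cusps of $\Gamma_0^{(n)}(N)\backslash\mathfrak{H}_n^*$, then they are also equal as $s$-cusps of the boundary component $\Gamma_\gamma^{(r)}\backslash\mathfrak{H}_r^*$ (whose group is conjugate to $\Gamma_0^{(r)}(N)$). In other words, no $r$-cusp can self-intersect at an $s$-cusp. (2) Let $(l_{n-s},\dots,l_1)$ be an $s$-cusp, where $0\le s<n-1$. Then the $(s+1)$-cusps on which $(l_{n-s},\dots,l_1)$ lies are precisely those of the form \[\left(l_{n-s}c_{n-s-1},\ \frac{l_{n-s-1}}{c_{n-s-1}}c_{n-s-2},\ \frac{l_{n-s-2}}{c_{n-s-2}}c_{n-s-3},\ \dots,\ \frac{l_2}{c_2}c_1\right),\] where $c_i\mid l_i$ for $1\le i\le n-s-1$.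
   Context: Let $n$ be a positive integer and $N$ a squarefree positive integer; $\Gamma_0^{(n)}(N)=\{\left(\begin{smallmatrix} A & B\\ C & D\end{smallmatrix}\right)\in \mathrm{Sp}_{2n}(\mathbf{Z}) : C\equiv 0 \bmod N\}$. The Satake compactification is $\Gamma_0^{(n)}(N)\backslash\mathfrak{H}_n^*$ with $\mathfrak{H}_n^*=\bigsqcup_{r=0}^n \mathrm{Sp}_{2n}(\mathbf{Q})\, j_{r,n}(\mathfrak{H}_r)$ inside the Grassmannian of isotropic $n$-planes in $\mathbf{C}^{2n}$, where $j_{r,n}(Z)$ is the class of $\left(\begin{smallmatrix}1_n\\ \mathrm{diag}(Z^{ -1},0_{n-r})\end{smallmatrix}\right)$ and $\mathfrak{H}_0=\{\infty\}$. The $r$-cusps correspond to $\Gamma_0^{(n)}(N)\backslash \mathrm{Sp}_{2n}(\mathbf{Q})/P_{n,r}(\mathbf{Q})$, where $P_{n,r}$ is the stabiliser of $j_{r,n}(\mathfrak{H}_r)$, i.e. matrices $\left(\begin{smallmatrix} A_{11} & 0 & B_{11} & B_{12} \\ A_{21} & A_{22} & B_{21} & B_{22} \\ C_{11} & 0 & D_{11} & D_{12} \\ 0 & 0 & 0 & D_{22}\end{smallmatrix}\right)$ ($*_{11}$ of size $r$), with surjection $\omega_{n,r}:P_{n,r}\to\mathrm{Sp}_{2r}$ onto $\left(\begin{smallmatrix} A_{11} & B_{11}\\ C_{11} & D_{11}\end{smallmatrix}\right)$ and splitting $\xi_{r,n}$ (embedding $\left(\begin{smallmatrix} A & B\\ C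 & D\end{smallmatrix}\right)$ with identity in the remaining diagonal blocks). The $r$-cusp attached to $\gamma$ is $\Gamma_\gamma^{(r)}\backslash\mathfrak{H}_r^*$, $\Gamma_\gamma^{(r)}=\omega_{n,r}(\gamma^{ -1}\Gamma_0^{(n)}(N)\gamma\cap P_{n,r}(\mathbf{Q}))$, embedded by $\Gamma_\gamma^{(r)}\rho\, j_{s,r}(Z)\mapsto \Gamma_0^{(n)}(N)\gamma\,\xi_{r,n}(\rho)\, j_{s,n}(Z)$; thus an $s$-cusp of it is an $s$-cusp of $\Gamma_0^{(n)}(N)\backslash\mathfrak{H}_n^*$. An $r$-cusp is identified with a tuple $(l_{n-r},\dots,l_1)$ of pairwise coprime positive divisors of $N$, represented by $\gamma=\gamma^{(n)}(l_{n-r})\xi_{n-1,n}(\gamma^{(n-1)}(l_{n-r-1}))\cdots\xi_{r+1,n}(\gamma^{(r+1)}(l_1))$, where $\gamma^{(m)}(l)\in\mathrm{Sp}_{2m}(\mathbf{Z})$ is congruent to $\left(\begin{smallmatrix}0&-1_m\\1_m&0\end{smallmatrix}\right)$ mod $l^2$ and to $1_{2m}$ mod $(N/l)^2$; these represent all $r$-cusps, and then $\Gamma_\gamma^{(r)}=\{\left(\begin{smallmatrix}A&B\\C&D\end{smallmatrix}\right)\in\mathrm{Sp}_{2r}(\mathbf{Z}): C\equiv0 \bmod l_0,\ B\equiv 0\bmod l_{n-r}\cdots l_1\}$ with $l_0=N/(l_{n-r}\cdots l_1)$. Equivalently, for $p\mid N$, $p\mid l_i$ iff the lower-right $(n-r)\times(n-r)$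 block of the $C$-block of a representative has rank $i$ mod $p$. An $s$-cusp lies on an $(s+1)$-cusp if it is one of the $s$-cusps of that boundary component. -}

module Defs where

open import Data.Nat as ℕ using (ℕ; zero; suc; _≤_; _<_)
open import Data.Nat.Divisibility using (_∣_)
open import Data.Nat.Coprimality using (Coprime)
open import Data.Integer as ℤ using (ℤ)
open import Data.Rational using (ℚ; _/_; 0ℚ; 1ℚ; _+_; _*_; _-_; -_)
open import Data.Fin as Fin using (Fin; toℕ; fromℕ<; inject≤)
open import Data.Sum using (_⊎_; inj₁; inj₂)
open import Data.Product using (Σ; ∃; ∃-syntax; _×_; proj₁; proj₂)
open import Data.Empty using (⊥)
open import Data.List using (List; []; _∷_)
open import Data.List.Relation.Unary.All using (All)
open import Data.List.Relation.Unary.AllPairs using (AllPairs)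
open import Relation.Binary.PropositionalEquality using (_≡_)
open import Relation.Nullary using (yes; no)

-- Matrices over ℚ.  A 2n × 2n matrix is indexed by Idx n = Fin n ⊎ Fin n
-- (inj₁ = first n coordinates, inj₂ = last n coordinates).

Mat : ℕ → ℕ → Set
Mat m k = Fin m → Fin k → ℚ

Idx : ℕ → Set
Idx n = Fin n ⊎ Fin n

Mat2 : ℕ → Set
Mat2 n = Idx n → Idx n → ℚ

sumF : ∀ {m} → (Fin m → ℚ) → ℚ
sumF {zero}  f = 0ℚ
sumF {suc m} f = f Fin.zero + sumF (λ i → f (Fin.suc i))

sumI : ∀ {n} → (Idx n → ℚ) → ℚ
sumI f = sumF (λ a → f (inj₁ a)) + sumF (λ a → f (inj₂ a))

infixl 7 _⊗_
_⊗_ : ∀ {n} → Mat2 n → Mat2 n → Mat2 n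
(A ⊗ B) i j = sumI (λ k → A i k * B k j)

transpose : ∀ {n} → Mat2 n → Mat2 n
transpose A i j = A j i

infix 4 _≈_
_≈_ : ∀ {n} → Mat2 n → Mat2 n → Set
A ≈ B = ∀ i j → A i j ≡ B i j

δ : ∀ {m} → Fin m → Fin m → ℚ
δ a b with a Fin.≟ b
... | yes _ = 1ℚ
... | no  _ = 0ℚ

top : ∀ {n} → Fin n → Idx n
top = inj₁

bot : ∀ {n} → Fin n → Idx n
bot = inj₂

blk : ∀ {n} → (A B C D : Mat n n) → Mat2 n
blk A B C D (inj₁ a) (inj₁ b) = A a b
blk A B C D (inj₁ a) (inj₂ b) = B a b
blk A B C D (inj₂ a) (inj₁ b) = C a b
blk A B C D (inj₂ a) (inj₂ b) = D a b

idM : ∀ {n} → Mat2 n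
idM = blk δ (λ _ _ → 0ℚ) (λ _ _ → 0ℚ) δ

J : (n : ℕ) → Mat2 n
J n = blk (λ _ _ → 0ℚ) (λ a b → - δ a b) δ (λ _ _ → 0ℚ)

IsSp : (n : ℕ) → Mat2 n → Set
IsSp n M = transpose M ⊗ J n ⊗ M ≈ J n

IsInt : ℚ → Set
IsInt q = ∃[ z ] q ≡ z / 1

IntegralM : ∀ {n} → Mat2 n → Set
IntegralM M = ∀ i j → IsInt (M i j)

DivQ : ℕ → ℚ → Set
DivQ m q = ∃[ z ] q ≡ (ℤ.+ m ℤ.* z) / 1

CongMod : ∀ {n} → ℕ → Mat2 n → Mat2 n → Set
CongMod m A B = ∀ i j → DivQ m (A i j - B i j)

InΓ0 : (N n : ℕ) → Mat2 n → Set
InΓ0 N n M = IsSp n M × IntegralM M × (∀ a b → DivQ N (M (bot a) (top b)))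

InP : (n r : ℕ) → Mat2 n → Set
InP n r M = IsSp n M
  × (∀ (a b : Fin n) → toℕ a < r → r ≤ toℕ b → M (top a) (top b) ≡ 0ℚ)
  × (∀ (a b : Fin n) → (r ≤ toℕ a ⊎ r ≤ toℕ b) → M (bot a) (top b) ≡ 0ℚ)
  × (∀ (a b : Fin n) → r ≤ toℕ a → toℕ b < r → M (bot a) (bot b) ≡ 0ℚ)

ω : (n r : ℕ) → r ≤ n → Mat2 n → Mat2 r
ω n r r≤n M i j = M (emb i) (emb j)
  where
  emb : Idx r → Idx n
  emb (inj₁ a) = top (inject≤ a r≤n)
  emb (inj₂ a) = bot (inject≤ a r≤n)

ξ : (r n : ℕ) → Mat2 r → Mat2 n
ξ r n ρ = blk (ext ρA δ) (ext ρB z) (ext ρC z) (ext ρD δ)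
  where
  z : Mat n n
  z _ _ = 0ℚ
  ρA ρB ρC ρD : Mat r r
  ρA a b = ρ (top a) (top b)
  ρB a b = ρ (top a) (bot b)
  ρC a b = ρ (bot a) (top b)
  ρD a b = ρ (bot a) (bot b)
  ext : Mat r r → Mat n n → Mat n n
  ext f d a b with toℕ a ℕ.<? r | toℕ b ℕ.<? r
  ... | yes p | yes q = f (fromℕ< p) (fromℕ< q)
  ... | _     | _     = d a b

DC : ∀ {n} → (Mat2 n → Set) → (Mat2 n → Set) → Mat2 n → Mat2 n → Set
DC G H g g' = ∃[ d ] ∃[ p ] G d × H p × (g' ≈ d ⊗ g ⊗ p)

-- Γ_γ^{(r)} = ω_{n,r}(γ⁻¹ Γ_0^{(n)}(N) γ ∩ P_{n,r}(ℚ))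
InΓγ : (N n r : ℕ) → r ≤ n → Mat2 n → Mat2 r → Set
InΓγ N n r r≤n γ ρ =
  ∃[ q ] InP n r q × (ω n r r≤n q ≈ ρ) × (∃[ d ] InΓ0 N n d × (γ ⊗ q ≈ d ⊗ γ))

SquareFree : ℕ → Set
SquareFree N = ∀ d → d ℕ.* d ∣ N → d ≡ 1

-- pairwise coprime positive divisors of N (list (l_{n-r}, …, l_1))
ValidTuple : ℕ → List ℕ → Set
ValidTuple N L = All (λ l → 0 < l × l ∣ N) L × AllPairs Coprime L

IsGammaL : (N m l : ℕ) → Mat2 m → Set
IsGammaL N m l g = IsSp m g × IntegralM g
  × (∀ l' → l ℕ.* l' ≡ N → CongMod (l ℕ.* l) g (J m) × CongMod (l' ℕ.* l') g idM)

-- γ = γ^{(n)}(l_{n-r}) ξ_{n-1,n}(γ^{(n-1)}(l_{n-r-1})) ⋯ ξ_{r+1,n}(γ^{(r+1)}(l_1))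
IsRep : (N n : ℕ) → List ℕ → Mat2 n → Set
IsRep N n       []      γ = γ ≈ idM
IsRep N zero    (l ∷ L) γ = ⊥
IsRep N (suc m) (l ∷ L) γ =
  ∃[ g ] ∃[ h ] IsGammaL N (suc m) l g × IsRep N m L h × (γ ≈ g ⊗ ξ m (suc m) h)

-- the s-cusp L lies on the (s+1)-cusp M (of Γ_0^{(n)}(N)\𝔥_n^*):
-- it is one of the s-cusps Γ_0 γ_M ξ_{s+1,n}(ρ) P_{n,s}(ℚ) of the boundary component of M
LiesOn : (N n s : ℕ) → List ℕ → List ℕ → Set
LiesOn N n s L M = ∀ γL γM → IsRep N n L γL → IsRep N n M γM →
  ∃[ ρ ] IsSp (suc s) ρ × DC (InΓ0 N n) (InP n s) γL (γM ⊗ ξ (suc s) n ρ)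

-- (l_{n-s} c_{n-s-1}, (l_{n-s-1}/c_{n-s-1}) c_{n-s-2}, …, (l_2/c_2) c_1)
-- given the list of pairs (c_i , l_i/c_i) for i = n-s-1, …, 1
formula : ℕ → List (ℕ × ℕ) → List ℕ
formula h []             = []
formula h (cd ∷ cds) = h ℕ.* proj₁ cd ∷ formula (proj₂ cd) cds

-- Everything is done for isotropic subspaces modulo the primes ℓ ∣ N.  Call an integral symplectic τ of type
-- β if, modulo each ℓ and for each j, the j-th column of its C-block (β ℓ j = 0) or of its D-block (β ℓ j = 1)
-- vanishes; τ is determined by β up to Γ₀(N) on the left, because C′D⊺ − D′C⊺ vanishes modulo ℓ for two
-- matrices of the same type.  Euclid's algorithm with SL₂(ℤ)'s acting on one or two coordinates, corrected by the Chinese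
-- remainder theorem so that types are kept, writes every g ∈ Sp₂ₙ(ℚ) as τ p with τ typed and p ∈ P_{n,s}(ℚ).  Two
-- typed matrices are equivalent under Γ₀(N) × P_{n,s} iff at each ℓ equally many coordinates > s have β = 1:
-- this number is the rank mod ℓ of the C-block on the isotropic subspace, and conversely rotations in pairs of
-- coordinates permute the entries of β at one prime at a time.  The representative of the cusp (l_{n-r}, …, l_1)
-- has rank i at the primes dividing l_i.  Multiplying it by ξ of a typed matrix adds the ranks, so the rank on the
-- boundary component is the difference of two ranks, whence (1); for (2) that difference is 0 or 1, so a prime
-- dividing l_i divides the (i−1)-st or the i-th entry of an incident (s+1)-cusp.
module Submission where

open import Defs
open import Algebra.Bundles using (Monoid)
open import Data.Bool as Bool using (Bool; true; false; if_then_else_; _xor_)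
import Data.Bool.Properties as Boolₚ
open import Data.Fin as Fin using (Fin; toℕ; fromℕ; fromℕ<; inject≤; splitAt; join)
import Data.Fin.Properties as Finₚ
open import Data.Integer as ℤ using (ℤ) renaming (+_ to pos)
import Data.Integer.Divisibility.Signed as Signed
import Data.Integer.Properties as ℤₚ
import Data.Integer.Tactic.RingSolver as ℤ-Solver
open import Data.List as List using (List; []; _∷_; _++_; length)
open import Data.List.Membership.Propositional using (_∈_; lose)
open import Data.List.Membership.Propositional.Properties using (∈-map⁺; ∈-++⁺ˡ; ∈-++⁺ʳ; ∈-filter⁺; ∈-allFin)
import Data.List.Properties as Listₚ
open import Data.List.Relation.Binary.Pointwise using (Pointwise; []; _∷_)
open import Data.List.Relation.Unary.All as All using (All; []; _∷_)
open import Data.List.Relation.Unary.AllPairs using ([]; _∷_)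
open import Data.List.Relation.Unary.Any using (here; there)
open import Data.Nat as ℕ using (ℕ; zero; suc; s≤s; z≤n; _≤_; _<_; _∸_)
open import Data.Nat.Coprimality as Coprimality using (Coprime)
open import Data.Nat.Divisibility as ∣ using (_∣_; divides)
import Data.Nat.GCD as GCD
open import Data.Nat.ListAction using (product)
open import Data.Nat.Primality using (Prime; prime?; euclidsLemma; prime⇒irreducible; ¬prime[1])
open import Data.Nat.Primality.Factorisation using (PrimeFactorisation; factorise)
import Data.Nat.Properties as ℕₚ
open import Data.Product using (_×_; _,_; proj₁; proj₂; ∃-syntax; Σ-syntax)
open import Data.Rational using (ℚ; mkℚ; ↥_; _/_; 0ℚ; 1ℚ; _+_; _*_; _-_; -_; 1/_; ≢-nonZero)
open import Data.Rational.Properties as ℚₚ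
  using (+-*-commutativeRing; +-identityˡ; +-identityʳ; *-zeroˡ; *-zeroʳ; *-identityˡ; *-identityʳ; *-assoc; *-comm; +-comm)
import Data.Rational.Unnormalised as ℚᵘ
open import Data.Sum as Sum using (_⊎_; inj₁; inj₂; [_,_]′)
import Data.Sum.Properties as Sumₚ
open import Data.Unit using (⊤)
open import Data.Empty using (⊥; ⊥-elim)
open import Function using (_∘_)
open import Function.Bundles using (_⇔_; mk⇔)
open import Level using (0ℓ)
open import Relation.Binary.Definitions using (tri<; tri≈; tri>)
open import Relation.Binary.PropositionalEquality hiding (J; setoid)
import Relation.Binary.Reasoning.Setoid as SetoidReasoning
open import Relation.Nullary using (¬_; Dec; yes; no; does; contradiction; ¬?)
open import Relation.Nullary.Decidable using (map′; _×-dec_; decidable-stable)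
open import Relation.Nullary.Decidable.Core using (dec⇒maybe)
open import Tactic.RingSolver using (solve-∀)
open import Tactic.RingSolver.Core.AlmostCommutativeRing using (AlmostCommutativeRing; fromCommutativeRing)

-- Ranks are visible only modulo the primes, while an equivalence has to be witnessed by matrices
-- over ℤ and ℚ. No lifting from Sp modulo N to Sp over ℤ is invoked: each auxiliary matrix is built
-- from SL₂(ℤ)-matrices with an integer parameter, whose determinant is one for every value of the
-- parameter, so that the Chinese remainder theorem can tune it at every prime separately.
-- Denominators never enter a typed matrix; they remain in the factor p. Gaussian elimination
-- without division serves twice: over ℚ it turns left inverses of matrices into right ones, and
-- modulo ℓ it makes the rank an invariant. A representative γ of an r-cusp is not of type 0 on the
-- first r coordinates: at the primes dividing some l_i it has constant type 1 there. Multiplication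
-- by ξ(z⁻¹), with an integral z of this constant type, repairs that. Conjugation by z then carries
-- Γ₀(N) of degree r into Γ_γ, which is how the equivalence in (1) returns from typed matrices to
-- the boundary component.

private variable
  m n : ℕ

-- Sums and symplectic matrices

ℚ-ring : AlmostCommutativeRing 0ℓ 0ℓ
ℚ-ring = fromCommutativeRing +-*-commutativeRing (λ x → dec⇒maybe (0ℚ ℚₚ.≟ x))

sumF-cong : {f g : Fin m → ℚ} → (∀ i → f i ≡ g i) → sumF f ≡ sumF g
sumF-cong {zero}  eq = refl
sumF-cong {suc m} eq = cong₂ _+_ (eq Fin.zero) (sumF-cong (eq ∘ Fin.suc))

sumF-zero : {f : Fin m → ℚ} → (∀ i → f i ≡ 0ℚ) → sumF f ≡ 0ℚ
sumF-zero {zero}  eq = refl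
sumF-zero {suc m} eq = cong₂ _+_ (eq Fin.zero) (sumF-zero (eq ∘ Fin.suc))

interchange : ∀ a b c d → (a + b) + (c + d) ≡ (a + c) + (b + d)
interchange = solve-∀ ℚ-ring

sumF-+ : (f g : Fin m → ℚ) → sumF (λ i → f i + g i) ≡ sumF f + sumF g
sumF-+ {zero}  f g = refl
sumF-+ {suc m} f g = trans (cong (f Fin.zero + g Fin.zero +_) (sumF-+ (f ∘ Fin.suc) (g ∘ Fin.suc)))
  (interchange (f Fin.zero) (g Fin.zero) (sumF (f ∘ Fin.suc)) (sumF (g ∘ Fin.suc)))

sumF-*ˡ : ∀ c (f : Fin m → ℚ) → sumF (λ i → c * f i) ≡ c * sumF f
sumF-*ˡ {zero}  c f = sym (*-zeroʳ c)
sumF-*ˡ {suc m} c f = trans (cong (c * f Fin.zero +_) (sumF-*ˡ c (f ∘ Fin.suc)))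
  (sym (ℚₚ.*-distribˡ-+ c (f Fin.zero) (sumF (f ∘ Fin.suc))))

sumF-swap : (f : Fin m → Fin n → ℚ) →
  sumF (λ i → sumF (f i)) ≡ sumF (λ j → sumF (λ i → f i j))
sumF-swap {zero} {n} f = sym (sumF-zero {n} (λ _ → refl))
sumF-swap {suc m} f = trans (cong (sumF (f Fin.zero) +_) (sumF-swap (f ∘ Fin.suc)))
  (sym (sumF-+ (f Fin.zero) (λ j → sumF (λ i → f (Fin.suc i) j))))

δ-refl : (k : Fin m) → δ k k ≡ 1ℚ
δ-refl k with k Fin.≟ k
... | yes _   = refl
... | no  k≢k = contradiction refl k≢k

δ-≢ : {k l : Fin m} → k ≢ l → δ k l ≡ 0ℚ
δ-≢ {k = k} {l} k≢l with k Fin.≟ l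
... | yes k≡l = contradiction k≡l k≢l
... | no  _   = refl

δ-sym : (k l : Fin m) → δ k l ≡ δ l k
δ-sym k l with k Fin.≟ l
... | yes refl = sym (δ-refl k)
... | no  k≢l  = sym (δ-≢ (k≢l ∘ sym))

δ-suc : (k l : Fin m) → δ (Fin.suc k) (Fin.suc l) ≡ δ k l
δ-suc k l with k Fin.≟ l
... | yes refl = refl
... | no  _    = refl

sumF-δˡ : (k : Fin m) (f : Fin m → ℚ) → sumF (λ i → δ k i * f i) ≡ f k
sumF-δˡ Fin.zero f = trans
  (cong₂ _+_ (*-identityˡ (f Fin.zero)) (sumF-zero (λ i → *-zeroˡ (f (Fin.suc i)))))
  (+-identityʳ (f Fin.zero))
sumF-δˡ (Fin.suc k) f = trans
  (cong₂ _+_ (*-zeroˡ (f Fin.zero))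
             (trans (sumF-cong (λ i → cong (_* f (Fin.suc i)) (δ-suc k i))) (sumF-δˡ k (f ∘ Fin.suc))))
  (+-identityˡ (f (Fin.suc k)))

sumF-δʳ : (k : Fin m) (f : Fin m → ℚ) → sumF (λ i → f i * δ i k) ≡ f k
sumF-δʳ k f = trans
  (sumF-cong (λ i → trans (*-comm (f i) (δ i k)) (cong (_* f i) (δ-sym i k)))) (sumF-δˡ k f)

sumI-cong : {f g : Idx n → ℚ} → (∀ i → f i ≡ g i) → sumI f ≡ sumI g
sumI-cong eq = cong₂ _+_ (sumF-cong (eq ∘ inj₁)) (sumF-cong (eq ∘ inj₂))

sumI-+ : (f g : Idx n → ℚ) → sumI (λ i → f i + g i) ≡ sumI f + sumI g
sumI-+ f g = trans (cong₂ _+_ (sumF-+ (f ∘ inj₁) (g ∘ inj₁)) (sumF-+ (f ∘ inj₂) (g ∘ inj₂)))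
  (interchange (sumF (f ∘ inj₁)) (sumF (g ∘ inj₁)) (sumF (f ∘ inj₂)) (sumF (g ∘ inj₂)))

sumI-*ˡ : ∀ c (f : Idx n → ℚ) → sumI (λ i → c * f i) ≡ c * sumI f
sumI-*ˡ c f = trans (cong₂ _+_ (sumF-*ˡ c (f ∘ inj₁)) (sumF-*ˡ c (f ∘ inj₂)))
  (sym (ℚₚ.*-distribˡ-+ c (sumF (f ∘ inj₁)) (sumF (f ∘ inj₂))))

sumI-*ʳ : ∀ c (f : Idx n → ℚ) → sumI (λ i → f i * c) ≡ sumI f * c
sumI-*ʳ c f = trans (sumI-cong (λ i → *-comm (f i) c)) (trans (sumI-*ˡ c f) (*-comm c (sumI f)))

sumI-swap : (f : Idx m → Idx n → ℚ) →
  sumI (λ i → sumI (f i)) ≡ sumI (λ j → sumI (λ i → f i j))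
sumI-swap f = trans
  (cong₂ _+_ (split inj₁) (split inj₂))
  (trans (interchange
            (sumF (λ b → sumF (λ a → f (inj₁ a) (inj₁ b)))) (sumF (λ b → sumF (λ a → f (inj₁ a) (inj₂ b))))
            (sumF (λ b → sumF (λ a → f (inj₂ a) (inj₁ b)))) (sumF (λ b → sumF (λ a → f (inj₂ a) (inj₂ b)))))
         (sym (cong₂ _+_
           (sumF-+ (λ b → sumF (λ a → f (inj₁ a) (inj₁ b))) (λ b → sumF (λ a → f (inj₂ a) (inj₁ b))))
           (sumF-+ (λ b → sumF (λ a → f (inj₁ a) (inj₂ b))) (λ b → sumF (λ a → f (inj₂ a) (inj₂ b)))))))
  where
  split : ∀ {k} (ι : Fin k → Idx _) →
    sumF (λ a → sumI (f (ι a))) ≡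
    sumF (λ b → sumF (λ a → f (ι a) (inj₁ b))) + sumF (λ b → sumF (λ a → f (ι a) (inj₂ b)))
  split ι = trans (sumF-+ (λ a → sumF (λ b → f (ι a) (inj₁ b))) (λ a → sumF (λ b → f (ι a) (inj₂ b))))
    (cong₂ _+_ (sumF-swap (λ a b → f (ι a) (inj₁ b))) (sumF-swap (λ a b → f (ι a) (inj₂ b))))

sumI-idˡ : (i : Idx n) (f : Idx n → ℚ) → sumI (λ k → idM i k * f k) ≡ f i
sumI-idˡ (inj₁ a) f = trans
  (cong₂ _+_ (sumF-δˡ a (f ∘ inj₁)) (sumF-zero (λ b → *-zeroˡ (f (inj₂ b))))) (+-identityʳ (f (inj₁ a)))
sumI-idˡ (inj₂ a) f = trans
  (cong₂ _+_ (sumF-zero (λ b → *-zeroˡ (f (inj₁ b)))) (sumF-δˡ a (f ∘ inj₂))) (+-identityˡ (f (inj₂ a)))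

sumI-idʳ : (j : Idx n) (f : Idx n → ℚ) → sumI (λ k → f k * idM k j) ≡ f j
sumI-idʳ (inj₁ a) f = trans
  (cong₂ _+_ (sumF-δʳ a (f ∘ inj₁)) (sumF-zero (λ b → *-zeroʳ (f (inj₂ b))))) (+-identityʳ (f (inj₁ a)))
sumI-idʳ (inj₂ a) f = trans
  (cong₂ _+_ (sumF-zero (λ b → *-zeroʳ (f (inj₁ b)))) (sumF-δʳ a (f ∘ inj₂))) (+-identityˡ (f (inj₂ a)))

⊗-cong : {A A′ B B′ : Mat2 n} → A ≈ A′ → B ≈ B′ → A ⊗ B ≈ A′ ⊗ B′
⊗-cong p q i j = sumI-cong (λ k → cong₂ _*_ (p i k) (q k j))

⊗-congˡ : (A : Mat2 n) {B B′ : Mat2 n} → B ≈ B′ → A ⊗ B ≈ A ⊗ B′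
⊗-congˡ A p i j = sumI-cong (λ k → cong (A i k *_) (p k j))

⊗-congʳ : (B : Mat2 n) {A A′ : Mat2 n} → A ≈ A′ → A ⊗ B ≈ A′ ⊗ B
⊗-congʳ B p i j = sumI-cong (λ k → cong (_* B k j) (p i k))

⊗-assoc : (A B C : Mat2 n) → (A ⊗ B) ⊗ C ≈ A ⊗ (B ⊗ C)
⊗-assoc A B C i j = begin
  sumI (λ k → sumI (λ l → A i l * B l k) * C k j)
    ≡⟨ sumI-cong (λ k → sym (sumI-*ʳ (C k j) (λ l → A i l * B l k))) ⟩
  sumI (λ k → sumI (λ l → A i l * B l k * C k j))
    ≡⟨ sumI-swap (λ k l → A i l * B l k * C k j) ⟩
  sumI (λ l → sumI (λ k → A i l * B l k * C k j))
    ≡⟨ sumI-cong (λ l → trans (sumI-cong (λ k → *-assoc (A i l) (B l k) (C k j)))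
                              (sumI-*ˡ (A i l) (λ k → B l k * C k j))) ⟩
  sumI (λ l → A i l * sumI (λ k → B l k * C k j)) ∎
  where open ≡-Reasoning

⊗-monoid : ℕ → Monoid 0ℓ 0ℓ
⊗-monoid n = record
  { Carrier = Mat2 n ; _≈_ = _≈_ ; _∙_ = _⊗_ ; ε = idM
  ; isMonoid = record
    { isSemigroup = record
      { isMagma = record
        { isEquivalence = record
          { refl  = λ i j → refl
          ; sym   = λ p i j → sym (p i j)
          ; trans = λ p q i j → trans (p i j) (q i j) }
        ; ∙-cong = λ {A} {A′} {B} {B′} → ⊗-cong {A = A} {A′} {B} {B′} }
      ; assoc = ⊗-assoc }
    ; identity = (λ A i j → sumI-idˡ i (λ k → A k j)) , (λ A i j → sumI-idʳ j (λ k → A i k)) } }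

-- This is J⁻¹ M⊺ J written out in blocks, the inverse of M when M is symplectic.
adj : Mat2 n → Mat2 n
adj M = blk (λ a b → M (bot b) (bot a)) (λ a b → - M (top b) (bot a))
            (λ a b → - M (bot b) (top a)) (λ a b → M (top b) (top a))

-- The alternating form x⊺ J y, arranged like the sum for `transpose M ⊗ J n ⊗ M`, so that the
-- comparison is termwise.
form : (Idx n → ℚ) → (Idx n → ℚ) → ℚ
form x y = sumI (λ { (inj₁ b) → x (bot b) * y (top b) ; (inj₂ b) → - x (top b) * y (bot b) })

sumI-J : (x : Idx n → ℚ) → ∀ b →
  sumI (λ l → x l * J n l (top b)) ≡ x (bot b) × sumI (λ l → x l * J n l (bot b)) ≡ - x (top b)
sumI-J {n} x b =
  trans (cong₂ _+_ (sumF-zero (λ a → *-zeroʳ (x (inj₁ a)))) (sumF-δʳ b (x ∘ inj₂))) (+-identityˡ (x (inj₂ b))) ,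
  trans (cong₂ _+_
          (trans (sumF-cong (λ a → neg-right (x (inj₁ a)) (δ a b))) (sumF-δʳ b (λ a → - x (inj₁ a))))
          (sumF-zero (λ a → *-zeroʳ (x (inj₂ a)))))
        (+-identityʳ (- x (inj₁ b)))
  where
  neg-right : ∀ x y → x * - y ≡ - x * y
  neg-right = solve-∀ ℚ-ring

conjJ≡form : (M : Mat2 n) → ∀ i j →
  (transpose M ⊗ J n ⊗ M) i j ≡ form (λ k → M k i) (λ k → M k j)
conjJ≡form {n} M i j = cong₂ _+_
  (sumF-cong (λ b → cong (_* M (top b) j) (proj₁ (sumI-J (λ k → M k i) b))))
  (sumF-cong (λ b → cong (_* M (bot b) j) (proj₂ (sumI-J (λ k → M k i) b))))

-form : (x y : Idx n → ℚ) →
  sumF (λ b → - x (bot b) * y (top b)) + sumF (λ b → x (top b) * y (bot b)) ≡ - form x y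
-form x y = trans
  (cong₂ _+_ (trans (sumF-cong (λ b → l₁ (x (bot b)) (y (top b)))) (sumF-*ˡ (- 1ℚ) (λ b → x (bot b) * y (top b))))
             (trans (sumF-cong (λ b → l₂ (x (top b)) (y (bot b)))) (sumF-*ˡ (- 1ℚ) (λ b → - x (top b) * y (bot b)))))
  (l₃ (sumF (λ b → x (bot b) * y (top b))) (sumF (λ b → - x (top b) * y (bot b))))
  where
  l₁ : ∀ x y → - x * y ≡ - 1ℚ * (x * y)
  l₁ = solve-∀ ℚ-ring
  l₂ : ∀ x y → x * y ≡ - 1ℚ * (- x * y)
  l₂ = solve-∀ ℚ-ring
  l₃ : ∀ x y → - 1ℚ * x + - 1ℚ * y ≡ - (x + y)
  l₃ = solve-∀ ℚ-ring

neg-involutive : ∀ x → - (- x) ≡ x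
neg-involutive = solve-∀ ℚ-ring

neg-injective : ∀ {x y} → - x ≡ - y → x ≡ y
neg-injective {x} {y} eq = trans (sym (neg-involutive x)) (trans (cong -_ eq) (neg-involutive y))

IsSp⇒adj-inverse : (M : Mat2 n) → IsSp n M → adj M ⊗ M ≈ idM
IsSp⇒adj-inverse {n} M sp (inj₁ a) j = trans (trans (sym (conjJ≡form M (bot a) j)) (sp (bot a) j)) (lem j)
  where
  lem : ∀ j → J n (bot a) j ≡ idM (top a) j
  lem (inj₁ b) = refl
  lem (inj₂ b) = refl
IsSp⇒adj-inverse {n} M sp (inj₂ a) j = trans (-form (λ k → M k (top a)) (λ k → M k j))
  (trans (cong -_ (trans (sym (conjJ≡form M (top a) j)) (sp (top a) j))) (lem j))
  where
  lem : ∀ j → - J n (top a) j ≡ idM (bot a) j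
  lem (inj₁ b) = refl
  lem (inj₂ b) = neg-involutive (δ a b)

adj-inverse⇒IsSp : (M : Mat2 n) → adj M ⊗ M ≈ idM → IsSp n M
adj-inverse⇒IsSp {n} M inv (inj₂ a) j = trans (conjJ≡form M (bot a) j) (trans (inv (top a) j) (lem j))
  where
  lem : ∀ j → idM (top a) j ≡ J n (bot a) j
  lem (inj₁ b) = refl
  lem (inj₂ b) = refl
adj-inverse⇒IsSp {n} M inv (inj₁ a) j = trans (conjJ≡form M (top a) j) (neg-injective
  (trans (sym (-form (λ k → M k (top a)) (λ k → M k j))) (trans (inv (bot a) j) (lem j))))
  where
  lem : ∀ j → idM (bot a) j ≡ - J n (top a) j
  lem (inj₁ b) = refl
  lem (inj₂ b) = sym (neg-involutive (δ a b))

adj-cong : {A B : Mat2 n} → A ≈ B → adj A ≈ adj B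
adj-cong p (inj₁ a) (inj₁ b) = p (bot b) (bot a)
adj-cong p (inj₁ a) (inj₂ b) = cong -_ (p (top b) (bot a))
adj-cong p (inj₂ a) (inj₁ b) = cong -_ (p (bot b) (top a))
adj-cong p (inj₂ a) (inj₂ b) = p (top b) (top a)

adj-involutive : (A : Mat2 n) → adj (adj A) ≈ A
adj-involutive A (inj₁ a) (inj₁ b) = refl
adj-involutive A (inj₁ a) (inj₂ b) = neg-involutive (A (top a) (bot b))
adj-involutive A (inj₂ a) (inj₁ b) = neg-involutive (A (bot a) (top b))
adj-involutive A (inj₂ a) (inj₂ b) = refl

adj-⊗ : (A B : Mat2 n) → adj (A ⊗ B) ≈ adj B ⊗ adj A
adj-⊗ A B = go
  where
  l₁ : ∀ x y → x * y ≡ y * x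
  l₁ = *-comm
  l₂ : ∀ x y → x * y ≡ - y * - x
  l₂ = solve-∀ ℚ-ring
  l₃ : ∀ x y → - 1ℚ * (x * y) ≡ y * - x
  l₃ = solve-∀ ℚ-ring
  l₄ : ∀ x y → - 1ℚ * (x * y) ≡ - y * x
  l₄ = solve-∀ ℚ-ring
  neg-sum : ∀ {k} (f g : Fin k → ℚ) →
    - (sumF f + sumF g) ≡ sumF (λ i → - 1ℚ * g i) + sumF (λ i → - 1ℚ * f i)
  neg-sum f g = trans (l₅ (sumF f) (sumF g)) (cong₂ _+_ (sym (sumF-*ˡ (- 1ℚ) g)) (sym (sumF-*ˡ (- 1ℚ) f)))
    where
    l₅ : ∀ x y → - (x + y) ≡ - 1ℚ * y + - 1ℚ * x
    l₅ = solve-∀ ℚ-ring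
  go : adj (A ⊗ B) ≈ adj B ⊗ adj A
  go (inj₁ a) (inj₁ b) = trans (+-comm (sumF (λ k → A (bot b) (top k) * B (top k) (bot a))) _) (cong₂ _+_
    (sumF-cong (λ k → l₁ (A (bot b) (bot k)) (B (bot k) (bot a))))
    (sumF-cong (λ k → l₂ (A (bot b) (top k)) (B (top k) (bot a)))))
  go (inj₁ a) (inj₂ b) = trans (neg-sum (λ k → A (top b) (top k) * B (top k) (bot a)) _) (cong₂ _+_
    (sumF-cong (λ k → l₃ (A (top b) (bot k)) (B (bot k) (bot a))))
    (sumF-cong (λ k → l₄ (A (top b) (top k)) (B (top k) (bot a)))))
  go (inj₂ a) (inj₁ b) = trans (neg-sum (λ k → A (bot b) (top k) * B (top k) (top a)) _) (cong₂ _+_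
    (sumF-cong (λ k → l₄ (A (bot b) (bot k)) (B (bot k) (top a))))
    (sumF-cong (λ k → l₃ (A (bot b) (top k)) (B (top k) (top a)))))
  go (inj₂ a) (inj₂ b) = trans (+-comm (sumF (λ k → A (top b) (top k) * B (top k) (top a))) _) (cong₂ _+_
    (sumF-cong (λ k → l₂ (A (top b) (bot k)) (B (bot k) (top a))))
    (sumF-cong (λ k → l₁ (A (top b) (top k)) (B (top k) (top a)))))

-- Integers and congruences inside ℚ

1-coprime : ∀ z → Coprime ℤ.∣ z ∣ 1
1-coprime z (_ , d∣1) = ∣.∣1⇒≡1 d∣1

/1≡mkℚ : ∀ z → z / 1 ≡ mkℚ z 0 (1-coprime z)
/1≡mkℚ z = ℚₚ.↥p/↧p≡p (mkℚ z 0 (1-coprime z))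

/1-injective : ∀ {y z} → y / 1 ≡ z / 1 → y ≡ z
/1-injective {y} {z} eq = cong ↥_ (trans (sym (/1≡mkℚ y)) (trans eq (/1≡mkℚ z)))

/1-+ : ∀ y z → y / 1 + z / 1 ≡ (y ℤ.+ z) / 1
/1-+ y z = trans (cong₂ _+_ (/1≡mkℚ y) (/1≡mkℚ z))
  (cong (_/ 1) (cong₂ ℤ._+_ (ℤₚ.*-identityʳ y) (ℤₚ.*-identityʳ z)))

/1-* : ∀ y z → (y / 1) * (z / 1) ≡ (y ℤ.* z) / 1
/1-* y z = cong₂ _*_ (/1≡mkℚ y) (/1≡mkℚ z)

/1-neg : ∀ z → - (z / 1) ≡ (ℤ.- z) / 1
/1-neg z = trans (l₁ (z / 1)) (trans (/1-* ℤ.-1ℤ z) (cong (_/ 1) (l₂ z)))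
  where
  l₁ : ∀ x → - x ≡ - 1ℚ * x
  l₁ = solve-∀ ℚ-ring
  l₂ : ∀ z → ℤ.-1ℤ ℤ.* z ≡ ℤ.- z
  l₂ = ℤ-Solver.solve-∀

int : ∀ z → IsInt (z / 1)
int z = z , refl

int-0 : IsInt 0ℚ
int-0 = int (pos 0)

int-1 : IsInt 1ℚ
int-1 = int (pos 1)

int-+ : ∀ {x y} → IsInt x → IsInt y → IsInt (x + y)
int-+ (y , refl) (z , refl) = y ℤ.+ z , /1-+ y z

int-* : ∀ {x y} → IsInt x → IsInt y → IsInt (x * y)
int-* (y , refl) (z , refl) = y ℤ.* z , /1-* y z

int-neg : ∀ {x} → IsInt x → IsInt (- x)
int-neg (z , refl) = ℤ.- z , /1-neg z

int-sub : ∀ {x y} → IsInt x → IsInt y → IsInt (x - y)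
int-sub ix iy = int-+ ix (int-neg iy)

int-sumF : {f : Fin n → ℚ} → (∀ i → IsInt (f i)) → IsInt (sumF f)
int-sumF {zero}  h = int-0
int-sumF {suc n} h = int-+ (h Fin.zero) (int-sumF (h ∘ Fin.suc))

int-δ : (i j : Fin n) → IsInt (δ i j)
int-δ i j with i Fin.≟ j
... | yes _ = int-1
... | no  _ = int-0

-- A wrapper from which Agda can infer the modulus.
record Div (m : ℕ) (x : ℚ) : Set where
  constructor ⟨_⟩
  field divQ : DivQ m x
open Div public

div-0 : ∀ m → Div m 0ℚ
div-0 m = ⟨ pos 0 , cong (_/ 1) (sym (ℤₚ.*-zeroʳ (pos m))) ⟩

div-+ : ∀ {m x y} → Div m x → Div m y → Div m (x + y)
div-+ {m} ⟨ y , refl ⟩ ⟨ z , refl ⟩ = ⟨ y ℤ.+ z ,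
  trans (/1-+ (pos m ℤ.* y) (pos m ℤ.* z)) (cong (_/ 1) (sym (ℤₚ.*-distribˡ-+ (pos m) y z))) ⟩

div-*ʳ : ∀ {m x y} → Div m x → IsInt y → Div m (x * y)
div-*ʳ {m} ⟨ y , refl ⟩ (z , refl) = ⟨ y ℤ.* z ,
  trans (/1-* (pos m ℤ.* y) z) (cong (_/ 1) (ℤₚ.*-assoc (pos m) y z)) ⟩

div-resp : ∀ {m x y} → x ≡ y → Div m x → Div m y
div-resp refl d = d

div-*ˡ : ∀ {m x y} → IsInt x → Div m y → Div m (x * y)
div-*ˡ {x = x} {y} ix dy = div-resp (*-comm y x) (div-*ʳ dy ix)

div-neg : ∀ {m x} → Div m x → Div m (- x)
div-neg {x = x} d = div-resp (l x) (div-*ˡ (int-neg int-1) d)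
  where
  l : ∀ x → - 1ℚ * x ≡ - x
  l = solve-∀ ℚ-ring

div-sub : ∀ {m x y} → Div m x → Div m y → Div m (x - y)
div-sub dx dy = div-+ dx (div-neg dy)

div-sumF : ∀ {m} {f : Fin n → ℚ} → (∀ i → Div m (f i)) → Div m (sumF f)
div-sumF {zero}  {m} h = div-0 m
div-sumF {suc n} h = div-+ (h Fin.zero) (div-sumF (h ∘ Fin.suc))

div-shift : ∀ {m} x y → Div m (x - y) → Div m x → Div m y
div-shift x y d dx = div-resp (l x y) (div-sub dx d)
  where
  l : ∀ x y → x - (x - y) ≡ y
  l = solve-∀ ℚ-ring

div⇒∣ : ∀ {m} z → Div m (z / 1) → m ∣ ℤ.∣ z ∣
div⇒∣ {m} z ⟨ k , eq ⟩ with /1-injective {z} {pos m ℤ.* k} eq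
... | refl = divides ℤ.∣ k ∣ (trans (ℤₚ.abs-* (pos m) k) (ℕₚ.*-comm m ℤ.∣ k ∣))

∣⇒div : ∀ {m} z → m ∣ ℤ.∣ z ∣ → Div m (z / 1)
∣⇒div {m} z h with Signed.∣ᵤ⇒∣ {pos m} {z} h
... | Signed.divides q eq = ⟨ q , cong (_/ 1) (trans eq (ℤₚ.*-comm q (pos m))) ⟩

div? : ∀ m {x} → IsInt x → Dec (Div m x)
div? m (z , refl) = map′ (∣⇒div z) (div⇒∣ z) (m ∣.∣? ℤ.∣ z ∣)

div-∣ : ∀ {m n x} → m ∣ n → Div n x → Div m x
div-∣ {m} {n} m∣n ⟨ z , refl ⟩ = ∣⇒div (pos n ℤ.* z)
  (subst (m ∣_) (sym (ℤₚ.abs-* (pos n) z)) (∣.∣m⇒∣m*n ℤ.∣ z ∣ m∣n))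

div-coprime : ∀ {m n x} → Coprime m n → Div m x → Div n x → Div (m ℕ.* n) x
div-coprime {m} {n} {x} cop dm@(⟨ z , refl ⟩) dn
  with Coprimality.coprime-divisor (Coprimality.sym cop)
         (subst (n ∣_) (ℤₚ.abs-* (pos m) z) (div⇒∣ (pos m ℤ.* z) dn))
... | n∣z = ∣⇒div (pos m ℤ.* z) (subst (m ℕ.* n ∣_) (sym (ℤₚ.abs-* (pos m) z)) (∣.*-monoʳ-∣ m n∣z))

div-euclid : ∀ {p x y} → Prime p → IsInt x → IsInt y → Div p (x * y) → Div p x ⊎ Div p y
div-euclid {p} pp (y , refl) (z , refl) d
  with euclidsLemma ℤ.∣ y ∣ ℤ.∣ z ∣ pp
         (subst (p ∣_) (ℤₚ.abs-* y z) (div⇒∣ (y ℤ.* z) (div-resp (/1-* y z) d)))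
... | inj₁ h = inj₁ (∣⇒div y h)
... | inj₂ h = inj₂ (∣⇒div z h)

¬div-1 : ∀ {p} → Prime p → ¬ Div p 1ℚ
¬div-1 pp d = ¬prime[1] (subst Prime (∣.∣1⇒≡1 (div⇒∣ (pos 1) d)) pp)

identity⇒combination : ∀ {d m n} → GCD.Bézout.Identity.Identity d m n →
  ∃[ u ] ∃[ v ] (u ℤ.* pos m ℤ.+ v ℤ.* pos n ≡ pos d)
identity⇒combination {d} {m} {n} (GCD.Bézout.Identity.+- x y eq) = pos x , ℤ.- pos y , (begin
  pos x ℤ.* pos m ℤ.+ ℤ.- pos y ℤ.* pos n      ≡⟨ cong (ℤ._+ ℤ.- pos y ℤ.* pos n) (trans (sym (ℤₚ.pos-* x m)) (trans (cong pos (sym eq)) (trans (ℤₚ.pos-+ d (y ℕ.* n)) (cong (λ t → pos d ℤ.+ t) (ℤₚ.pos-* y n))))) ⟩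
  pos d ℤ.+ pos y ℤ.* pos n ℤ.+ ℤ.- pos y ℤ.* pos n ≡⟨ l (pos d) (pos y) (pos n) ⟩
  pos d ∎)
  where
  open ≡-Reasoning
  l : ∀ d y n → d ℤ.+ y ℤ.* n ℤ.+ ℤ.- y ℤ.* n ≡ d
  l = ℤ-Solver.solve-∀
identity⇒combination {d} {m} {n} (GCD.Bézout.Identity.-+ x y eq)
  with identity⇒combination {d} {n} {m} (GCD.Bézout.Identity.+- y x eq)
... | u , v , e = v , u , trans (ℤₚ.+-comm (v ℤ.* pos m) (u ℤ.* pos n)) e

coprime-combination : ∀ {m n} → Coprime m n →
  ∃[ u ] ∃[ v ] IsInt u × IsInt v × u * ((pos m) / 1) + v * ((pos n) / 1) ≡ 1ℚ
coprime-combination {m} {n} cop with identity⇒combination (Coprimality.coprime-Bézout cop)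
... | u , v , eq = u / 1 , v / 1 , int u , int v ,
  trans (cong₂ _+_ (/1-* u (pos m)) (/1-* v (pos n))) (trans (/1-+ (u ℤ.* pos m) (v ℤ.* pos n)) (cong (_/ 1) eq))

-- The cofactors satisfy `unit` even for a = b = 0, where g = 0; so (a₀, b₀) can always be completed
-- to a matrix in SL₂(ℤ).
record Bezout (a b : ℚ) : Set where
  field
    {g a₀ b₀ x y} : ℚ
    int-g  : IsInt g
    int-a₀ : IsInt a₀
    int-b₀ : IsInt b₀
    int-x  : IsInt x
    int-y  : IsInt y
    a≡     : a ≡ g * a₀
    b≡     : b ≡ g * b₀
    unit   : x * a₀ + y * b₀ ≡ 1ℚ

private
  record Bezoutℤ (a b : ℤ) : Set where
    field
      {g a₀ b₀ x y} : ℤ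
      a≡     : a ≡ g ℤ.* a₀
      b≡     : b ≡ g ℤ.* b₀
      unit   : x ℤ.* a₀ ℤ.+ y ℤ.* b₀ ≡ pos 1

  bezout-ℕ : ∀ m n → Bezoutℤ (pos m) (pos n)
  bezout-ℕ m n with GCD.Bézout.lemma m n
  ... | GCD.Bézout.result 0 gcd _ with ∣.0∣⇒≡0 (GCD.GCD.gcd∣m gcd) | ∣.0∣⇒≡0 (GCD.GCD.gcd∣n gcd)
  ...   | refl | refl = record { g = pos 0 ; a₀ = pos 1 ; b₀ = pos 0 ; x = pos 1 ; y = pos 0 ; a≡ = refl ; b≡ = refl ; unit = refl }
  bezout-ℕ m n | GCD.Bézout.result d@(suc _) gcd id
    with identity⇒combination id | GCD.GCD.gcd∣m gcd | GCD.GCD.gcd∣n gcd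
  ... | u , v , eq | divides m′ refl | divides n′ refl = record
    { g = pos d ; a₀ = pos m′ ; b₀ = pos n′ ; x = u ; y = v
    ; a≡ = trans (ℤₚ.pos-* m′ d) (ℤₚ.*-comm (pos m′) (pos d))
    ; b≡ = trans (ℤₚ.pos-* n′ d) (ℤₚ.*-comm (pos n′) (pos d))
    ; unit = ℤₚ.*-cancelʳ-≡ _ _ (pos d) (begin
        (u ℤ.* pos m′ ℤ.+ v ℤ.* pos n′) ℤ.* pos d ≡⟨ l u (pos m′) v (pos n′) (pos d) ⟩
        u ℤ.* (pos m′ ℤ.* pos d) ℤ.+ v ℤ.* (pos n′ ℤ.* pos d)
          ≡⟨ cong₂ (λ s t → u ℤ.* s ℤ.+ v ℤ.* t) (sym (ℤₚ.pos-* m′ d)) (sym (ℤₚ.pos-* n′ d)) ⟩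
        u ℤ.* pos (m′ ℕ.* d) ℤ.+ v ℤ.* pos (n′ ℕ.* d) ≡⟨ eq ⟩
        pos d ≡⟨ sym (ℤₚ.*-identityˡ (pos d)) ⟩
        pos 1 ℤ.* pos d ∎) }
    where
    open ≡-Reasoning
    l : ∀ u m v n d → (u ℤ.* m ℤ.+ v ℤ.* n) ℤ.* d ≡ u ℤ.* (m ℤ.* d) ℤ.+ v ℤ.* (n ℤ.* d)
    l = ℤ-Solver.solve-∀

  bezout-negˡ : ∀ {a b} → Bezoutℤ a b → Bezoutℤ (ℤ.- a) b
  bezout-negˡ z = record
    { g = g ; a₀ = ℤ.- a₀ ; b₀ = b₀ ; x = ℤ.- x ; y = y
    ; a≡ = trans (cong ℤ.-_ a≡) (l₁ g a₀) ; b≡ = b≡ ; unit = trans (l₂ x a₀ (y ℤ.* b₀)) unit }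
    where
    open Bezoutℤ z
    l₁ : ∀ g a → ℤ.- (g ℤ.* a) ≡ g ℤ.* ℤ.- a
    l₁ = ℤ-Solver.solve-∀
    l₂ : ∀ x a c → ℤ.- x ℤ.* ℤ.- a ℤ.+ c ≡ x ℤ.* a ℤ.+ c
    l₂ = ℤ-Solver.solve-∀

  bezout-swap : ∀ {a b} → Bezoutℤ a b → Bezoutℤ b a
  bezout-swap z = record
    { g = g ; a₀ = b₀ ; b₀ = a₀ ; x = y ; y = x
    ; a≡ = b≡ ; b≡ = a≡ ; unit = trans (ℤₚ.+-comm (y ℤ.* b₀) (x ℤ.* a₀)) unit }
    where open Bezoutℤ z

  bezoutℤ : ∀ a b → Bezoutℤ a b
  bezoutℤ (pos m)        (pos n)        = bezout-ℕ m n
  bezoutℤ (pos m)        (ℤ.-[1+ n ]) = bezout-swap (bezout-negˡ (bezout-ℕ (suc n) m))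
  bezoutℤ (ℤ.-[1+ m ]) (pos n)        = bezout-negˡ (bezout-ℕ (suc m) n)
  bezoutℤ (ℤ.-[1+ m ]) (ℤ.-[1+ n ]) = bezout-negˡ (bezout-swap (bezout-negˡ (bezout-ℕ (suc n) (suc m))))

abstract
  bezout : ∀ {a b} → IsInt a → IsInt b → Bezout a b
  bezout (a , refl) (b , refl) = record
    { int-g = int g ; int-a₀ = int a₀ ; int-b₀ = int b₀ ; int-x = int x ; int-y = int y
    ; a≡ = trans (cong (_/ 1) a≡) (sym (/1-* g a₀))
    ; b≡ = trans (cong (_/ 1) b≡) (sym (/1-* g b₀))
    ; unit = trans (cong₂ _+_ (/1-* x a₀) (/1-* y b₀)) (trans (/1-+ (x ℤ.* a₀) (y ℤ.* b₀)) (cong (_/ 1) unit)) }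
    where open Bezoutℤ (bezoutℤ a b)

-- Square-free moduli and the Chinese remainder theorem

prime-∤⇒coprime : ∀ {p n} → Prime p → ¬ p ∣ n → Coprime p n
prime-∤⇒coprime pp p∤n (d∣p , d∣n) with prime⇒irreducible pp d∣p
... | inj₁ d≡1  = d≡1
... | inj₂ refl = contradiction d∣n p∤n

prime-inverse : ∀ {p x} → Prime p → IsInt x → ¬ Div p x → ∃[ y ] IsInt y × Div p (1ℚ - x * y)
prime-inverse {p} pp (z , refl) p∤z
  -- Bézout is applied to the absolute value of z; the sign is then moved into the inverse.
  with coprime-combination (prime-∤⇒coprime {n = ℤ.∣ z ∣} pp (λ h → p∤z (∣⇒div z h))) | ℤₚ.+∣i∣≡i⊎+∣i∣≡-i z
... | u , v , iu , iv , eq | inj₁ e = v , iv , div-resp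
  (trans (l u ((pos p) / 1) v ((pos ℤ.∣ z ∣) / 1)) (cong₂ _-_ eq (cong (λ t → t / 1 * v) e)))
  (div-*ˡ iu (∣⇒div (pos p) ∣.∣-refl))
  where
  l : ∀ u p v z → u * p ≡ (u * p + v * z) - z * v
  l = solve-∀ ℚ-ring
... | u , v , iu , iv , eq | inj₂ e = - v , int-neg iv , div-resp
  (trans (l u ((pos p) / 1) v ((pos ℤ.∣ z ∣) / 1)) (cong₂ _-_ eq (trans (cong (λ t → t / 1 * v) e) (trans (cong (_* v) (sym (/1-neg z))) (l′ (z / 1) v)))))
  (div-*ˡ iu (∣⇒div (pos p) ∣.∣-refl))
  where
  l : ∀ u p v z → u * p ≡ (u * p + v * z) - z * v
  l = solve-∀ ℚ-ring
  l′ : ∀ z v → - z * v ≡ z * - v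
  l′ = solve-∀ ℚ-ring

-- Square-freeness makes each prime factor coprime to the product of the remaining ones, which is
-- what gluing prime by prime requires.
squarefree-induction : (P : ℕ → Set) → P 1 →
  (∀ p n → Prime p → Coprime p n → P n → P (p ℕ.* n)) →
  ∀ {N} → 0 < N → SquareFree N → P N
squarefree-induction P base step {N} 0<N sf =
  subst P (sym isFactorisation) (go factors factorsPrime (subst SquareFree isFactorisation sf))
  where
  instance _ = ℕ.>-nonZero 0<N
  open PrimeFactorisation (factorise N)
  go : ∀ ps → All Prime ps → SquareFree (product ps) → P (product ps)
  go []       []               _  = base
  go (p ∷ ps) (pp ∷ primes) sf = step p (product ps) pp
    (prime-∤⇒coprime pp (λ p∣ps → ¬prime[1] (subst Prime (sf p (∣.*-monoʳ-∣ p p∣ps)) pp)))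
    (go ps primes (λ d dd∣ → sf d (∣.∣n⇒∣m*n p dd∣)))

prime-∣-prime : ∀ {p q} → Prime p → Prime q → p ∣ q → p ≡ q
prime-∣-prime pp pq p∣q with prime⇒irreducible pq p∣q
... | inj₁ refl = contradiction pp ¬prime[1]
... | inj₂ p≡q  = p≡q

div-squarefree : ∀ {N x} → 0 < N → SquareFree N → IsInt x →
  (∀ p → Prime p → p ∣ N → Div p x) → Div N x
div-squarefree {x = x} 0<N sf ix = squarefree-induction
  (λ N → (∀ p → Prime p → p ∣ N → Div p x) → Div N x)
  (λ _ → ⟨ proj₁ ix , trans (proj₂ ix) (cong (_/ 1) (sym (ℤₚ.*-identityˡ (proj₁ ix)))) ⟩)
  (λ p n pp cop ih h → div-coprime cop (h p pp (∣.m∣m*n n)) (ih (λ q pq q∣n → h q pq (∣.∣n⇒∣m*n p q∣n))))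
  0<N sf

module _ (R : ℕ → ℚ → Set)
         (resp : ∀ {p} x y → IsInt x → IsInt y → Div p (x - y) → R p x → R p y) where

  private
    Local Global : ℕ → Set
    Local  N = ∀ p → Prime p → p ∣ N → ∃[ x ] IsInt x × R p x
    Global N = ∃[ x ] IsInt x × (∀ p → Prime p → p ∣ N → R p x)

  abstract
    -- The local conditions are arbitrary properties stable under congruence rather than prescribed
    -- residues, so that alternatives such as "b ≡ 0 or a + k b ≡ 0" can be imposed directly.
    crt : ∀ {N} → 0 < N → SquareFree N → Local N → Global N
    crt = squarefree-induction (λ N → Local N → Global N)
      (λ _ → 0ℚ , int-0 , λ p pp p∣1 → contradiction (subst Prime (∣.∣1⇒≡1 p∣1) pp) ¬prime[1])
      step
      where
      l₁ : ∀ x y u p v n → (x * (u * p) + y * (v * n)) ≡ x * (u * p + v * n) + (y - x) * v * n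
      l₁ = solve-∀ ℚ-ring
      l₂ : ∀ x y u p v n → (x * (u * p) + y * (v * n)) ≡ y * (u * p + v * n) + (x - y) * u * p
      l₂ = solve-∀ ℚ-ring
      l₃ : ∀ x z → - z ≡ x - (x * 1ℚ + z)
      l₃ = solve-∀ ℚ-ring
      step : ∀ p n → Prime p → Coprime p n → (Local n → Global n) → Local (p ℕ.* n) → Global (p ℕ.* n)
      step p n pp cop ih local
        with coprime-combination cop | ih (λ q pq q∣n → local q pq (∣.∣n⇒∣m*n p q∣n)) | local p pp (∣.m∣m*n n)
      ... | u , v , iu , iv , eq | x , ix , hx | y , iy , hy = z , iz , good
        where
        P M z : ℚ
        P = (pos p) / 1
        M = (pos n) / 1
        -- As u p + v n = 1, this is x modulo n and y modulo p.
        z = x * (u * P) + y * (v * M)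
        iz : IsInt z
        iz = int-+ (int-* ix (int-* iu (int (pos p)))) (int-* iy (int-* iv (int (pos n))))
        good : ∀ q → Prime q → q ∣ p ℕ.* n → R q z
        good q pq q∣pn with euclidsLemma p n pq q∣pn
        ... | inj₁ q∣p with prime-∣-prime pq pp q∣p
        ...   | refl = resp y z iy iz
          (div-resp (trans (l₃ y ((x - y) * u * P)) (cong (λ t → y - t)
              (trans (cong (λ t → y * t + (x - y) * u * P) (sym eq)) (sym (l₂ x y u P v M)))))
            (div-neg (div-*ˡ (int-* (int-sub ix iy) iu) (∣⇒div (pos p) ∣.∣-refl)))) hy
        good q pq q∣pn | inj₂ q∣n = resp x z ix iz
          (div-resp (trans (l₃ x ((y - x) * v * M)) (cong (λ t → x - t)
              (trans (cong (λ t → x * t + (y - x) * v * M) (sym eq)) (sym (l₁ x y u P v M)))))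
            (div-neg (div-*ˡ (int-* (int-sub iy ix) iv) (∣⇒div (pos n) q∣n)))) (hx q pq q∣n)

-- Linear dependence modulo a prime ideal

#ᵇ : Bool → ℕ
#ᵇ b = if b then 1 else 0

count : (Fin n → Bool) → ℕ
count {zero}  b = 0
count {suc n} b = #ᵇ (b Fin.zero) ℕ.+ count (b ∘ Fin.suc)

count-cong : {b c : Fin n → Bool} → (∀ i → b i ≡ c i) → count b ≡ count c
count-cong {zero}  eq = refl
count-cong {suc n} eq = cong₂ ℕ._+_ (cong #ᵇ (eq Fin.zero)) (count-cong (eq ∘ Fin.suc))

count-const-false : {b : Fin n → Bool} → (∀ i → b i ≡ false) → count b ≡ 0
count-const-false {zero}  eq = refl
count-const-false {suc n} eq = cong₂ ℕ._+_ (cong #ᵇ (eq Fin.zero)) (count-const-false (eq ∘ Fin.suc))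

count-const-true : {b : Fin n → Bool} → (∀ i → b i ≡ true) → count b ≡ n
count-const-true {zero}  eq = refl
count-const-true {suc n} eq = cong₂ ℕ._+_ (cong #ᵇ (eq Fin.zero)) (count-const-true (eq ∘ Fin.suc))

count-mono : {b c : Fin n → Bool} → (∀ i → b i ≡ true → c i ≡ true) → count b ≤ count c
count-mono {zero}          imp = z≤n
count-mono {suc n} {b} {c} imp = ℕₚ.+-mono-≤ (lem (b Fin.zero) (c Fin.zero) (imp Fin.zero)) (count-mono (imp ∘ Fin.suc))
  where
  lem : ∀ x y → (x ≡ true → y ≡ true) → #ᵇ x ≤ #ᵇ y
  lem false y     h = z≤n
  lem true  true  h = ℕₚ.≤-refl
  lem true  false h with () ← h refl

update : (Fin n → Bool) → Fin n → Bool → Fin n → Bool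
update b Fin.zero    x Fin.zero    = x
update b Fin.zero    x (Fin.suc i) = b (Fin.suc i)
update b (Fin.suc j) x Fin.zero    = b Fin.zero
update b (Fin.suc j) x (Fin.suc i) = update (b ∘ Fin.suc) j x i

update-≡ : ∀ (b : Fin n → Bool) j x → update b j x j ≡ x
update-≡ b Fin.zero    x = refl
update-≡ b (Fin.suc j) x = update-≡ (b ∘ Fin.suc) j x

update-≢ : ∀ (b : Fin n → Bool) {j} x {i} → i ≢ j → update b j x i ≡ b i
update-≢ b {Fin.zero}  x {Fin.zero}  i≢j = contradiction refl i≢j
update-≢ b {Fin.zero}  x {Fin.suc i} i≢j = refl
update-≢ b {Fin.suc j} x {Fin.zero}  i≢j = refl
update-≢ b {Fin.suc j} x {Fin.suc i} i≢j = update-≢ (b ∘ Fin.suc) x (i≢j ∘ cong Fin.suc)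

-- Each side is completed by the bit that the other one counts, which avoids truncated subtraction.
count-update : ∀ (b : Fin n → Bool) j x → count (update b j x) ℕ.+ #ᵇ (b j) ≡ count b ℕ.+ #ᵇ x
count-update b Fin.zero    x = begin
  #ᵇ x ℕ.+ c ℕ.+ #ᵇ (b Fin.zero)   ≡⟨ ℕₚ.+-comm (#ᵇ x ℕ.+ c) _ ⟩
  #ᵇ (b Fin.zero) ℕ.+ (#ᵇ x ℕ.+ c) ≡⟨ cong (#ᵇ (b Fin.zero) ℕ.+_) (ℕₚ.+-comm (#ᵇ x) c) ⟩
  #ᵇ (b Fin.zero) ℕ.+ (c ℕ.+ #ᵇ x) ≡⟨ ℕₚ.+-assoc (#ᵇ (b Fin.zero)) c (#ᵇ x) ⟨
  #ᵇ (b Fin.zero) ℕ.+ c ℕ.+ #ᵇ x   ∎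
  where
  open ≡-Reasoning
  c = count (b ∘ Fin.suc)
count-update b (Fin.suc j) x = trans (ℕₚ.+-assoc (#ᵇ (b Fin.zero)) _ _)
  (trans (cong (#ᵇ (b Fin.zero) ℕ.+_) (count-update (b ∘ Fin.suc) j x))
         (sym (ℕₚ.+-assoc (#ᵇ (b Fin.zero)) _ _)))

count-remove : ∀ (b : Fin n → Bool) j → b j ≡ true → count b ≡ suc (count (update b j false))
count-remove b j bj = begin
  count b                                ≡⟨ ℕₚ.+-identityʳ (count b) ⟨
  count b ℕ.+ 0                          ≡⟨ count-update b j false ⟨
  count (update b j false) ℕ.+ #ᵇ (b j)  ≡⟨ cong (λ x → count (update b j false) ℕ.+ #ᵇ x) bj ⟩
  count (update b j false) ℕ.+ 1         ≡⟨ ℕₚ.+-comm _ 1 ⟩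
  suc (count (update b j false))         ∎
  where open ≡-Reasoning

count-∃ : (b : Fin n → Bool) → 0 < count b → ∃[ j ] b j ≡ true
count-∃ {suc n} b lt with b Fin.zero in eq
... | true  = Fin.zero , eq
... | false with count-∃ (b ∘ Fin.suc) lt
...   | j , bj = Fin.suc j , bj

-- A prime ideal I of a subring O of ℚ; the cases of interest are 0 ⊂ ℚ and pℤ ⊂ ℤ.
record PrimeIdeal : Set₁ where
  field
    O I    : ℚ → Set
    O-0    : O 0ℚ
    O-1    : O 1ℚ
    O-+    : ∀ {x y} → O x → O y → O (x + y)
    O-*    : ∀ {x y} → O x → O y → O (x * y)
    O-neg  : ∀ {x} → O x → O (- x)
    I-0    : I 0ℚ
    I-+    : ∀ {x y} → I x → I y → I (x + y)
    I-*    : ∀ {x y} → O x → I y → I (x * y)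
    I?     : ∀ {x} → O x → Dec (I x)
    I-prime : ∀ {x y} → O x → O y → I (x * y) → I x ⊎ I y
    ¬I-1   : ¬ I 1ℚ

*-cancelʳ-≢0 : ∀ x y t → t ≢ 0ℚ → x * t ≡ y * t → x ≡ y
*-cancelʳ-≢0 x y t t≢0 eq = trans (l x) (trans (cong (_* (1/ t)) eq) (sym (l y)))
  where
  instance _ = ≢-nonZero t≢0
  l : ∀ z → z ≡ z * t * (1/ t)
  l z = sym (trans (*-assoc z t (1/ t)) (trans (cong (z *_) (ℚₚ.*-inverseʳ t)) (*-identityʳ z)))

zeroIdeal : PrimeIdeal
zeroIdeal = record
  { O = λ _ → ⊤ ; I = _≡ 0ℚ
  ; O-0 = _ ; O-1 = _ ; O-+ = _ ; O-* = _ ; O-neg = _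
  ; I-0 = refl ; I-+ = cong₂ _+_ ; I-* = λ { {x} _ refl → *-zeroʳ x }
  ; I? = λ {x} _ → x ℚₚ.≟ 0ℚ ; I-prime = λ {x} {y} _ _ → zero-product x y ; ¬I-1 = λ () }
  where
  zero-product : ∀ x y → x * y ≡ 0ℚ → x ≡ 0ℚ ⊎ y ≡ 0ℚ
  zero-product x y xy with y ℚₚ.≟ 0ℚ
  ... | yes y≡0 = inj₂ y≡0
  ... | no  y≢0 = inj₁ (*-cancelʳ-≢0 x 0ℚ y y≢0 (trans xy (sym (*-zeroˡ y))))

module _ (𝔭 : PrimeIdeal) where
  open PrimeIdeal 𝔭

  private
    O-sumF : {f : Fin n → ℚ} → (∀ i → O (f i)) → O (sumF f)
    O-sumF {zero}  h = O-0
    O-sumF {suc n} h = O-+ (h Fin.zero) (O-sumF (h ∘ Fin.suc))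

    I-sumF : {f : Fin n → ℚ} → (∀ i → I (f i)) → I (sumF f)
    I-sumF {zero}  h = I-0
    I-sumF {suc n} h = I-+ (h Fin.zero) (I-sumF (h ∘ Fin.suc))

    O-δ : (i j : Fin n) → O (δ i j)
    O-δ i j with i Fin.≟ j
    ... | yes _ = O-1
    ... | no  _ = O-0

  -- Fraction-free Gaussian elimination: the columns are those marked by b,
  -- and clearing the first row x with a pivot column j unmarks j.
  dependence : ∀ {A : Set} (xs : List A) (f : A → Fin m → ℚ) → (∀ x j → O (f x j)) →
    (b : Fin m → Bool) → length xs < count b →
    Σ[ c ∈ (Fin m → ℚ) ] (∀ j → O (c j)) × (∀ j → b j ≡ false → c j ≡ 0ℚ) × (∃[ j ] b j ≡ true × ¬ I (c j)) ×
           (∀ x → x ∈ xs → I (sumF (λ j → f x j * c j)))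
  dependence [] f Of b lt with count-∃ b lt
  ... | k , bk = δ k , O-δ k , (λ j bj → δ-≢ {k = k} {l = j} λ { refl → case-bool bk bj }) ,
    (k , bk , λ Ik → ¬I-1 (subst I (δ-refl k) Ik)) , λ _ ()
    where
    case-bool : ∀ {x} → x ≡ true → x ≡ false → ⊥
    case-bool refl ()
  dependence {m} (x ∷ xs) f Of b lt
    with Finₚ.any? (λ j → (b j Bool.≟ true) ×-dec ¬? (I? (Of x j)))
  -- Without a pivot in the marked columns, row x is zero modulo I against every vector supported
  -- there, so the other rows decide.
  ... | no ¬pivot with dependence xs f Of b (ℕₚ.<-trans (ℕₚ.n<1+n _) lt)
  ...   | c , Oc , supp , nz , rel = c , Oc , supp , nz , λ
    { _ (here refl) → I-sumF λ j → first-row j (b j) refl ; y (there y∈) → rel y y∈ }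
    where
    first-row : ∀ j t → b j ≡ t → I (f x j * c j)
    first-row j true  bj = subst I (*-comm (c j) (f x j))
      (I-* (Oc j) (decidable-stable (I? (Of x j)) (λ ¬I → ¬pivot (j , bj , ¬I))))
    first-row j false bj = subst I (sym (trans (cong (f x j *_) (supp j bj)) (*-zeroʳ (f x j)))) I-0
  dependence {m} (x ∷ xs) f Of b lt | yes (k , bk , ¬Iπ)
    with dependence xs (λ y j → f x k * f y j + - (f x j * f y k))
           (λ y j → O-+ (O-* (Of x k) (Of y j)) (O-neg (O-* (Of x j) (Of y k))))
           (update b k false)
           (ℕₚ.≤-pred (subst (suc (length xs) <_) (count-remove b k bk) lt))
  ... | c , Oc , supp , (l , bl , ¬Icl) , rel = c′ , Oc′ , supp′ , (l , trans (sym (update-≢ b false l≢k)) bl , ¬Ic′l) , rel′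
    where
    π = f x k
    S = sumF (λ j → f x j * c j)
    OS : O S
    OS = O-sumF (λ j → O-* (Of x j) (Oc j))
    -- Scaling by the pivot replaces division, and subtracting S in coordinate k makes the sum for
    -- row x vanish exactly. The reduced rows were formed so that their sums against c equal those
    -- of the original rows against c′.
    c′ : Fin m → ℚ
    c′ j = π * c j + - (δ k j * S)
    Oc′ : ∀ j → O (c′ j)
    Oc′ j = O-+ (O-* (Of x k) (Oc j)) (O-neg (O-* (O-δ k j) OS))
    l≢k : l ≢ k
    l≢k refl with () ← trans (sym (update-≡ b k false)) bl
    simp : ∀ π c S → π * c + - (0ℚ * S) ≡ π * c
    simp = solve-∀ ℚ-ring
    c′-≢ : ∀ {j} → j ≢ k → c′ j ≡ π * c j
    c′-≢ {j} j≢k = trans (cong (λ d → π * c j + - (d * S)) (δ-≢ (j≢k ∘ sym))) (simp π (c j) S)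
    supp′ : ∀ j → b j ≡ false → c′ j ≡ 0ℚ
    supp′ j bj = trans (c′-≢ j≢k) (trans (cong (π *_) (supp j (trans (update-≢ b false j≢k) bj))) (*-zeroʳ π))
      where
      j≢k : j ≢ k
      j≢k refl with () ← trans (sym bk) bj
    ¬Ic′l : ¬ I (c′ l)
    ¬Ic′l Ic′l = [ ¬Iπ , ¬Icl ]′ (I-prime (Of x k) (Oc l) (subst I (c′-≢ l≢k) Ic′l))
    expand : ∀ f π c d S → f * (π * c + - (d * S)) ≡ π * (f * c) + (- S) * (f * d)
    expand = solve-∀ ℚ-ring
    row : ∀ y → sumF (λ j → f y j * c′ j) ≡ π * sumF (λ j → f y j * c j) + (- S) * f y k
    row y = begin
      sumF (λ j → f y j * c′ j)
        ≡⟨ sumF-cong (λ j → expand (f y j) π (c j) (δ k j) S) ⟩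
      sumF (λ j → π * (f y j * c j) + (- S) * (f y j * δ k j))
        ≡⟨ sumF-+ (λ j → π * (f y j * c j)) (λ j → (- S) * (f y j * δ k j)) ⟩
      sumF (λ j → π * (f y j * c j)) + sumF (λ j → (- S) * (f y j * δ k j))
        ≡⟨ cong₂ _+_ (sumF-*ˡ π (λ j → f y j * c j)) (sumF-*ˡ (- S) (λ j → f y j * δ k j)) ⟩
      π * sumF (λ j → f y j * c j) + (- S) * sumF (λ j → f y j * δ k j)
        ≡⟨ cong (λ t → π * sumF (λ j → f y j * c j) + (- S) * t)
                (trans (sumF-cong (λ j → cong (f y j *_) (δ-sym k j))) (sumF-δʳ k (f y))) ⟩
      π * sumF (λ j → f y j * c j) + (- S) * f y k ∎
      where open ≡-Reasoning
    first : ∀ π S → π * S + (- S) * π ≡ 0ℚ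
    first = solve-∀ ℚ-ring
    expand′ : ∀ π f g h c → (π * f + - (g * h)) * c ≡ π * (f * c) + (- h) * (g * c)
    expand′ = solve-∀ ℚ-ring
    swap : ∀ a S h → a + (- h) * S ≡ a + (- S) * h
    swap = solve-∀ ℚ-ring
    other : ∀ y → sumF (λ j → (f x k * f y j + - (f x j * f y k)) * c j) ≡
                  π * sumF (λ j → f y j * c j) + (- S) * f y k
    other y = begin
      sumF (λ j → (f x k * f y j + - (f x j * f y k)) * c j)
        ≡⟨ sumF-cong (λ j → expand′ π (f y j) (f x j) (f y k) (c j)) ⟩
      sumF (λ j → π * (f y j * c j) + (- f y k) * (f x j * c j))
        ≡⟨ sumF-+ (λ j → π * (f y j * c j)) (λ j → (- f y k) * (f x j * c j)) ⟩
      sumF (λ j → π * (f y j * c j)) + sumF (λ j → (- f y k) * (f x j * c j))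
        ≡⟨ cong₂ _+_ (sumF-*ˡ π (λ j → f y j * c j)) (sumF-*ˡ (- f y k) (λ j → f x j * c j)) ⟩
      π * sumF (λ j → f y j * c j) + (- f y k) * S
        ≡⟨ swap (π * sumF (λ j → f y j * c j)) S (f y k) ⟩
      π * sumF (λ j → f y j * c j) + (- S) * f y k ∎
      where open ≡-Reasoning
    rel′ : ∀ y → y ∈ x ∷ xs → I (sumF (λ j → f y j * c′ j))
    rel′ _ (here refl) = subst I (sym (trans (row x) (first π S))) I-0
    rel′ y (there y∈)  = subst I (trans (other y) (sym (row y))) (rel y y∈)

sumF-splitAt : (f : Fin m ⊎ Fin n → ℚ) →
  sumF (λ j → f (splitAt m j)) ≡ sumF (f ∘ inj₁) + sumF (f ∘ inj₂)
sumF-splitAt {zero}  {n} f = sym (+-identityˡ (sumF (f ∘ inj₂)))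
sumF-splitAt {suc m} {n} f = trans
  (cong (f (inj₁ Fin.zero) +_) (sumF-splitAt (f ∘ Sum.map₁ Fin.suc)))
  (sym (ℚₚ.+-assoc (f (inj₁ Fin.zero)) (sumF (f ∘ inj₁ ∘ Fin.suc)) (sumF (f ∘ inj₂))))

-- For fixed k the 2n - 1 rows of M other than row k annihilate a common c ≠ 0, so M c = t e_k.
-- Applying A gives c = t A e_k, whence t ≠ 0, and cancelling t in M (t A e_k) = t e_k gives column
-- k of M A = 1.
inverse-flip : (A M : Mat2 n) → A ⊗ M ≈ idM → M ⊗ A ≈ idM
inverse-flip {n} A M AM≈1 i k = go
  where
  _≟ᴵ_ = Sumₚ.≡-dec Fin._≟_ Fin._≟_
  allIdx : List (Idx n)
  allIdx = List.map inj₁ (List.allFin n) ++ List.map inj₂ (List.allFin n)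
  ∈-allIdx : ∀ j → j ∈ allIdx
  ∈-allIdx (inj₁ a) = ∈-++⁺ˡ (∈-map⁺ inj₁ (∈-allFin a))
  ∈-allIdx (inj₂ a) = ∈-++⁺ʳ _ (∈-map⁺ inj₂ (∈-allFin a))
  others : List (Idx n)
  others = List.filter (λ j → ¬? (j ≟ᴵ k)) allIdx
  length-allIdx : length allIdx ≡ n ℕ.+ n
  length-allIdx = trans (Listₚ.length-++ (List.map inj₁ (List.allFin n)))
    (cong₂ ℕ._+_ (trans (Listₚ.length-map inj₁ (List.allFin n)) (Listₚ.length-tabulate {n = n} (λ j → j)))
                 (trans (Listₚ.length-map inj₂ (List.allFin n)) (Listₚ.length-tabulate {n = n} (λ j → j))))
  fewer : length others < count {n ℕ.+ n} (λ _ → true)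
  fewer = subst (length others <_) (trans length-allIdx (sym (count-const-true {n ℕ.+ n} (λ _ → refl))))
    (Listₚ.filter-notAll (λ j → ¬? (j ≟ᴵ k)) allIdx (lose (∈-allIdx k) (λ k≢k → k≢k refl)))
  go : (M ⊗ A) i k ≡ idM i k
  go with dependence zeroIdeal others (λ x j → M x (splitAt n j)) _ (λ _ → true) fewer
  ... | c , _ , _ , (l , _ , cl≢0) , rel = result
    where
    open ≡-Reasoning
    c′ : Idx n → ℚ
    c′ j = c (join n n j)
    t = sumI (λ j → M k j * c′ j)
    toI : ∀ x → sumF (λ j → M x (splitAt n j) * c j) ≡ sumI (λ j → M x j * c′ j)
    toI x = trans (sumF-cong (λ j → cong (λ z → M x (splitAt n j) * c z) (sym (Finₚ.join-splitAt n n j))))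
                  (sumF-splitAt (λ j → M x j * c′ j))
    idM-≢ : ∀ (x y : Idx n) → x ≢ y → idM x y ≡ 0ℚ
    idM-≢ (inj₁ a) (inj₁ b) x≢y = δ-≢ (x≢y ∘ cong inj₁)
    idM-≢ (inj₁ a) (inj₂ b) x≢y = refl
    idM-≢ (inj₂ a) (inj₁ b) x≢y = refl
    idM-≢ (inj₂ a) (inj₂ b) x≢y = δ-≢ (x≢y ∘ cong inj₂)
    idM-≡ : ∀ (x : Idx n) → idM x x ≡ 1ℚ
    idM-≡ (inj₁ a) = δ-refl a
    idM-≡ (inj₂ a) = δ-refl a
    Mc : ∀ x → sumI (λ j → M x j * c′ j) ≡ idM x k * t
    Mc x with x ≟ᴵ k
    ... | yes refl = sym (trans (cong (_* t) (idM-≡ k)) (*-identityˡ t))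
    ... | no  x≢k  = trans (trans (sym (toI x)) (rel x (∈-filter⁺ (λ j → ¬? (j ≟ᴵ k)) (∈-allIdx x) x≢k)))
                           (sym (trans (cong (_* t) (idM-≢ x k x≢k)) (*-zeroˡ t)))
    c′≡ : ∀ x → c′ x ≡ A x k * t
    c′≡ x = begin
      c′ x ≡⟨ sumI-idˡ x c′ ⟨
      sumI (λ j → idM x j * c′ j) ≡⟨ sumI-cong (λ j → cong (_* c′ j) (AM≈1 x j)) ⟨
      sumI (λ j → sumI (λ y → A x y * M y j) * c′ j)
        ≡⟨ sumI-cong (λ j → sym (sumI-*ʳ (c′ j) (λ y → A x y * M y j))) ⟩
      sumI (λ j → sumI (λ y → A x y * M y j * c′ j)) ≡⟨ sumI-swap (λ j y → A x y * M y j * c′ j) ⟩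
      sumI (λ y → sumI (λ j → A x y * M y j * c′ j))
        ≡⟨ sumI-cong (λ y → trans (sumI-cong (λ j → *-assoc (A x y) (M y j) (c′ j)))
             (trans (sumI-*ˡ (A x y) (λ j → M y j * c′ j)) (cong (A x y *_) (Mc y)))) ⟩
      sumI (λ y → A x y * (idM y k * t))
        ≡⟨ sumI-cong (λ y → *-assoc (A x y) (idM y k) t) ⟨
      sumI (λ y → A x y * idM y k * t) ≡⟨ sumI-*ʳ t (λ y → A x y * idM y k) ⟩
      sumI (λ y → A x y * idM y k) * t ≡⟨ cong (_* t) (sumI-idʳ k (λ y → A x y)) ⟩
      A x k * t ∎
    t≢0 : t ≢ 0ℚ
    t≢0 t≡0 = cl≢0 (trans (cong c (sym (Finₚ.join-splitAt n n l)))
      (trans (c′≡ (splitAt n l)) (trans (cong (A (splitAt n l) k *_) t≡0) (*-zeroʳ (A (splitAt n l) k)))))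
    scaled : (M ⊗ A) i k * t ≡ idM i k * t
    scaled = begin
      (M ⊗ A) i k * t ≡⟨ sumI-*ʳ t (λ j → M i j * A j k) ⟨
      sumI (λ j → M i j * A j k * t)
        ≡⟨ sumI-cong (λ j → trans (*-assoc (M i j) (A j k) t) (cong (M i j *_) (sym (c′≡ j)))) ⟩
      sumI (λ j → M i j * c′ j) ≡⟨ Mc i ⟩
      idM i k * t ∎
    result : (M ⊗ A) i k ≡ idM i k
    result = *-cancelʳ-≢0 ((M ⊗ A) i k) (idM i k) t t≢0 scaled

-- The embeddings ξ, the groups P and types

module ⊗ {n} = Monoid (⊗-monoid n)
module ⊗-Reasoning {n} = SetoidReasoning (Monoid.setoid (⊗-monoid n))

idM-adj : adj (idM {n}) ≈ idM
idM-adj (inj₁ a) (inj₁ b) = δ-sym b a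
idM-adj (inj₁ a) (inj₂ b) = refl
idM-adj (inj₂ a) (inj₁ b) = refl
idM-adj (inj₂ a) (inj₂ b) = δ-sym b a

sp-inverseˡ : (A : Mat2 n) → IsSp n A → adj A ⊗ A ≈ idM
sp-inverseˡ = IsSp⇒adj-inverse

sp-inverseʳ : (A : Mat2 n) → IsSp n A → A ⊗ adj A ≈ idM
sp-inverseʳ A sp = inverse-flip (adj A) A (sp-inverseˡ A sp)

sp-idM : IsSp n idM
sp-idM {n} = adj-inverse⇒IsSp idM (λ i j → trans (⊗.identityʳ (adj idM) i j) (idM-adj i j))

sp-adj : (A : Mat2 n) → IsSp n A → IsSp n (adj A)
sp-adj A sp = adj-inverse⇒IsSp (adj A) (λ i j →
  trans (⊗-congʳ (adj A) (adj-involutive A) i j) (sp-inverseʳ A sp i j))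

sp-⊗ : (A B : Mat2 n) → IsSp n A → IsSp n B → IsSp n (A ⊗ B)
sp-⊗ {n} A B spA spB = adj-inverse⇒IsSp (A ⊗ B) (begin
  adj (A ⊗ B) ⊗ (A ⊗ B)     ≈⟨ ⊗-congʳ (A ⊗ B) (adj-⊗ A B) ⟩
  (adj B ⊗ adj A) ⊗ (A ⊗ B) ≈⟨ ⊗-assoc (adj B) (adj A) (A ⊗ B) ⟩
  adj B ⊗ (adj A ⊗ (A ⊗ B)) ≈⟨ ⊗-congˡ (adj B) (begin
      adj A ⊗ (A ⊗ B) ≈⟨ ⊗-assoc (adj A) A B ⟨
      (adj A ⊗ A) ⊗ B ≈⟨ ⊗-congʳ B (sp-inverseˡ A spA) ⟩
      idM ⊗ B         ≈⟨ ⊗.identityˡ B ⟩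
      B               ∎) ⟩
  adj B ⊗ B                 ≈⟨ sp-inverseˡ B spB ⟩
  idM                       ∎)
  where open ⊗-Reasoning {n}

sp-cong : {A B : Mat2 n} → A ≈ B → IsSp n A → IsSp n B
sp-cong {A = A} {B} A≈B sp = adj-inverse⇒IsSp B (λ i j →
  trans (sym (⊗-cong {A = adj A} {adj B} {A} {B} (adj-cong A≈B) A≈B i j)) (sp-inverseˡ A sp i j))

integral-⊗ : {A B : Mat2 n} → IntegralM A → IntegralM B → IntegralM (A ⊗ B)
integral-⊗ iA iB i j = int-+ (int-sumF (λ k → int-* (iA i (inj₁ k)) (iB (inj₁ k) j)))
                             (int-sumF (λ k → int-* (iA i (inj₂ k)) (iB (inj₂ k) j)))

integral-adj : {A : Mat2 n} → IntegralM A → IntegralM (adj A)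
integral-adj iA (inj₁ a) (inj₁ b) = iA (bot b) (bot a)
integral-adj iA (inj₁ a) (inj₂ b) = int-neg (iA (top b) (bot a))
integral-adj iA (inj₂ a) (inj₁ b) = int-neg (iA (bot b) (top a))
integral-adj iA (inj₂ a) (inj₂ b) = iA (top b) (top a)

integral-idM : IntegralM (idM {n})
integral-idM (inj₁ a) (inj₁ b) = int-δ a b
integral-idM (inj₁ a) (inj₂ b) = int-0
integral-idM (inj₂ a) (inj₁ b) = int-0
integral-idM (inj₂ a) (inj₂ b) = int-δ a b

δ-<≤ : ∀ {s} (a b : Fin n) → toℕ a < s → s ≤ toℕ b → δ a b ≡ 0ℚ
δ-<≤ a b a<s s≤b = δ-≢ {k = a} {b} λ { refl → ℕₚ.<⇒≱ a<s s≤b }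

δ-≤< : ∀ {s} (a b : Fin n) → s ≤ toℕ a → toℕ b < s → δ a b ≡ 0ℚ
δ-≤< a b s≤a b<s = trans (δ-sym a b) (δ-<≤ b a b<s s≤a)

ix : Idx n → Fin n
ix (inj₁ a) = a
ix (inj₂ a) = a

idM-≢ : (i j : Idx n) → ix i ≢ ix j → idM i j ≡ 0ℚ
idM-≢ (inj₁ a) (inj₁ b) = δ-≢
idM-≢ (inj₁ a) (inj₂ b) _ = refl
idM-≢ (inj₂ a) (inj₁ b) _ = refl
idM-≢ (inj₂ a) (inj₂ b) = δ-≢

module _ {r n : ℕ} (r≤n : r ≤ n) where

  emb : Fin r → Fin n
  emb a = inject≤ a r≤n

  embI : Idx r → Idx n
  embI = Sum.map emb emb

  emb-< : ∀ a → toℕ (emb a) < r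
  emb-< a = subst (ℕ._< r) (sym (Finₚ.toℕ-inject≤ a r≤n)) (Finₚ.toℕ<n a)

  -- A view of the indices: one below r is presented as an image under `emb`, so that entries of `ξ`
  -- are computed without repeating the comparisons in its definition.
  data Inner? : Fin n → Set where
    inner : ∀ a → Inner? (emb a)
    outer : ∀ {k} → r ≤ toℕ k → Inner? k

  inner? : ∀ k → Inner? k
  inner? k with toℕ k ℕ.<? r
  ... | no ≮r = outer (ℕₚ.≮⇒≥ ≮r)
  ... | yes <r = subst Inner? (Finₚ.toℕ-injective (trans (Finₚ.toℕ-inject≤ (fromℕ< <r) r≤n) (Finₚ.toℕ-fromℕ< <r)))
                   (inner (fromℕ< <r))

  data InnerI? : Idx n → Set where
    inner : ∀ i → InnerI? (embI i)
    outer : ∀ {k} → r ≤ toℕ (ix k) → InnerI? k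

  innerI? : ∀ k → InnerI? k
  innerI? (inj₁ k) with inner? k
  ... | inner a = inner (inj₁ a)
  ... | outer h = outer h
  innerI? (inj₂ k) with inner? k
  ... | inner a = inner (inj₂ a)
  ... | outer h = outer h

  ix-embI : ∀ i → ix (embI i) ≡ emb (ix i)
  ix-embI (inj₁ a) = refl
  ix-embI (inj₂ a) = refl

  outer≢inner : ∀ k i → r ≤ toℕ (ix k) → ix k ≢ ix (embI i)
  outer≢inner k i r≤k eq = ℕₚ.<⇒≱ (emb-< (ix i)) (subst (λ z → r ≤ toℕ z) (trans eq (ix-embI i)) r≤k)

  private
    fromℕ<-emb : ∀ a (p : toℕ (emb a) < r) → fromℕ< p ≡ a
    fromℕ<-emb a p = Finₚ.toℕ-injective (trans (Finₚ.toℕ-fromℕ< p) (Finₚ.toℕ-inject≤ a r≤n))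

  ξ-inner : (ρ : Mat2 r) → ∀ i j → ξ r n ρ (embI i) (embI j) ≡ ρ i j
  ξ-inner ρ (inj₁ a) (inj₁ b) with toℕ (emb a) ℕ.<? r | toℕ (emb b) ℕ.<? r
  ... | yes p | yes q = cong₂ (λ a b → ρ (inj₁ a) (inj₁ b)) (fromℕ<-emb a p) (fromℕ<-emb b q)
  ... | no ¬p | _     = contradiction (emb-< a) ¬p
  ... | yes _ | no ¬q = contradiction (emb-< b) ¬q
  ξ-inner ρ (inj₁ a) (inj₂ b) with toℕ (emb a) ℕ.<? r | toℕ (emb b) ℕ.<? r
  ... | yes p | yes q = cong₂ (λ a b → ρ (inj₁ a) (inj₂ b)) (fromℕ<-emb a p) (fromℕ<-emb b q)
  ... | no ¬p | _     = contradiction (emb-< a) ¬p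
  ... | yes _ | no ¬q = contradiction (emb-< b) ¬q
  ξ-inner ρ (inj₂ a) (inj₁ b) with toℕ (emb a) ℕ.<? r | toℕ (emb b) ℕ.<? r
  ... | yes p | yes q = cong₂ (λ a b → ρ (inj₂ a) (inj₁ b)) (fromℕ<-emb a p) (fromℕ<-emb b q)
  ... | no ¬p | _     = contradiction (emb-< a) ¬p
  ... | yes _ | no ¬q = contradiction (emb-< b) ¬q
  ξ-inner ρ (inj₂ a) (inj₂ b) with toℕ (emb a) ℕ.<? r | toℕ (emb b) ℕ.<? r
  ... | yes p | yes q = cong₂ (λ a b → ρ (inj₂ a) (inj₂ b)) (fromℕ<-emb a p) (fromℕ<-emb b q)
  ... | no ¬p | _     = contradiction (emb-< a) ¬p
  ... | yes _ | no ¬q = contradiction (emb-< b) ¬q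

  ξ-outer : (ρ : Mat2 r) → ∀ i j → r ≤ toℕ (ix i) ⊎ r ≤ toℕ (ix j) → ξ r n ρ i j ≡ idM i j
  ξ-outer ρ (inj₁ a) (inj₁ b) h with toℕ a ℕ.<? r | toℕ b ℕ.<? r
  ... | yes p | yes q = contradiction h [ ℕₚ.<⇒≱ p , ℕₚ.<⇒≱ q ]′
  ... | no ¬p | _     = refl
  ... | yes _ | no ¬q = refl
  ξ-outer ρ (inj₁ a) (inj₂ b) h with toℕ a ℕ.<? r | toℕ b ℕ.<? r
  ... | yes p | yes q = contradiction h [ ℕₚ.<⇒≱ p , ℕₚ.<⇒≱ q ]′
  ... | no ¬p | _     = refl
  ... | yes _ | no ¬q = refl
  ξ-outer ρ (inj₂ a) (inj₁ b) h with toℕ a ℕ.<? r | toℕ b ℕ.<? r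
  ... | yes p | yes q = contradiction h [ ℕₚ.<⇒≱ p , ℕₚ.<⇒≱ q ]′
  ... | no ¬p | _     = refl
  ... | yes _ | no ¬q = refl
  ξ-outer ρ (inj₂ a) (inj₂ b) h with toℕ a ℕ.<? r | toℕ b ℕ.<? r
  ... | yes p | yes q = contradiction h [ ℕₚ.<⇒≱ p , ℕₚ.<⇒≱ q ]′
  ... | no ¬p | _     = refl
  ... | yes _ | no ¬q = refl

sumF-emb : ∀ {r n} (r≤n : r ≤ n) (f : Fin n → ℚ) → (∀ k → r ≤ toℕ k → f k ≡ 0ℚ) →
  sumF f ≡ sumF (f ∘ emb r≤n)
sumF-emb {zero}          r≤n f h = sumF-zero (λ k → h k z≤n)
sumF-emb {suc r} {suc n} (s≤s r≤n) f h = cong (f Fin.zero +_) (sumF-emb r≤n (f ∘ Fin.suc) (λ k r≤k → h (Fin.suc k) (s≤s r≤k)))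

module _ {r n : ℕ} (r≤n : r ≤ n) where

  sumI-emb : (f : Idx n → ℚ) → (∀ k → r ≤ toℕ (ix k) → f k ≡ 0ℚ) → sumI f ≡ sumI (f ∘ embI r≤n)
  sumI-emb f h = cong₂ _+_ (sumF-emb r≤n (f ∘ inj₁) (λ k → h (inj₁ k))) (sumF-emb r≤n (f ∘ inj₂) (λ k → h (inj₂ k)))

  module _ (ρ : Mat2 r) (x : Idx n → ℚ) where

    ξ-column-inner : ∀ j → sumI (λ k → x k * ξ r n ρ k (embI r≤n j)) ≡ sumI (λ i → x (embI r≤n i) * ρ i j)
    ξ-column-inner j = trans
      (sumI-emb _ (λ k r≤k → trans (cong (x k *_) (trans (ξ-outer r≤n ρ k (embI r≤n j) (inj₁ r≤k))
                                      (idM-≢ k (embI r≤n j) (outer≢inner r≤n k j r≤k)))) (*-zeroʳ (x k))))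
      (sumI-cong (λ i → cong (x (embI r≤n i) *_) (ξ-inner r≤n ρ i j)))

    ξ-column-outer : ∀ j → r ≤ toℕ (ix j) → sumI (λ k → x k * ξ r n ρ k j) ≡ x j
    ξ-column-outer j r≤j = trans (sumI-cong (λ k → cong (x k *_) (ξ-outer r≤n ρ k j (inj₂ r≤j)))) (sumI-idʳ j x)

    ξ-row-inner : ∀ i → sumI (λ k → ξ r n ρ (embI r≤n i) k * x k) ≡ sumI (λ k → ρ i k * x (embI r≤n k))
    ξ-row-inner i = trans
      (sumI-emb _ (λ k r≤k → trans (cong (_* x k) (trans (ξ-outer r≤n ρ (embI r≤n i) k (inj₂ r≤k))
                                      (idM-≢ (embI r≤n i) k (outer≢inner r≤n k i r≤k ∘ sym)))) (*-zeroˡ (x k))))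
      (sumI-cong (λ k → cong (_* x (embI r≤n k)) (ξ-inner r≤n ρ i k)))

    ξ-row-outer : ∀ i → r ≤ toℕ (ix i) → sumI (λ k → ξ r n ρ i k * x k) ≡ x i
    ξ-row-outer i r≤i = trans (sumI-cong (λ k → cong (_* x k) (ξ-outer r≤n ρ i k (inj₁ r≤i)))) (sumI-idˡ i x)

  ξ-⊗ : (A B : Mat2 r) → ξ r n (A ⊗ B) ≈ ξ r n A ⊗ ξ r n B
  ξ-⊗ A B i j with innerI? r≤n i | innerI? r≤n j
  ... | inner i | inner j = trans (ξ-inner r≤n (A ⊗ B) i j)
    (sym (trans (ξ-column-inner B (ξ r n A (embI r≤n i)) j) (sumI-cong (λ k → cong (_* B k j) (ξ-inner r≤n A i k)))))
  ... | outer h | _       = trans (ξ-outer r≤n (A ⊗ B) i j (inj₁ h))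
    (sym (trans (ξ-row-outer A (λ k → ξ r n B k j) i h) (ξ-outer r≤n B i j (inj₁ h))))
  ... | inner _ | outer h = trans (ξ-outer r≤n (A ⊗ B) i j (inj₂ h))
    (sym (trans (ξ-column-outer B (ξ r n A i) j h) (ξ-outer r≤n A i j (inj₂ h))))

  idM-embI : ∀ i j → idM (embI r≤n i) (embI r≤n j) ≡ idM i j
  idM-embI (inj₁ a) (inj₁ b) = δ-emb a b
    where
    δ-emb : ∀ a b → δ (emb r≤n a) (emb r≤n b) ≡ δ a b
    δ-emb a b with a Fin.≟ b
    ... | yes refl = δ-refl (emb r≤n a)
    ... | no  a≢b  = δ-≢ (a≢b ∘ Finₚ.inject≤-injective r≤n r≤n a b)
  idM-embI (inj₁ a) (inj₂ b) = refl
  idM-embI (inj₂ a) (inj₁ b) = refl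
  idM-embI (inj₂ a) (inj₂ b) = idM-embI (inj₁ a) (inj₁ b)

  ξ-idM : ξ r n idM ≈ idM
  ξ-idM i j with innerI? r≤n i | innerI? r≤n j
  ... | inner i | inner j = trans (ξ-inner r≤n idM i j) (sym (idM-embI i j))
  ... | outer h | _       = ξ-outer r≤n idM i j (inj₁ h)
  ... | inner _ | outer h = ξ-outer r≤n idM i j (inj₂ h)

  ξ-cong : {A B : Mat2 r} → A ≈ B → ξ r n A ≈ ξ r n B
  ξ-cong {A} {B} A≈B i j with innerI? r≤n i | innerI? r≤n j
  ... | inner i | inner j = trans (ξ-inner r≤n A i j) (trans (A≈B i j) (sym (ξ-inner r≤n B i j)))
  ... | outer h | _       = trans (ξ-outer r≤n A i j (inj₁ h)) (sym (ξ-outer r≤n B i j (inj₁ h)))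
  ... | inner _ | outer h = trans (ξ-outer r≤n A i j (inj₂ h)) (sym (ξ-outer r≤n B i j (inj₂ h)))

  module _ (A : Mat2 r) where

    private
      adj-inner : ∀ i j → adj (ξ r n A) (embI r≤n i) (embI r≤n j) ≡ adj A i j
      adj-inner (inj₁ a) (inj₁ b) = ξ-inner r≤n A (bot b) (bot a)
      adj-inner (inj₁ a) (inj₂ b) = cong -_ (ξ-inner r≤n A (top b) (bot a))
      adj-inner (inj₂ a) (inj₁ b) = cong -_ (ξ-inner r≤n A (bot b) (top a))
      adj-inner (inj₂ a) (inj₂ b) = ξ-inner r≤n A (top b) (top a)

      adj-outer : ∀ i j → r ≤ toℕ (ix i) ⊎ r ≤ toℕ (ix j) → adj (ξ r n A) i j ≡ idM i j
      adj-outer (inj₁ a) (inj₁ b) h = trans (ξ-outer r≤n A (bot b) (bot a) (Sum.swap h)) (δ-sym b a)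
      adj-outer (inj₁ a) (inj₂ b) h = cong -_ (ξ-outer r≤n A (top b) (bot a) (Sum.swap h))
      adj-outer (inj₂ a) (inj₁ b) h = cong -_ (ξ-outer r≤n A (bot b) (top a) (Sum.swap h))
      adj-outer (inj₂ a) (inj₂ b) h = trans (ξ-outer r≤n A (top b) (top a) (Sum.swap h)) (δ-sym b a)

    ξ-adj : adj (ξ r n A) ≈ ξ r n (adj A)
    ξ-adj i j with innerI? r≤n i | innerI? r≤n j
    ... | inner i | inner j = trans (adj-inner i j) (sym (ξ-inner r≤n (adj A) i j))
    ... | outer h | _       = trans (adj-outer i j (inj₁ h)) (sym (ξ-outer r≤n (adj A) i j (inj₁ h)))
    ... | inner _ | outer h = trans (adj-outer i j (inj₂ h)) (sym (ξ-outer r≤n (adj A) i j (inj₂ h)))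

  integral-ξ : {A : Mat2 r} → IntegralM A → IntegralM (ξ r n A)
  integral-ξ {A} iA i j with innerI? r≤n i | innerI? r≤n j
  ... | inner i | inner j = subst IsInt (sym (ξ-inner r≤n A i j)) (iA i j)
  ... | outer h | _       = subst IsInt (sym (ξ-outer r≤n A i j (inj₁ h))) (integral-idM i j)
  ... | inner _ | outer h = subst IsInt (sym (ξ-outer r≤n A i j (inj₂ h))) (integral-idM i j)

  sp-ξ : (A : Mat2 r) → IsSp r A → IsSp n (ξ r n A)
  sp-ξ A sp = adj-inverse⇒IsSp (ξ r n A) (begin
    adj (ξ r n A) ⊗ ξ r n A ≈⟨ ⊗-congʳ (ξ r n A) (ξ-adj A) ⟩
    ξ r n (adj A) ⊗ ξ r n A ≈⟨ ξ-⊗ (adj A) A ⟨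
    ξ r n (adj A ⊗ A)       ≈⟨ ξ-cong {adj A ⊗ A} {idM} (sp-inverseˡ A sp) ⟩
    ξ r n idM               ≈⟨ ξ-idM ⟩
    idM                     ∎)
    where open ⊗-Reasoning {n}

  ξ-inverse : (A B : Mat2 r) → A ⊗ B ≈ idM → ξ r n A ⊗ ξ r n B ≈ idM
  ξ-inverse A B inv i j = trans (sym (ξ-⊗ A B i j)) (trans (ξ-cong {A ⊗ B} {idM} inv i j) (ξ-idM i j))

  ω-ξ : (A : Mat2 r) → ω n r r≤n (ξ r n A) ≈ A
  ω-ξ A (inj₁ a) (inj₁ b) = ξ-inner r≤n A (inj₁ a) (inj₁ b)
  ω-ξ A (inj₁ a) (inj₂ b) = ξ-inner r≤n A (inj₁ a) (inj₂ b)
  ω-ξ A (inj₂ a) (inj₁ b) = ξ-inner r≤n A (inj₂ a) (inj₁ b)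
  ω-ξ A (inj₂ a) (inj₂ b) = ξ-inner r≤n A (inj₂ a) (inj₂ b)

  ξ∈P : (A : Mat2 r) → IsSp r A → InP n r (ξ r n A)
  ξ∈P A sp = sp-ξ A sp
    , (λ a b a<r r≤b → trans (ξ-outer r≤n A (top a) (top b) (inj₂ r≤b)) (δ-<≤ a b a<r r≤b))
    , (λ a b h → ξ-outer r≤n A (bot a) (top b) h)
    , (λ a b r≤a b<r → trans (ξ-outer r≤n A (bot a) (bot b) (inj₁ r≤a)) (δ-≤< a b r≤a b<r))

InP-⊗ : ∀ {s} (p q : Mat2 n) → InP n s p → InP n s q → InP n s (p ⊗ q)
InP-⊗ {n} {s} p q (spp , pA , pC , pD) (spq , qA , qC , qD) = sp-⊗ p q spp spq
  , (λ a b a<s s≤b → zeros (λ k → case-< k (λ k<s → r0 (p (top a) (top k)) (qA k b k<s s≤b)) (λ s≤k → l0 (q (top k) (top b)) (pA a k a<s s≤k)))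
                           (λ k → r0 (p (top a) (bot k)) (qC k b (inj₂ s≤b))))
  , (λ { a b (inj₁ s≤a) → zeros (λ k → l0 (q (top k) (top b)) (pC a k (inj₁ s≤a)))
                                (λ k → case-< k (λ k<s → l0 (q (bot k) (top b)) (pD a k s≤a k<s)) (λ s≤k → r0 (p (bot a) (bot k)) (qC k b (inj₁ s≤k))))
       ; a b (inj₂ s≤b) → zeros (λ k → case-< k (λ k<s → r0 (p (bot a) (top k)) (qA k b k<s s≤b)) (λ s≤k → l0 (q (top k) (top b)) (pC a k (inj₂ s≤k))))
                                (λ k → r0 (p (bot a) (bot k)) (qC k b (inj₂ s≤b))) })
  , (λ a b s≤a b<s → zeros (λ k → l0 (q (top k) (bot b)) (pC a k (inj₁ s≤a)))
                           (λ k → case-< k (λ k<s → l0 (q (bot k) (bot b)) (pD a k s≤a k<s)) (λ s≤k → r0 (p (bot a) (bot k)) (qD k b s≤k b<s))))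
  where
  l0 : ∀ {x} y → x ≡ 0ℚ → x * y ≡ 0ℚ
  l0 y refl = *-zeroˡ y
  r0 : ∀ x {y} → y ≡ 0ℚ → x * y ≡ 0ℚ
  r0 x refl = *-zeroʳ x
  zeros : {f g : Fin n → ℚ} → (∀ k → f k ≡ 0ℚ) → (∀ k → g k ≡ 0ℚ) → sumF f + sumF g ≡ 0ℚ
  zeros f0 g0 = cong₂ _+_ (sumF-zero f0) (sumF-zero g0)
  case-< : ∀ (k : Fin n) {X : Set} → (toℕ k < s → X) → (s ≤ toℕ k → X) → X
  case-< k f g with toℕ k ℕ.<? s
  ... | yes k<s = f k<s
  ... | no  k≮s = g (ℕₚ.≮⇒≥ k≮s)

InP-adj : ∀ {s} (p : Mat2 n) → InP n s p → InP n s (adj p)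
InP-adj p (sp , pA , pC , pD) = sp-adj p sp
  , (λ a b a<s s≤b → pD b a s≤b a<s)
  , (λ a b h → cong -_ (pC b a (Sum.swap h)))
  , (λ a b s≤a b<s → pA b a b<s s≤a)

InP-idM : ∀ {s} → InP n s idM
InP-idM {n} {s} = sp-idM , (λ a b a<s s≤b → δ-<≤ a b a<s s≤b) , (λ _ _ _ → refl)
  , (λ a b s≤a b<s → δ-≤< a b s≤a b<s)

InP-ξ : ∀ {r n s} (r≤n : r ≤ n) → s ≤ r → (p : Mat2 r) → InP r s p → InP n s (ξ r n p)
InP-ξ {r} {n} {s} r≤n s≤r p (sp , pA , pC , pD) = sp-ξ r≤n p sp , A , C , D
  where
  unemb : ∀ {a} → s ≤ toℕ (emb r≤n a) → s ≤ toℕ a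
  unemb {a} = subst (s ≤_) (Finₚ.toℕ-inject≤ a r≤n)
  unemb< : ∀ {a} → toℕ (emb r≤n a) < s → toℕ a < s
  unemb< {a} = subst (ℕ._< s) (Finₚ.toℕ-inject≤ a r≤n)
  A : ∀ (a b : Fin n) → toℕ a < s → s ≤ toℕ b → ξ r n p (top a) (top b) ≡ 0ℚ
  A a b a<s s≤b with inner? r≤n a | inner? r≤n b
  ... | inner a | inner b = trans (ξ-inner r≤n p (top a) (top b)) (pA a b (unemb< a<s) (unemb s≤b))
  ... | outer h | _       = contradiction (ℕₚ.≤-trans s≤r h) (ℕₚ.<⇒≱ a<s)
  ... | inner _ | outer h = trans (ξ-outer r≤n p (top a) (top b) (inj₂ h)) (δ-<≤ (emb r≤n _) b a<s s≤b)
  C : ∀ (a b : Fin n) → (s ≤ toℕ a ⊎ s ≤ toℕ b) → ξ r n p (bot a) (top b) ≡ 0ℚ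
  C a b h with inner? r≤n a | inner? r≤n b
  ... | inner a | inner b = trans (ξ-inner r≤n p (bot a) (top b)) (pC a b (Sum.map unemb unemb h))
  ... | outer h | _       = ξ-outer r≤n p (bot a) (top b) (inj₁ h)
  ... | inner _ | outer h = ξ-outer r≤n p (bot a) (top b) (inj₂ h)
  D : ∀ (a b : Fin n) → s ≤ toℕ a → toℕ b < s → ξ r n p (bot a) (bot b) ≡ 0ℚ
  D a b s≤a b<s with inner? r≤n a | inner? r≤n b
  ... | inner a | inner b = trans (ξ-inner r≤n p (bot a) (bot b)) (pD a b (unemb s≤a) (unemb< b<s))
  ... | _       | outer h = contradiction (ℕₚ.≤-trans s≤r h) (ℕₚ.<⇒≱ b<s)
  ... | outer h | inner _ = trans (ξ-outer r≤n p (bot a) (bot b) (inj₁ h)) (δ-≤< a (emb r≤n _) s≤a b<s)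

-- Types modulo the primes dividing N

Types : ℕ → Set
Types n = ℕ → Fin n → Bool

-- `column` points to the half that vanishes. `row` points to the opposite half: when the columns of
-- one kind vanish in γ, a product γ ρ only sees the rows of ρ that meet the other kind.
column row : Bool → Fin n → Idx n
column false = top
column true  = bot
row    false = bot
row    true  = top

-- Modulo each prime p ∣ N, and for each j, one of the j-th columns of C and D vanishes, as
-- β p j records.  An integral symplectic τ of type β lies in Γ₀(N) times the coordinatewise
-- product of the matrices 1 and J prescribed by β.
HasType : ℕ → Mat2 n → Types n → Set
HasType N τ β = ∀ p → Prime p → p ∣ N → ∀ j k → Div p (τ (bot k) (column (β p j) j))

hasType-cong : ∀ {N} {A B : Mat2 n} {β} → A ≈ B → HasType N A β → HasType N B β
hasType-cong {β = β} A≈B h p pp p∣N j k = div-resp (A≈B (bot k) (column (β p j) j)) (h p pp p∣N j k)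

same-type⇒Γ0 : ∀ {N} → 0 < N → SquareFree N → {σ τ : Mat2 n} → {β : Types n} →
  IsSp n σ → IntegralM σ → HasType N σ β → IsSp n τ → IntegralM τ → HasType N τ β →
  InΓ0 N n (τ ⊗ adj σ)
same-type⇒Γ0 0<N sf {σ} {τ} {β} spσ iσ tσ spτ iτ tτ =
  sp-⊗ τ (adj σ) spτ (sp-adj σ spσ) , integral , λ a b → divQ (div-squarefree 0<N sf (integral (bot a) (top b)) (C a b))
  where
  integral : IntegralM (τ ⊗ adj σ)
  integral = integral-⊗ {A = τ} {adj σ} iτ (integral-adj iσ)
  C : ∀ a b p → Prime p → p ∣ _ → Div p ((τ ⊗ adj σ) (bot a) (top b))
  C a b p pp p∣N = div-+ (div-sumF λ j → first j (β p j) refl) (div-sumF λ j → second j (β p j) refl)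
    where
    first : ∀ j t → β p j ≡ t → Div p (τ (bot a) (top j) * σ (bot b) (bot j))
    first j false eq = div-*ʳ (subst (λ t → Div p (τ (bot a) (column t j))) eq (tτ p pp p∣N j a)) (iσ (bot b) (bot j))
    first j true  eq = div-*ˡ (iτ (bot a) (top j)) (subst (λ t → Div p (σ (bot b) (column t j))) eq (tσ p pp p∣N j b))
    second : ∀ j t → β p j ≡ t → Div p (τ (bot a) (bot j) * - σ (bot b) (top j))
    second j true  eq = div-*ʳ (subst (λ t → Div p (τ (bot a) (column t j))) eq (tτ p pp p∣N j a)) (int-neg (iσ (bot b) (top j)))
    second j false eq = div-*ˡ (iτ (bot a) (bot j)) (div-neg (subst (λ t → Div p (σ (bot b) (column t j))) eq (tσ p pp p∣N j b)))

-- The C-block of d vanishes modulo every ℓ dividing N, so the bottom rows of d τ are there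
-- combinations of the bottom rows of τ alone.
Γ0-type : ∀ {N} {d τ : Mat2 n} {β} → InΓ0 N n d → IntegralM τ → HasType N τ β → HasType N (d ⊗ τ) β
Γ0-type {β = β} (_ , id , Cd) iτ tτ p pp p∣N j k = div-+
  (div-sumF λ a → div-*ʳ (div-∣ p∣N ⟨ Cd k a ⟩) (iτ (top a) (column (β p j) j)))
  (div-sumF λ a → div-*ˡ (id (bot k) (bot a)) (tτ p pp p∣N j a))

module _ {r n : ℕ} (r≤n : r ≤ n) where

  extend : (Fin r → Bool) → (Fin n → Bool) → Fin n → Bool
  extend β γ j with toℕ j ℕ.<? r
  ... | yes j<r = β (fromℕ< j<r)
  ... | no  _   = γ j

  extend-inner : ∀ β γ a → extend β γ (emb r≤n a) ≡ β a
  extend-inner β γ a with toℕ (emb r≤n a) ℕ.<? r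
  ... | yes p = cong β (Finₚ.toℕ-injective (trans (Finₚ.toℕ-fromℕ< p) (Finₚ.toℕ-inject≤ a r≤n)))
  ... | no ¬p = contradiction (emb-< r≤n a) ¬p

  extend-outer : ∀ β γ j → r ≤ toℕ j → extend β γ j ≡ γ j
  extend-outer β γ j r≤j with toℕ j ℕ.<? r
  ... | yes p = contradiction r≤j (ℕₚ.<⇒≱ p)
  ... | no ¬p = refl

  -- If γ is of constant type κ on the first r coordinates, then the bottom rows of γ ⊗ ξ ρ
  -- combine the rows of ρ selected by κ.
  ξ-type : ∀ {N} {γ : Mat2 n} {ρ : Mat2 r} {β : Types n} {κ : ℕ → Bool} {β′ : Types r} →
    IntegralM γ → IntegralM ρ → HasType N γ β → (∀ p a → β p (emb r≤n a) ≡ κ p) →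
    (∀ p → Prime p → p ∣ N → ∀ j k → Div p (ρ (row (κ p) k) (column (β′ p j) j))) →
    HasType N (γ ⊗ ξ r n ρ) (λ p → extend (β′ p) (β p))
  ξ-type {N} {γ} {ρ} {β} {κ} {β′} iγ iρ tγ const tρ p pp p∣N j k with inner? r≤n j
  ... | outer h = subst (λ t → Div p ((γ ⊗ ξ r n ρ) (bot k) (column t j))) (sym (extend-outer (β′ p) (β p) j h))
    (div-resp (sym (ξ-column-outer r≤n ρ (γ (bot k)) (column (β p j) j)
                      (subst (λ z → r ≤ toℕ z) (sym (ix-column (β p j) j)) h)))
              (tγ p pp p∣N j k))
    where
    ix-column : ∀ t (j : Fin n) → ix (column t j) ≡ j
    ix-column false j = refl
    ix-column true  j = refl
  ... | inner a = subst (λ t → Div p ((γ ⊗ ξ r n ρ) (bot k) (column t (emb r≤n a)))) (sym (extend-inner (β′ p) (β p) a))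
    (div-resp (sym (trans (cong (λ z → (γ ⊗ ξ r n ρ) (bot k) z) (sym (embI-column (β′ p a) a)))
                          (ξ-column-inner r≤n ρ (γ (bot k)) (column (β′ p a) a))))
              (go (κ p) refl))
    where
    embI-column : ∀ t a → embI r≤n (column t a) ≡ column t (emb r≤n a)
    embI-column false a = refl
    embI-column true  a = refl
    c = column (β′ p a) a
    γcol : ∀ t → κ p ≡ t → ∀ i → Div p (γ (bot k) (column t (emb r≤n i)))
    γcol t eq i = subst (λ t → Div p (γ (bot k) (column t (emb r≤n i)))) (trans (const p i) eq) (tγ p pp p∣N (emb r≤n i) k)
    ρrow : ∀ t → κ p ≡ t → ∀ i → Div p (ρ (row t i) c)
    ρrow t eq i = subst (λ t → Div p (ρ (row t i) c)) eq (tρ p pp p∣N a i)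
    go : ∀ t → κ p ≡ t → Div p (sumI (λ i → γ (bot k) (embI r≤n i) * ρ i c))
    go false eq = div-+ (div-sumF λ i → div-*ʳ (γcol false eq i) (iρ (top i) c))
                        (div-sumF λ i → div-*ˡ (iγ (bot k) (bot (emb r≤n i))) (ρrow false eq i))
    go true  eq = div-+ (div-sumF λ i → div-*ˡ (iγ (bot k) (top (emb r≤n i))) (ρrow true eq i))
                        (div-sumF λ i → div-*ʳ (γcol true eq i) (iρ (bot i) c))

-- Matrices acting on one or two coordinates

record SL₂ℤ : Set where
  field
    {p q r s} : ℚ
    int-p : IsInt p
    int-q : IsInt q
    int-r : IsInt r
    int-s : IsInt s
    det   : p * s - q * r ≡ 1ℚ

-- For e ≡ 0 this is the identity, for e ≡ 1 the rotation (0 −1; 1 0); as a polynomial in e it is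
-- the product of the elementary matrices (1 −e; 0 1), (1 0; e 1), (1 −e; 0 1).
rotation : ∀ {e} → IsInt e → SL₂ℤ
rotation {e} ie = record
  { p = 1ℚ - e * e ; q = e * e * e - (e + e) ; r = e ; s = 1ℚ - e * e
  ; int-p = i ; int-q = int-sub (int-* (int-* ie ie) ie) (int-+ ie ie) ; int-r = ie ; int-s = i ; det = l e }
  where
  i = int-sub int-1 (int-* ie ie)
  l : ∀ e → (1ℚ - e * e) * (1ℚ - e * e) - (e * e * e - (e + e)) * e ≡ 1ℚ
  l = solve-∀ ℚ-ring

sumF-δ-scaled : ∀ (x : Fin n → ℚ) j c → sumF (λ a → x a * (δ a j * c)) ≡ x j * c
sumF-δ-scaled x j c = trans
  (sumF-cong (λ a → trans (sym (*-assoc (x a) (δ a j) c)) (*-comm (x a * δ a j) c)))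
  (trans (sumF-*ˡ c (λ a → x a * δ a j)) (trans (cong (c *_) (sumF-δʳ j x)) (*-comm c (x j))))

module _ (X : Fin n → SL₂ℤ) where

  open SL₂ℤ

  -- One copy of SL₂ = Sp₂ for each of the mutually orthogonal planes spanned by the j-th top and
  -- the j-th bottom basis vector.
  coordinatewise : Mat2 n
  coordinatewise = blk (λ a b → δ a b * p (X b)) (λ a b → δ a b * q (X b))
                       (λ a b → δ a b * r (X b)) (λ a b → δ a b * s (X b))

  coordinatewise-columnˡ : ∀ (x : Idx n → ℚ) j →
    sumI (λ k → x k * coordinatewise k (top j)) ≡ x (top j) * p (X j) + x (bot j) * r (X j)
  coordinatewise-columnˡ x j = cong₂ _+_ (sumF-δ-scaled (x ∘ inj₁) j (p (X j))) (sumF-δ-scaled (x ∘ inj₂) j (r (X j)))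

  coordinatewise-columnʳ : ∀ (x : Idx n → ℚ) j →
    sumI (λ k → x k * coordinatewise k (bot j)) ≡ x (top j) * q (X j) + x (bot j) * s (X j)
  coordinatewise-columnʳ x j = cong₂ _+_ (sumF-δ-scaled (x ∘ inj₁) j (q (X j))) (sumF-δ-scaled (x ∘ inj₂) j (s (X j)))

  sp-coordinatewise : IsSp n coordinatewise
  sp-coordinatewise = adj-inverse⇒IsSp coordinatewise go
    where
    D = coordinatewise
    f₁ : ∀ p q r s → 1ℚ * s * p + - (1ℚ * q) * r ≡ p * s - q * r
    f₁ = solve-∀ ℚ-ring
    f₂ : ∀ q s → 1ℚ * s * q + - (1ℚ * q) * s ≡ 0ℚ
    f₂ = solve-∀ ℚ-ring
    f₃ : ∀ p r → - (1ℚ * r) * p + 1ℚ * p * r ≡ 0ℚ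
    f₃ = solve-∀ ℚ-ring
    f₄ : ∀ p q r s → - (1ℚ * r) * q + 1ℚ * p * s ≡ p * s - q * r
    f₄ = solve-∀ ℚ-ring
    z₁ : ∀ a b c d → 0ℚ * a * b + - (0ℚ * c) * d ≡ 0ℚ
    z₁ = solve-∀ ℚ-ring
    z₂ : ∀ a b c d → - (0ℚ * a) * b + 0ℚ * c * d ≡ 0ℚ
    z₂ = solve-∀ ℚ-ring
    go : adj D ⊗ D ≈ idM
    go (inj₁ a) (inj₁ b) = trans (coordinatewise-columnˡ (adj D (top a)) b) (lem (b Fin.≟ a))
      where
      lem : Dec (b ≡ a) → δ b a * s (X a) * p (X b) + - (δ b a * q (X a)) * r (X b) ≡ δ a b
      lem (yes refl) rewrite δ-refl b = trans (f₁ (p (X b)) (q (X b)) (r (X b)) (s (X b))) (det (X b))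
      lem (no b≢a) rewrite δ-≢ b≢a | δ-≢ (b≢a ∘ sym) = z₁ (s (X a)) (p (X b)) (q (X a)) (r (X b))
    go (inj₁ a) (inj₂ b) = trans (coordinatewise-columnʳ (adj D (top a)) b) (lem (b Fin.≟ a))
      where
      lem : Dec (b ≡ a) → δ b a * s (X a) * q (X b) + - (δ b a * q (X a)) * s (X b) ≡ 0ℚ
      lem (yes refl) rewrite δ-refl b = f₂ (q (X b)) (s (X b))
      lem (no b≢a) rewrite δ-≢ b≢a = z₁ (s (X a)) (q (X b)) (q (X a)) (s (X b))
    go (inj₂ a) (inj₁ b) = trans (coordinatewise-columnˡ (adj D (bot a)) b) (lem (b Fin.≟ a))
      where
      lem : Dec (b ≡ a) → - (δ b a * r (X a)) * p (X b) + δ b a * p (X a) * r (X b) ≡ 0ℚ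
      lem (yes refl) rewrite δ-refl b = f₃ (p (X b)) (r (X b))
      lem (no b≢a) rewrite δ-≢ b≢a = z₂ (r (X a)) (p (X b)) (p (X a)) (r (X b))
    go (inj₂ a) (inj₂ b) = trans (coordinatewise-columnʳ (adj D (bot a)) b) (lem (b Fin.≟ a))
      where
      lem : Dec (b ≡ a) → - (δ b a * r (X a)) * q (X b) + δ b a * p (X a) * s (X b) ≡ δ a b
      lem (yes refl) rewrite δ-refl b = trans (f₄ (p (X b)) (q (X b)) (r (X b)) (s (X b))) (det (X b))
      lem (no b≢a) rewrite δ-≢ b≢a | δ-≢ (b≢a ∘ sym) = z₂ (r (X a)) (q (X b)) (p (X a)) (s (X b))

  integral-coordinatewise : IntegralM coordinatewise
  integral-coordinatewise (inj₁ a) (inj₁ b) = int-* (int-δ a b) (int-p (X b))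
  integral-coordinatewise (inj₁ a) (inj₂ b) = int-* (int-δ a b) (int-q (X b))
  integral-coordinatewise (inj₂ a) (inj₁ b) = int-* (int-δ a b) (int-r (X b))
  integral-coordinatewise (inj₂ a) (inj₂ b) = int-* (int-δ a b) (int-s (X b))

-- The two letters are the old and the new bit. The new column that has to vanish combines the two
-- old ones, and the entry required to vanish is the coefficient of the old column about which
-- nothing is known.
data Turn (ℓ : ℕ) (X : SL₂ℤ) : (x x′ : Bool) → Set where
  ff : Div ℓ (SL₂ℤ.r X) → Turn ℓ X false false
  ft : Div ℓ (SL₂ℤ.s X) → Turn ℓ X false true
  tf : Div ℓ (SL₂ℤ.p X) → Turn ℓ X true  false
  tt : Div ℓ (SL₂ℤ.q X) → Turn ℓ X true  true

coordinatewise-type : ∀ {N} {τ : Mat2 n} {β β′ : Types n} (X : Fin n → SL₂ℤ) →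
  IntegralM τ → HasType N τ β →
  (∀ ℓ → Prime ℓ → ℓ ∣ N → ∀ j → Turn ℓ (X j) (β ℓ j) (β′ ℓ j)) →
  HasType N (τ ⊗ coordinatewise X) β′
coordinatewise-type {τ = τ} {β} {β′} X iτ tτ turn ℓ pℓ ℓ∣N j k = go (β ℓ j) (β′ ℓ j) (turn ℓ pℓ ℓ∣N j) (tτ ℓ pℓ ℓ∣N j k)
  where
  open SL₂ℤ (X j)
  go : ∀ x x′ → Turn ℓ (X j) x x′ → Div ℓ (τ (bot k) (column x j)) →
       Div ℓ ((τ ⊗ coordinatewise X) (bot k) (column x′ j))
  go _ _ (ff d) h = div-resp (sym (coordinatewise-columnˡ X (τ (bot k)) j)) (div-+ (div-*ʳ h int-p) (div-*ˡ (iτ (bot k) (bot j)) d))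
  go _ _ (tf d) h = div-resp (sym (coordinatewise-columnˡ X (τ (bot k)) j)) (div-+ (div-*ˡ (iτ (bot k) (top j)) d) (div-*ʳ h int-r))
  go _ _ (ft d) h = div-resp (sym (coordinatewise-columnʳ X (τ (bot k)) j)) (div-+ (div-*ʳ h int-q) (div-*ˡ (iτ (bot k) (bot j)) d))
  go _ _ (tt d) h = div-resp (sym (coordinatewise-columnʳ X (τ (bot k)) j)) (div-+ (div-*ˡ (iτ (bot k) (top j)) d) (div-*ʳ h int-s))

Bit : Bool → ℕ → ℚ → Set
Bit false ℓ e = Div ℓ e
Bit true  ℓ e = Div ℓ (1ℚ - e)

idempotent : ∀ {N} → 0 < N → SquareFree N → (b : ℕ → Bool) →
  ∃[ e ] IsInt e × (∀ ℓ → Prime ℓ → ℓ ∣ N → Bit (b ℓ) ℓ e)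
idempotent 0<N sf b = crt (λ ℓ e → Bit (b ℓ) ℓ e) transfer 0<N sf (λ ℓ _ _ → local ℓ (b ℓ))
  where
  l : ∀ x y → (x - y) + (1ℚ - x) ≡ 1ℚ - y
  l = solve-∀ ℚ-ring
  transfer : ∀ {ℓ} x y → IsInt x → IsInt y → Div ℓ (x - y) → Bit (b ℓ) ℓ x → Bit (b ℓ) ℓ y
  transfer {ℓ} x y _ _ d h with b ℓ
  ... | false = div-shift x y d h
  ... | true  = div-resp (l x y) (div-+ d h)
  local : ∀ ℓ t → ∃[ e ] IsInt e × Bit t ℓ e
  local ℓ false = 0ℚ , int-0 , div-0 ℓ
  local ℓ true  = 1ℚ , int-1 , div-0 ℓ

module _ {ℓ : ℕ} {e : ℚ} (ie : IsInt e) where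

  private
    l : ∀ e → (1ℚ - e) * (1ℚ + e) ≡ 1ℚ - e * e
    l = solve-∀ ℚ-ring

  rotation-0 : Div ℓ e → Div ℓ (SL₂ℤ.q (rotation ie))
  rotation-0 d = div-sub (div-*ˡ (int-* ie ie) d) (div-+ d d)

  rotation-1 : Div ℓ (1ℚ - e) → Div ℓ (1ℚ - e * e)
  rotation-1 d = div-resp (l e) (div-*ʳ d (int-+ int-1 ie))

  rotation-turn : ∀ x x′ → Bit (x xor x′) ℓ e → Turn ℓ (rotation ie) x x′
  rotation-turn false false d = ff d
  rotation-turn false true  d = ft (rotation-1 d)
  rotation-turn true  false d = tf (rotation-1 d)
  rotation-turn true  true  d = tt (rotation-0 d)

-- The identity has type 0 at every prime, and a rotation in each plane turns it where β is 1. The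
-- factor `idM` is kept because `coordinatewise-type` speaks of products.
sp-of-type : ∀ {N} → 0 < N → SquareFree N → (β : Types n) →
  ∃[ τ ] IsSp n τ × IntegralM τ × HasType N τ β
sp-of-type {n} {N} 0<N sf β = idM ⊗ coordinatewise X
  , sp-⊗ idM (coordinatewise X) sp-idM (sp-coordinatewise X)
  , integral-⊗ {A = idM} {coordinatewise X} integral-idM (integral-coordinatewise X)
  , coordinatewise-type X integral-idM (λ ℓ _ _ _ _ → div-0 ℓ)
      (λ ℓ pℓ ℓ∣N j → rotation-turn (proj₁ (proj₂ (e j))) false (β ℓ j) (proj₂ (proj₂ (e j)) ℓ pℓ ℓ∣N))
  where
  e : ∀ j → ∃[ e ] IsInt e × (∀ ℓ → Prime ℓ → ℓ ∣ N → Bit (false xor β ℓ j) ℓ e)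
  e j = idempotent 0<N sf (λ ℓ → β ℓ j)
  X : Fin n → SL₂ℤ
  X j = rotation (proj₁ (proj₂ (e j)))

-- The matrix (p q; r s) in rows and columns i, j, and the identity elsewhere. Writing it as the
-- identity plus a correction in δ lets sums be evaluated without distinguishing cases.
pairBlock : Fin n → Fin n → ℚ → ℚ → ℚ → ℚ → Mat n n
pairBlock i j p q r s k l =
  δ k l + (δ k i * ((p - 1ℚ) * δ i l + q * δ j l) + δ k j * (r * δ i l + (s - 1ℚ) * δ j l))

pairBlock-column : ∀ (i j : Fin n) p q r s (x : Fin n → ℚ) l →
  sumF (λ k → x k * pairBlock i j p q r s k l) ≡
  x l + (x i * ((p - 1ℚ) * δ i l + q * δ j l) + x j * (r * δ i l + (s - 1ℚ) * δ j l))
pairBlock-column i j p q r s x l = begin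
  sumF (λ k → x k * (δ k l + (δ k i * u + δ k j * v)))
    ≡⟨ sumF-cong (λ k → expand (x k) (δ k l) (δ k i) u (δ k j) v) ⟩
  sumF (λ k → x k * δ k l + (x k * (δ k i * u) + x k * (δ k j * v)))
    ≡⟨ sumF-+ (λ k → x k * δ k l) (λ k → x k * (δ k i * u) + x k * (δ k j * v)) ⟩
  sumF (λ k → x k * δ k l) + sumF (λ k → x k * (δ k i * u) + x k * (δ k j * v))
    ≡⟨ cong₂ _+_ (sumF-δʳ l x) (trans (sumF-+ (λ k → x k * (δ k i * u)) (λ k → x k * (δ k j * v)))
         (cong₂ _+_ (sumF-δ-scaled x i u) (sumF-δ-scaled x j v))) ⟩
  x l + (x i * u + x j * v) ∎
  where
  open ≡-Reasoning
  u = (p - 1ℚ) * δ i l + q * δ j l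
  v = r * δ i l + (s - 1ℚ) * δ j l
  expand : ∀ x a b u c v → x * (a + (b * u + c * v)) ≡ x * a + (x * (b * u) + x * (c * v))
  expand = solve-∀ ℚ-ring

module _ {i j : Fin n} (i≢j : i ≢ j) where

  module _ (p q r s : ℚ) (x : Fin n → ℚ) where

    private
      value : ∀ l {d e} → δ i l ≡ d → δ j l ≡ e →
        sumF (λ k → x k * pairBlock i j p q r s k l) ≡
        x l + (x i * ((p - 1ℚ) * d + q * e) + x j * (r * d + (s - 1ℚ) * e))
      value l refl refl = pairBlock-column i j p q r s x l

    pairBlock-columnᵢ : sumF (λ k → x k * pairBlock i j p q r s k i) ≡ x i * p + x j * r
    pairBlock-columnᵢ = trans (value i (δ-refl i) (δ-≢ (i≢j ∘ sym))) (f (x i) (x j) p q r s)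
      where
      f : ∀ x y p q r s → x + (x * ((p - 1ℚ) * 1ℚ + q * 0ℚ) + y * (r * 1ℚ + (s - 1ℚ) * 0ℚ)) ≡ x * p + y * r
      f = solve-∀ ℚ-ring

    pairBlock-columnⱼ : sumF (λ k → x k * pairBlock i j p q r s k j) ≡ x i * q + x j * s
    pairBlock-columnⱼ = trans (value j (δ-≢ i≢j) (δ-refl j)) (f (x i) (x j) p q r s)
      where
      f : ∀ x y p q r s → y + (x * ((p - 1ℚ) * 0ℚ + q * 1ℚ) + y * (r * 0ℚ + (s - 1ℚ) * 1ℚ)) ≡ x * q + y * s
      f = solve-∀ ℚ-ring

    pairBlock-column-≢ : ∀ {l} → l ≢ i → l ≢ j → sumF (λ k → x k * pairBlock i j p q r s k l) ≡ x l
    pairBlock-column-≢ {l} l≢i l≢j = trans (value l (δ-≢ (l≢i ∘ sym)) (δ-≢ (l≢j ∘ sym))) (f (x l) (x i) (x j) p q r s)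
      where
      f : ∀ z x y p q r s → z + (x * ((p - 1ℚ) * 0ℚ + q * 0ℚ) + y * (r * 0ℚ + (s - 1ℚ) * 0ℚ)) ≡ z
      f = solve-∀ ℚ-ring

  module _ (X : SL₂ℤ) where

    open SL₂ℤ X

    -- The Levi embedding U ↦ diag(U, U⁻⊺) of SL₂ acting on coordinates i and j; (s -r; -q p) is the
    -- transposed inverse of (p q; r s).
    pairwise : Mat2 n
    pairwise = blk (pairBlock i j p q r s) (λ _ _ → 0ℚ) (λ _ _ → 0ℚ) (pairBlock i j s (- r) (- q) p)

    pairwise-columnˡ : ∀ (x : Idx n → ℚ) l →
      sumI (λ k → x k * pairwise k (top l)) ≡ sumF (λ k → x (top k) * pairBlock i j p q r s k l)
    pairwise-columnˡ x l = trans (cong (sumF (λ k → x (top k) * pairBlock i j p q r s k l) +_) (sumF-zero (λ k → *-zeroʳ (x (bot k)))))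
      (+-identityʳ (sumF (λ k → x (top k) * pairBlock i j p q r s k l)))

    pairwise-columnʳ : ∀ (x : Idx n → ℚ) l →
      sumI (λ k → x k * pairwise k (bot l)) ≡ sumF (λ k → x (bot k) * pairBlock i j s (- r) (- q) p k l)
    pairwise-columnʳ x l = trans (cong (_+ sumF (λ k → x (bot k) * pairBlock i j s (- r) (- q) p k l)) (sumF-zero (λ k → *-zeroʳ (x (top k)))))
      (+-identityˡ (sumF (λ k → x (bot k) * pairBlock i j s (- r) (- q) p k l)))

    private
      block-inverse : ∀ p q r s → p * s - q * r ≡ 1ℚ → ∀ a l →
        sumF (λ k → pairBlock i j s (- r) (- q) p k a * pairBlock i j p q r s k l) ≡ δ a l
      block-inverse p q r s det a l = trans (pairBlock-column i j p q r s (λ k → pairBlock i j s (- r) (- q) p k a) l)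
        (trans (f p q r s (δ l a) (δ l i) (δ i l) (δ l j) (δ j l) (δ i i) (δ i j) (δ j i) (δ j j) (δ i a) (δ j a)
                  (δ-sym l i) (δ-sym l j) (δ-refl i) (δ-≢ i≢j) (δ-≢ (i≢j ∘ sym)) (δ-refl j))
               (trans (cong (λ z → δ l a + (z - 1ℚ) * (δ i l * δ i a + δ j l * δ j a)) det)
                 (trans (g (δ l a) (δ i l * δ i a + δ j l * δ j a)) (δ-sym l a))))
        where
        g : ∀ x y → x + (1ℚ - 1ℚ) * y ≡ x
        g = solve-∀ ℚ-ring
        h : ∀ p q r s d u v w z →
          (d + (u * ((s - 1ℚ) * w + - r * z) + v * (- q * w + (p - 1ℚ) * z)))
          + ((w + (1ℚ * ((s - 1ℚ) * w + - r * z) + 0ℚ * (- q * w + (p - 1ℚ) * z))) * ((p - 1ℚ) * u + q * v)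
          + (z + (0ℚ * ((s - 1ℚ) * w + - r * z) + 1ℚ * (- q * w + (p - 1ℚ) * z))) * (r * u + (s - 1ℚ) * v))
          ≡ d + ((p * s - q * r) - 1ℚ) * (u * w + v * z)
        h = solve-∀ ℚ-ring
        f : ∀ p q r s d u u′ v v′ ii ij ji jj w z → u ≡ u′ → v ≡ v′ → ii ≡ 1ℚ → ij ≡ 0ℚ → ji ≡ 0ℚ → jj ≡ 1ℚ →
          (d + (u * ((s - 1ℚ) * w + - r * z) + v * (- q * w + (p - 1ℚ) * z)))
          + ((w + (ii * ((s - 1ℚ) * w + - r * z) + ij * (- q * w + (p - 1ℚ) * z))) * ((p - 1ℚ) * u′ + q * v′)
          + (z + (ji * ((s - 1ℚ) * w + - r * z) + jj * (- q * w + (p - 1ℚ) * z))) * (r * u′ + (s - 1ℚ) * v′))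
          ≡ d + ((p * s - q * r) - 1ℚ) * (u′ * w + v′ * z)
        f p q r s d u _ v _ _ _ _ _ w z refl refl refl refl refl refl = h p q r s d u v w z

      zero-neg : ∀ {m} (y : Fin m → ℚ) → sumF (λ k → - 0ℚ * y k) ≡ 0ℚ
      zero-neg y = sumF-zero (λ k → *-zeroˡ (y k))

    sp-pairwise : IsSp n pairwise
    sp-pairwise = adj-inverse⇒IsSp pairwise go
      where
      l₁ : ∀ p q r s → s * p - - r * - q ≡ p * s - q * r
      l₁ = solve-∀ ℚ-ring
      neg : ∀ x → x ≡ - - x
      neg x = sym (neg-involutive x)
      go : adj pairwise ⊗ pairwise ≈ idM
      go (inj₁ a) (inj₁ b) = trans (pairwise-columnˡ (adj pairwise (top a)) b) (block-inverse p q r s det a b)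
      go (inj₁ a) (inj₂ b) = trans (pairwise-columnʳ (adj pairwise (top a)) b) (zero-neg (λ k → pairBlock i j s (- r) (- q) p k b))
      go (inj₂ a) (inj₁ b) = trans (pairwise-columnˡ (adj pairwise (bot a)) b) (zero-neg (λ k → pairBlock i j p q r s k b))
      go (inj₂ a) (inj₂ b) = trans (pairwise-columnʳ (adj pairwise (bot a)) b)
        (trans (sumF-cong (λ k → cong₂ (λ x y → pairBlock i j p x y s k a * pairBlock i j s (- r) (- q) p k b) (neg q) (neg r)))
               (block-inverse s (- r) (- q) p (trans (l₁ p q r s) det) a b))

    integral-pairwise : IntegralM pairwise
    integral-pairwise = λ { (inj₁ a) (inj₁ b) → block a b int-p int-q int-r int-s
                          ; (inj₁ a) (inj₂ b) → int-0
                          ; (inj₂ a) (inj₁ b) → int-0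
                          ; (inj₂ a) (inj₂ b) → block a b int-s (int-neg int-r) (int-neg int-q) int-p }
      where
      block : ∀ a b {p q r s} → IsInt p → IsInt q → IsInt r → IsInt s → IsInt (pairBlock i j p q r s a b)
      block a b ip iq ir is = int-+ (int-δ a b)
        (int-+ (int-* (int-δ a i) (int-+ (int-* (int-sub ip int-1) (int-δ i b)) (int-* iq (int-δ j b))))
               (int-* (int-δ a j) (int-+ (int-* ir (int-δ i b)) (int-* (int-sub is int-1) (int-δ j b)))))

    -- For i, j ≥ t the action takes place inside A₂₂ and D₂₂, where P_{n,t} contains a full linear
    -- group. This is what allows bits beyond t to be permuted by right multiplication.
    InP-pairwise : ∀ {t} → t ≤ toℕ i → t ≤ toℕ j → InP n t pairwise
    InP-pairwise {t} t≤i t≤j = sp-pairwise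
      , (λ a b a<t t≤b → zeros (δ-<≤ a b a<t t≤b) (δ-<≤ a i a<t t≤i) (δ-<≤ a j a<t t≤j))
      , (λ _ _ _ → refl)
      , (λ a b t≤a b<t → columns (δ a i) (δ a j) (s - 1ℚ) (- r) (- q) (p - 1ℚ) (δ-≤< a b t≤a b<t) (δ-≤< i b t≤i b<t) (δ-≤< j b t≤j b<t))
      where
      z : ∀ u v → 0ℚ + (0ℚ * u + 0ℚ * v) ≡ 0ℚ
      z = solve-∀ ℚ-ring
      zeros : ∀ {x y w u v} → x ≡ 0ℚ → y ≡ 0ℚ → w ≡ 0ℚ → x + (y * u + w * v) ≡ 0ℚ
      zeros {u = u} {v} refl refl refl = z u v
      z′ : ∀ a b p q r s → 0ℚ + (a * (p * 0ℚ + q * 0ℚ) + b * (r * 0ℚ + s * 0ℚ)) ≡ 0ℚ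
      z′ = solve-∀ ℚ-ring
      columns : ∀ a b p q r s {x y w} → x ≡ 0ℚ → y ≡ 0ℚ → w ≡ 0ℚ → x + (a * (p * y + q * w) + b * (r * y + s * w)) ≡ 0ℚ
      columns a b p q r s refl refl refl = z′ a b p q r s

-- The names list the old bits at i and j, then the new ones. Equal bits survive every X, as
-- vanishing columns are only mixed among themselves. For different bits one entry controls both
-- columns, because the D-block of `pairwise` is the transposed inverse of its A-block.
data Exchange (ℓ : ℕ) (X : SL₂ℤ) : (x y x′ y′ : Bool) → Set where
  same  : ∀ {x} → Exchange ℓ X x x x x
  ft-ft : Div ℓ (SL₂ℤ.r X) → Exchange ℓ X false true  false true
  ft-tf : Div ℓ (SL₂ℤ.s X) → Exchange ℓ X false true  true  false
  tf-tf : Div ℓ (SL₂ℤ.q X) → Exchange ℓ X true  false true  false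
  tf-ft : Div ℓ (SL₂ℤ.p X) → Exchange ℓ X true  false false true

pairwise-type : ∀ {N} {τ : Mat2 n} {β β′ : Types n} {i j} (i≢j : i ≢ j) (X : SL₂ℤ) →
  IntegralM τ → HasType N τ β →
  (∀ ℓ → Prime ℓ → ℓ ∣ N → (∀ k → k ≢ i → k ≢ j → β ℓ k ≡ β′ ℓ k) × Exchange ℓ X (β ℓ i) (β ℓ j) (β′ ℓ i) (β′ ℓ j)) →
  HasType N (τ ⊗ pairwise i≢j X) β′
pairwise-type {τ = τ} {β} {β′} {i} {j} i≢j X iτ tτ change ℓ pℓ ℓ∣N l k with l Fin.≟ i | l Fin.≟ j
... | yes refl | _ = go (proj₂ (change ℓ pℓ ℓ∣N)) (tτ ℓ pℓ ℓ∣N i k) (tτ ℓ pℓ ℓ∣N j k)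
  where
  open SL₂ℤ X
  C : Div ℓ (τ (bot k) (top i) * p + τ (bot k) (top j) * r) → Div ℓ ((τ ⊗ pairwise i≢j X) (bot k) (top i))
  C = div-resp (sym (trans (pairwise-columnˡ i≢j X (τ (bot k)) i) (pairBlock-columnᵢ i≢j p q r s (τ (bot k) ∘ top))))
  D : Div ℓ (τ (bot k) (bot i) * s + τ (bot k) (bot j) * - q) → Div ℓ ((τ ⊗ pairwise i≢j X) (bot k) (bot i))
  D = div-resp (sym (trans (pairwise-columnʳ i≢j X (τ (bot k)) i) (pairBlock-columnᵢ i≢j s (- r) (- q) p (τ (bot k) ∘ bot))))
  go : ∀ {x y x′ y′} → Exchange ℓ X x y x′ y′ → Div ℓ (τ (bot k) (column x i)) → Div ℓ (τ (bot k) (column y j)) →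
       Div ℓ ((τ ⊗ pairwise i≢j X) (bot k) (column x′ i))
  go (same {false}) hi hj = C (div-+ (div-*ʳ hi int-p) (div-*ʳ hj int-r))
  go (same {true})  hi hj = D (div-+ (div-*ʳ hi int-s) (div-*ʳ hj (int-neg int-q)))
  go (ft-ft d)      hi hj = C (div-+ (div-*ʳ hi int-p) (div-*ˡ (iτ (bot k) (top j)) d))
  go (ft-tf d)      hi hj = D (div-+ (div-*ˡ (iτ (bot k) (bot i)) d) (div-*ʳ hj (int-neg int-q)))
  go (tf-tf d)      hi hj = D (div-+ (div-*ʳ hi int-s) (div-*ˡ (iτ (bot k) (bot j)) (div-neg d)))
  go (tf-ft d)      hi hj = C (div-+ (div-*ˡ (iτ (bot k) (top i)) d) (div-*ʳ hj int-r))
... | no _ | yes refl = go (proj₂ (change ℓ pℓ ℓ∣N)) (tτ ℓ pℓ ℓ∣N i k) (tτ ℓ pℓ ℓ∣N j k)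
  where
  open SL₂ℤ X
  C : Div ℓ (τ (bot k) (top i) * q + τ (bot k) (top j) * s) → Div ℓ ((τ ⊗ pairwise i≢j X) (bot k) (top j))
  C = div-resp (sym (trans (pairwise-columnˡ i≢j X (τ (bot k)) j) (pairBlock-columnⱼ i≢j p q r s (τ (bot k) ∘ top))))
  D : Div ℓ (τ (bot k) (bot i) * - r + τ (bot k) (bot j) * p) → Div ℓ ((τ ⊗ pairwise i≢j X) (bot k) (bot j))
  D = div-resp (sym (trans (pairwise-columnʳ i≢j X (τ (bot k)) j) (pairBlock-columnⱼ i≢j s (- r) (- q) p (τ (bot k) ∘ bot))))
  go : ∀ {x y x′ y′} → Exchange ℓ X x y x′ y′ → Div ℓ (τ (bot k) (column x i)) → Div ℓ (τ (bot k) (column y j)) →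
       Div ℓ ((τ ⊗ pairwise i≢j X) (bot k) (column y′ j))
  go (same {false}) hi hj = C (div-+ (div-*ʳ hi int-q) (div-*ʳ hj int-s))
  go (same {true})  hi hj = D (div-+ (div-*ʳ hi (int-neg int-r)) (div-*ʳ hj int-p))
  go (ft-ft d)      hi hj = D (div-+ (div-*ˡ (iτ (bot k) (bot i)) (div-neg d)) (div-*ʳ hj int-p))
  go (ft-tf d)      hi hj = C (div-+ (div-*ʳ hi int-q) (div-*ˡ (iτ (bot k) (top j)) d))
  go (tf-tf d)      hi hj = C (div-+ (div-*ˡ (iτ (bot k) (top i)) d) (div-*ʳ hj int-s))
  go (tf-ft d)      hi hj = D (div-+ (div-*ʳ hi (int-neg int-r)) (div-*ˡ (iτ (bot k) (bot j)) d))
... | no l≢i | no l≢j = subst (λ t → Div ℓ ((τ ⊗ pairwise i≢j X) (bot k) (column t l)))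
    (proj₁ (change ℓ pℓ ℓ∣N) l l≢i l≢j) (go (β ℓ l) (tτ ℓ pℓ ℓ∣N l k))
  where
  open SL₂ℤ X
  go : ∀ t → Div ℓ (τ (bot k) (column t l)) → Div ℓ ((τ ⊗ pairwise i≢j X) (bot k) (column t l))
  go false = div-resp (sym (trans (pairwise-columnˡ i≢j X (τ (bot k)) l) (pairBlock-column-≢ i≢j p q r s (τ (bot k) ∘ top) l≢i l≢j)))
  go true  = div-resp (sym (trans (pairwise-columnʳ i≢j X (τ (bot k)) l) (pairBlock-column-≢ i≢j s (- r) (- q) p (τ (bot k) ∘ bot) l≢i l≢j)))

-- The double cosets of typed matrices

-- Products are rearranged in an arbitrary monoid, where matrices are opaque letters and no sum over
-- entries appears.
module MonoidInverses (M : Monoid 0ℓ 0ℓ) where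
  open Monoid M using (_∙_; ε; assoc; identityˡ; identityʳ; ∙-congʳ; ∙-congˡ)
    renaming (_≈_ to _≋_; sym to ≋-sym; setoid to ≋-setoid)
  open SetoidReasoning ≋-setoid

  cancelˡ : ∀ {a a′} b → a′ ∙ a ≋ ε → a′ ∙ (a ∙ b) ≋ b
  cancelˡ {a} {a′} b inv = begin
    a′ ∙ (a ∙ b) ≈⟨ assoc a′ a b ⟨
    (a′ ∙ a) ∙ b ≈⟨ ∙-congʳ inv ⟩
    ε ∙ b        ≈⟨ identityˡ b ⟩
    b            ∎

  cancelʳ : ∀ {a a′} b → a ∙ a′ ≋ ε → (b ∙ a) ∙ a′ ≋ b
  cancelʳ {a} {a′} b inv = begin
    (b ∙ a) ∙ a′ ≈⟨ assoc b a a′ ⟩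
    b ∙ (a ∙ a′) ≈⟨ ∙-congˡ inv ⟩
    b ∙ ε        ≈⟨ identityʳ b ⟩
    b            ∎

  solve-middle : ∀ {d d′ g p p′ t} → d′ ∙ d ≋ ε → p ∙ p′ ≋ ε → t ≋ (d ∙ g) ∙ p → g ≋ (d′ ∙ t) ∙ p′
  solve-middle {d} {d′} {g} {p} {p′} {t} d′d pp′ eq = ≋-sym (begin
    (d′ ∙ t) ∙ p′             ≈⟨ ∙-congʳ (∙-congˡ eq) ⟩
    (d′ ∙ ((d ∙ g) ∙ p)) ∙ p′ ≈⟨ assoc d′ _ p′ ⟩
    d′ ∙ (((d ∙ g) ∙ p) ∙ p′) ≈⟨ ∙-congˡ (cancelʳ (d ∙ g) pp′) ⟩
    d′ ∙ (d ∙ g)              ≈⟨ cancelˡ g d′d ⟩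
    g                         ∎)

  insert-inverses : ∀ {a a′ x x′} g → a ∙ a′ ≋ ε → x ∙ x′ ≋ ε → g ≋ (a ∙ x) ∙ (x′ ∙ (a′ ∙ g))
  insert-inverses {a} {a′} {x} {x′} g aa′ xx′ = ≋-sym (begin
    (a ∙ x) ∙ (x′ ∙ (a′ ∙ g)) ≈⟨ assoc a x _ ⟩
    a ∙ (x ∙ (x′ ∙ (a′ ∙ g))) ≈⟨ ∙-congˡ (cancelˡ (a′ ∙ g) xx′) ⟩
    a ∙ (a′ ∙ g)              ≈⟨ cancelˡ g aa′ ⟩
    g                         ∎)

module ⊗-Inverses {n} = MonoidInverses (⊗-monoid n)

InΓ0-adj : ∀ {N} (d : Mat2 n) → InΓ0 N n d → InΓ0 N n (adj d)
InΓ0-adj {N = N} d (sp , i , C) = sp-adj d sp , integral-adj i , λ a b → divQ (div-neg (⟨_⟩ {N} (C b a)))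

-- Keeps the bits from s on, those of the top basis vectors that span the isotropic subspace
-- stabilised by P_{n,s}.
window : ℕ → (Fin n → Bool) → Fin n → Bool
window s b j with toℕ j ℕ.<? s
... | yes _ = false
... | no  _ = b j

window-< : ∀ s (b : Fin n → Bool) j → toℕ j < s → window s b j ≡ false
window-< s b j j<s with toℕ j ℕ.<? s
... | yes _  = refl
... | no j≮s = contradiction j<s j≮s

window-≥ : ∀ s (b : Fin n → Bool) j → s ≤ toℕ j → window s b j ≡ b j
window-≥ s b j s≤j with toℕ j ℕ.<? s
... | yes j<s = contradiction s≤j (ℕₚ.<⇒≱ j<s)
... | no  _   = refl

window-true : ∀ s (b : Fin n → Bool) j → window s b j ≡ true → s ≤ toℕ j × b j ≡ true
window-true s b j eq with toℕ j ℕ.<? s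
window-true s b j () | yes _
... | no j≮s = ℕₚ.≮⇒≥ j≮s , eq

members : (Fin n → Bool) → List (Fin n)
members {zero}  b = []
members {suc n} b with b Fin.zero
... | true  = Fin.zero ∷ List.map Fin.suc (members (b ∘ Fin.suc))
... | false = List.map Fin.suc (members (b ∘ Fin.suc))

length-members : (b : Fin n → Bool) → length (members b) ≡ count b
length-members {zero}  b = refl
length-members {suc n} b with b Fin.zero
... | true  = cong suc (trans (Listₚ.length-map Fin.suc (members (b ∘ Fin.suc))) (length-members (b ∘ Fin.suc)))
... | false = trans (Listₚ.length-map Fin.suc (members (b ∘ Fin.suc))) (length-members (b ∘ Fin.suc))

∈-members : (b : Fin n → Bool) → ∀ j → b j ≡ true → j ∈ members b
∈-members b Fin.zero    eq with b Fin.zero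
∈-members b Fin.zero    refl | true = here refl
∈-members b (Fin.suc j) eq with b Fin.zero
... | true  = there (∈-map⁺ Fin.suc (∈-members (b ∘ Fin.suc) j eq))
... | false = ∈-map⁺ Fin.suc (∈-members (b ∘ Fin.suc) j eq)

primeIdeal : ∀ {ℓ} → Prime ℓ → PrimeIdeal
primeIdeal {ℓ} pℓ = record
  { O = IsInt ; I = Div ℓ
  ; O-0 = int-0 ; O-1 = int-1 ; O-+ = int-+ ; O-* = int-* ; O-neg = int-neg
  ; I-0 = div-0 ℓ ; I-+ = div-+ ; I-* = div-*ˡ
  ; I? = div? ℓ ; I-prime = div-euclid pℓ ; ¬I-1 = ¬div-1 pℓ }

infixr 7 _·_
_·_ : Mat2 n → (Idx n → ℚ) → Idx n → ℚ
(A · y) i = sumI (λ k → A i k * y k)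

·-assoc : ∀ (A B : Mat2 n) y i → ((A ⊗ B) · y) i ≡ (A · (B · y)) i
·-assoc A B y i = ⊗-assoc A B (λ k _ → y k) i i

·-cong : ∀ {A B : Mat2 n} → A ≈ B → ∀ y i → (A · y) i ≡ (B · y) i
·-cong A≈B y i = sumI-cong (λ k → cong (_* y k) (A≈B i k))

-- Over the prime ℓ, the columns s, s+1, … of the C-block of τ are combinations of those of σ.  In
-- both matrices the columns with β = true are independent and the other columns vanish.
count-≤ : ∀ {s N} {σ τ p : Mat2 n} {β β′ : Types n} →
  IsSp n σ → IntegralM σ → HasType N σ β → IsSp n τ → IntegralM τ → HasType N τ β′ →
  InP n s p → τ ≈ σ ⊗ p →
  ∀ ℓ → Prime ℓ → ℓ ∣ N → count (window s (β′ ℓ)) ≤ count (window s (β ℓ))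
count-≤ {n} {s} {N} {σ} {τ} {p} {β} {β′} spσ iσ tσ spτ iτ tτ (_ , pA , pC , _) τ≈σp ℓ pℓ ℓ∣N
  with count (window s (β ℓ)) ℕ.<? count (window s (β′ ℓ))
... | no ≮ = ℕₚ.≮⇒≥ ≮
-- With more marks in β′ than in β, some combination of the basis vectors marked by β′, nonzero
-- modulo ℓ, is sent by p to a vector whose coordinates marked by β all vanish modulo ℓ.
... | yes lt = ⊥-elim (impossible (dependence (primeIdeal pℓ) (members (window s (β ℓ))) (λ κ j → p (top κ) (top j))
        (λ κ j → ip (top κ) (top j)) (window s (β′ ℓ)) (subst (ℕ._< count (window s (β′ ℓ))) (sym (length-members (window s (β ℓ)))) lt)))
  where
  -- Elements of P are rational in general, but this one equals σ⁻¹ τ.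
  ip : IntegralM p
  ip i j = subst IsInt (trans (⊗-congˡ (adj σ) τ≈σp i j)
                              (⊗-Inverses.cancelˡ {a = σ} {adj σ} p (sp-inverseˡ σ spσ) i j))
             (integral-⊗ {A = adj σ} {τ} (integral-adj iσ) iτ i j)
  impossible : ¬ (Σ[ c ∈ (Fin n → ℚ) ] (∀ j → IsInt (c j)) × (∀ j → window s (β′ ℓ) j ≡ false → c j ≡ 0ℚ) ×
    (∃[ j ] window s (β′ ℓ) j ≡ true × ¬ Div ℓ (c j)) ×
    (∀ κ → κ ∈ members (window s (β ℓ)) → Div ℓ (sumF (λ j → p (top κ) (top j) * c j))))
  -- Coordinate l of y is recovered by row `top l` of τ⁻¹. Its entries from column l of the D-block
  -- of τ vanish modulo ℓ, as β′ is 1 at l; the others meet the bottom half of τ y, which vanishes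
  -- modulo ℓ.
  impossible (c , ic , supp , (l , wl , ¬cl) , rel) = ¬cl (div-resp yl (div-+
      (div-sumF λ a → div-*ʳ (subst (λ t → Div ℓ (τ (bot a) (column t l))) β′l (tτ ℓ pℓ ℓ∣N l a)) (iτy (top a)))
      (div-sumF λ a → div-*ˡ (int-neg (iτ (top a) (bot l))) (bottom a))))
    where
    β′l : β′ ℓ l ≡ true
    β′l = proj₂ (window-true s (β′ ℓ) l wl)
    y : Idx n → ℚ
    y (inj₁ j) = c j
    y (inj₂ j) = 0ℚ
    iy : ∀ i → IsInt (y i)
    iy (inj₁ j) = ic j
    iy (inj₂ j) = int-0
    iτy : ∀ i → IsInt ((τ · y) i)
    iτy i = int-+ (int-sumF (λ k → int-* (iτ i (inj₁ k)) (iy (inj₁ k)))) (int-sumF (λ k → int-* (iτ i (inj₂ k)) (iy (inj₂ k))))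
    yl : (adj τ · (τ · y)) (top l) ≡ c l
    yl = trans (sym (·-assoc (adj τ) τ y (top l))) (trans (·-cong (sp-inverseˡ τ spτ) y (top l)) (sumI-idˡ (top l) y))
    c-small : ∀ j → toℕ j < s → c j ≡ 0ℚ
    c-small j j<s = supp j (window-< s (β′ ℓ) j j<s)
    r0 : ∀ x {y} → y ≡ 0ℚ → x * y ≡ 0ℚ
    r0 x refl = *-zeroʳ x
    l0 : ∀ {x} y → x ≡ 0ℚ → x * y ≡ 0ℚ
    l0 y refl = *-zeroˡ y
    py-top : ∀ κ → (p · y) (top κ) ≡ sumF (λ j → p (top κ) (top j) * c j)
    py-top κ = trans (cong (sumF (λ j → p (top κ) (top j) * c j) +_) (sumF-zero (λ j → *-zeroʳ (p (top κ) (bot j)))))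
      (+-identityʳ (sumF (λ j → p (top κ) (top j) * c j)))
    py-bot : ∀ κ → (p · y) (bot κ) ≡ 0ℚ
    py-bot κ = cong₂ _+_ (sumF-zero term) (sumF-zero (λ j → *-zeroʳ (p (bot κ) (bot j))))
      where
      term : ∀ j → p (bot κ) (top j) * c j ≡ 0ℚ
      term j with toℕ j ℕ.<? s
      ... | yes j<s = r0 (p (bot κ) (top j)) (c-small j j<s)
      ... | no  j≮s = l0 (c j) (pC κ j (inj₂ (ℕₚ.≮⇒≥ j≮s)))
    py-small : ∀ κ → toℕ κ < s → (p · y) (top κ) ≡ 0ℚ
    py-small κ κ<s = trans (py-top κ) (sumF-zero term)
      where
      term : ∀ j → p (top κ) (top j) * c j ≡ 0ℚ
      term j with toℕ j ℕ.<? s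
      ... | yes j<s = r0 (p (top κ) (top j)) (c-small j j<s)
      ... | no  j≮s = l0 (c j) (pA κ j κ<s (ℕₚ.≮⇒≥ j≮s))
    ipy : ∀ κ → IsInt ((p · y) (top κ))
    ipy κ = subst IsInt (sym (py-top κ)) (int-sumF (λ j → int-* (ip (top κ) (top j)) (ic j)))
    bottom : ∀ a → Div ℓ ((τ · y) (bot a))
    bottom a = div-resp (sym (trans (·-cong τ≈σp y (bot a)) (·-assoc σ p y (bot a))))
      (div-+ (div-sumF term) (div-sumF λ κ → div-resp (sym (r0 (σ (bot a) (bot κ)) (py-bot κ))) (div-0 ℓ)))
      where
      by-type : ∀ κ t → β ℓ κ ≡ t → s ≤ toℕ κ → Div ℓ (σ (bot a) (top κ) * (p · y) (top κ))
      by-type κ true  eq s≤κ = div-*ˡ (iσ (bot a) (top κ)) (div-resp (sym (py-top κ))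
        (rel κ (∈-members (window s (β ℓ)) κ (trans (window-≥ s (β ℓ) κ s≤κ) eq))))
      by-type κ false eq s≤κ = div-*ʳ (subst (λ t → Div ℓ (σ (bot a) (column t κ))) eq (tσ ℓ pℓ ℓ∣N κ a)) (ipy κ)
      term : ∀ κ → Div ℓ (σ (bot a) (top κ) * (p · y) (top κ))
      term κ with toℕ κ ℕ.<? s
      ... | yes κ<s = div-resp (sym (r0 (σ (bot a) (top κ)) (py-small κ κ<s))) (div-0 ℓ)
      ... | no  κ≮s = by-type κ (β ℓ κ) refl (ℕₚ.≮⇒≥ κ≮s)

-- Left multiplication by Γ₀(N) preserves types, so d can be absorbed into either matrix; `count-≤`
-- is then applied once with p and once with p⁻¹.
count-invariant : ∀ {s N} {σ τ d p : Mat2 n} {β β′ : Types n} →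
  IsSp n σ → IntegralM σ → HasType N σ β → IsSp n τ → IntegralM τ → HasType N τ β′ →
  InΓ0 N n d → InP n s p → τ ≈ d ⊗ σ ⊗ p →
  ∀ ℓ → Prime ℓ → ℓ ∣ N → count (window s (β ℓ)) ≡ count (window s (β′ ℓ))
count-invariant {n} {s} {N} {σ} {τ} {d} {p} {β} {β′} spσ iσ tσ spτ iτ tτ d∈@(spd , id , _) p∈@(spp , _) eq ℓ pℓ ℓ∣N =
  ℕₚ.≤-antisym
    (count-≤ {s = s} {σ = adj d ⊗ τ} {σ} {adj p} (sp-⊗ (adj d) τ (sp-adj d spd) spτ) (integral-⊗ {A = adj d} {τ} (integral-adj id) iτ)
      (Γ0-type {d = adj d} {τ} {β′} (InΓ0-adj {N = N} d d∈) iτ tτ) spσ iσ tσ (InP-adj p p∈)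
      (⊗-Inverses.solve-middle {d = d} {adj d} {σ} {p} {adj p} {τ} (sp-inverseˡ d spd) (sp-inverseʳ p spp) eq) ℓ pℓ ℓ∣N)
    (count-≤ {s = s} {σ = d ⊗ σ} {τ} {p} (sp-⊗ d σ spd spσ) (integral-⊗ {A = d} {σ} id iσ)
      (Γ0-type {d = d} {σ} {β} d∈ iσ tσ) spτ iτ tτ p∈ eq ℓ pℓ ℓ∣N)

-- Permuting the bits of a type

swap : (Fin n → Bool) → Fin n → Fin n → Fin n → Bool
swap b i j = update (update b i (b j)) j (b i)

module _ (b : Fin n → Bool) {i j : Fin n} (i≢j : i ≢ j) where

  swap-ˡ : swap b i j i ≡ b j
  swap-ˡ = trans (update-≢ (update b i (b j)) (b i) i≢j) (update-≡ b i (b j))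

  swap-ʳ : swap b i j j ≡ b i
  swap-ʳ = update-≡ (update b i (b j)) j (b i)

  swap-≢ : ∀ {k} → k ≢ i → k ≢ j → swap b i j k ≡ b k
  swap-≢ k≢i k≢j = trans (update-≢ (update b i (b j)) (b i) k≢j) (update-≢ b (b j) k≢i)

  count-swap : count (swap b i j) ≡ count b
  count-swap = ℕₚ.+-cancelʳ-≡ (#ᵇ (b j)) _ _ (begin
    count (swap b i j) ℕ.+ #ᵇ (b j)                   ≡⟨ cong (λ x → count (swap b i j) ℕ.+ #ᵇ x) (update-≢ b (b j) (i≢j ∘ sym)) ⟨
    count (swap b i j) ℕ.+ #ᵇ (update b i (b j) j)    ≡⟨ count-update (update b i (b j)) j (b i) ⟩
    count (update b i (b j)) ℕ.+ #ᵇ (b i)             ≡⟨ count-update b i (b j) ⟩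
    count b ℕ.+ #ᵇ (b j)                              ∎)
    where open ≡-Reasoning

module _ {s : ℕ} (Q : (Fin n → Bool) → Set)
  (Q-resp : ∀ {f g} → (∀ i → f i ≡ g i) → Q f → Q g)
  (Q-swap : ∀ f i j → i ≢ j → s ≤ toℕ i → s ≤ toℕ j → Q f → Q (swap f i j)) where

  private
    below : ∀ {f g : Fin n → Bool} k → (∀ i → toℕ i < toℕ k → f i ≡ g i) → f k ≡ true → g k ≡ false →
      (∀ j → toℕ k < toℕ j → f j ≡ false → g j ≡ false) → count g < count f
    below {f} {g} k agree fk gk above = subst (count g <_) (sym (count-remove f k fk)) (s≤s (count-mono imp))
      where
      imp : ∀ i → g i ≡ true → update f k false i ≡ true
      imp i gi with ℕₚ.<-cmp (toℕ i) (toℕ k)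
      ... | tri< i<k i≢k _ = trans (update-≢ f false (i≢k ∘ cong toℕ)) (trans (agree i i<k) gi)
      ... | tri≈ _ i≡k _ with Finₚ.toℕ-injective i≡k
      ...   | refl with () ← trans (sym gi) gk
      imp i gi | tri> _ i≢k k<i = trans (update-≢ f false (i≢k ∘ cong toℕ)) (lem (f i) refl)
        where
        lem : ∀ t → f i ≡ t → f i ≡ true
        lem true  eq = eq
        lem false eq with () ← trans (sym gi) (above i k<i eq)

    -- Otherwise f would take the value opposite to g k everywhere after k. One function would then
    -- dominate the other from k on, strictly at k, and the counts would differ.
    partner : ∀ {f g : Fin n → Bool} k → (∀ i → toℕ i < toℕ k → f i ≡ g i) → f k ≢ g k → count f ≡ count g →
      ∃[ j ] toℕ k < toℕ j × f j ≡ g k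
    partner {f} {g} k agree fk≢gk eq with Finₚ.any? (λ j → (toℕ k ℕ.<? toℕ j) ×-dec (f j Bool.≟ g k))
    ... | yes found = found
    ... | no  none  = ⊥-elim (lem (f k) (g k) refl refl)
      where
      lem : ∀ x y → f k ≡ x → g k ≡ y → ⊥
      lem true  true  fk gk = fk≢gk (trans fk (sym gk))
      lem false false fk gk = fk≢gk (trans fk (sym gk))
      lem true  false fk gk = ℕₚ.<-irrefl (sym eq) (below k agree fk gk
        (λ j k<j fj → ⊥-elim (none (j , k<j , trans fj (sym gk)))))
      lem false true  fk gk = ℕₚ.<-irrefl eq (below k (λ i i<k → sym (agree i i<k)) gk fk
        (λ j k<j _ → Boolₚ.¬-not {f j} (λ fj → none (j , k<j , trans fj (sym gk)))))

    go : ∀ fuel b f g → b ℕ.+ fuel ≡ n → s ≤ b → (∀ i → toℕ i < b → f i ≡ g i) → count f ≡ count g → Q f → Q g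
    go zero b f g b≡n s≤b agree eq Qf = Q-resp
      (λ i → agree i (subst (toℕ i <_) (trans (sym b≡n) (ℕₚ.+-identityʳ b)) (Finₚ.toℕ<n i))) Qf
    go (suc fuel) b f g b≡n s≤b agree eq Qf = step (f k Bool.≟ g k)
      where
      b<n : b < n
      b<n = subst (b <_) b≡n (ℕₚ.m<m+n b (s≤s z≤n))
      k : Fin n
      k = fromℕ< b<n
      k≡b : toℕ k ≡ b
      k≡b = Finₚ.toℕ-fromℕ< b<n
      b+1 : suc b ℕ.+ fuel ≡ n
      b+1 = trans (sym (ℕₚ.+-suc b fuel)) b≡n
      extendAgree : ∀ f → (∀ i → toℕ i < b → f i ≡ g i) → f k ≡ g k → ∀ i → toℕ i < suc b → f i ≡ g i
      extendAgree f ag fk i (s≤s i≤b) with ℕₚ.m≤n⇒m<n∨m≡n i≤b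
      ... | inj₁ i<b = ag i i<b
      ... | inj₂ i≡b with Finₚ.toℕ-injective (trans i≡b (sym k≡b))
      ...   | refl = fk
      step : Dec (f k ≡ g k) → Q g
      step (yes fk) = go fuel (suc b) f g b+1 (ℕₚ.m≤n⇒m≤1+n s≤b) (extendAgree f agree fk) eq Qf
      step (no fk) with partner k (λ i i<k → agree i (subst (toℕ i <_) k≡b i<k)) fk eq
      ... | j , k<j , fj = go fuel (suc b) (swap f k j) g b+1 (ℕₚ.m≤n⇒m≤1+n s≤b)
          (extendAgree (swap f k j) (λ i i<b → trans (swap-≢ f k≢j (λ { refl → ℕₚ.<-irrefl k≡b i<b }) (λ { refl → ℕₚ.<-asym i<b b<j })) (agree i i<b))
                       (trans (swap-ˡ f k≢j) fj))
          (trans (count-swap f k≢j) eq)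
          (Q-swap f k j k≢j (subst (s ≤_) (sym k≡b) s≤b) (ℕₚ.≤-trans s≤b (ℕₚ.<⇒≤ b<j)) Qf)
        where
        b<j : b < toℕ j
        b<j = subst (ℕ._< toℕ j) k≡b k<j
        k≢j : k ≢ j
        k≢j refl = ℕₚ.<-irrefl refl k<j

  -- A selection sort: at the first disagreement, the value wanted is fetched from a later position,
  -- so all transpositions stay among the positions from s on.
  transpositions-connect : s ≤ n → ∀ f g → (∀ i → toℕ i < s → f i ≡ g i) → count f ≡ count g → Q f → Q g
  transpositions-connect s≤n f g = go (n ℕ.∸ s) s f g (ℕₚ.m+[n∸m]≡n s≤n) ℕₚ.≤-refl

-- The rotation by an idempotent which is 1 at ℓ and 0 at the other primes dividing N transposes two
-- coordinates at ℓ only; so the types can be matched one prime at a time.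
module _ {N : ℕ} (0<N : 0 < N) (sf : SquareFree N) {s : ℕ} (s≤n : s ≤ n) {τ : Mat2 n} (iτ : IntegralM τ) where

  Reachable : Types n → Set
  Reachable β = ∃[ p ] InP n s p × IntegralM p × HasType N (τ ⊗ p) β

  private
    at : ℕ → (Fin n → Bool) → Types n → Types n
    at ℓ f β p with p ℕ.≟ ℓ
    ... | yes _ = f
    ... | no  _ = β p

    reach-resp : ∀ {β β′} → (∀ ℓ → Prime ℓ → ℓ ∣ N → ∀ j → β ℓ j ≡ β′ ℓ j) → Reachable β → Reachable β′
    reach-resp eq (p , p∈ , ip , t) = p , p∈ , ip ,
      λ ℓ pℓ ℓ∣N j k → subst (λ x → Div ℓ ((τ ⊗ p) (bot k) (column x j))) (eq ℓ pℓ ℓ∣N j) (t ℓ pℓ ℓ∣N j k)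

    bitAt : ℕ → ℕ → Bool
    bitAt ℓ q with q ℕ.≟ ℓ
    ... | yes _ = true
    ... | no  _ = false

    bitAt-1 : ∀ ℓ {x} → Bit (bitAt ℓ ℓ) ℓ x → Div ℓ (1ℚ - x)
    bitAt-1 ℓ h with ℓ ℕ.≟ ℓ
    ... | yes _  = h
    ... | no ℓ≢ℓ = contradiction refl ℓ≢ℓ

    bitAt-0 : ∀ ℓ q {x} → q ≢ ℓ → Bit (bitAt ℓ q) q x → Div q x
    bitAt-0 ℓ q q≢ℓ h with q ℕ.≟ ℓ
    ... | yes q≡ℓ = contradiction q≡ℓ q≢ℓ
    ... | no _    = h

    exchange : ∀ {e} (ie : IsInt e) q x y → Div q (1ℚ - e) → Exchange q (rotation ie) x y y x
    exchange ie q false false d = same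
    exchange ie q true  true  d = same
    exchange ie q false true  d = ft-tf (rotation-1 ie d)
    exchange ie q true  false d = tf-ft (rotation-1 ie d)

    keep : ∀ {e} (ie : IsInt e) q x y → Div q e → Exchange q (rotation ie) x y x y
    keep ie q false false d = same
    keep ie q true  true  d = same
    keep ie q false true  d = ft-ft d
    keep ie q true  false d = tf-tf (rotation-0 ie d)

    change : ∀ {e} (ie : IsInt e) ℓ β f i j → i ≢ j → (∀ q → Prime q → q ∣ N → Bit (bitAt ℓ q) q e) →
      ∀ q → Prime q → q ∣ N →
      (∀ k → k ≢ i → k ≢ j → at ℓ f β q k ≡ at ℓ (swap f i j) β q k) ×
      Exchange q (rotation ie) (at ℓ f β q i) (at ℓ f β q j) (at ℓ (swap f i j) β q i) (at ℓ (swap f i j) β q j)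
    change ie ℓ β f i j i≢j bit q pq q∣N with q ℕ.≟ ℓ
    ... | yes refl = (λ k k≢i k≢j → sym (swap-≢ f i≢j k≢i k≢j)) ,
      subst₂ (Exchange q (rotation ie) (f i) (f j)) (sym (swap-ˡ f i≢j)) (sym (swap-ʳ f i≢j))
        (exchange ie q (f i) (f j) (bitAt-1 q (bit q pq q∣N)))
    ... | no q≢ℓ = (λ _ _ _ → refl) , keep ie q (β q i) (β q j) (bitAt-0 ℓ q q≢ℓ (bit q pq q∣N))

    reach-swap : ∀ ℓ β f i j → i ≢ j → s ≤ toℕ i → s ≤ toℕ j → Reachable (at ℓ f β) → Reachable (at ℓ (swap f i j) β)
    reach-swap ℓ β f i j i≢j s≤i s≤j (p , p∈ , ip , t) = p ⊗ G , InP-⊗ p G p∈ (InP-pairwise i≢j X s≤i s≤j) ,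
      integral-⊗ {A = p} {G} ip (integral-pairwise i≢j X) ,
      hasType-cong {A = (τ ⊗ p) ⊗ G} {τ ⊗ (p ⊗ G)} {at ℓ (swap f i j) β} (⊗-assoc τ p G)
        (pairwise-type i≢j X (integral-⊗ {A = τ} {p} iτ ip) t
          (change ie ℓ β f i j i≢j (proj₂ (proj₂ e))))
      where
      e = idempotent 0<N sf (bitAt ℓ)
      ie = proj₁ (proj₂ e)
      X = rotation ie
      G = pairwise i≢j X

    go : ∀ b β β′ → (∀ ℓ → Prime ℓ → ℓ ∣ N → (∀ j → toℕ j < s → β ℓ j ≡ β′ ℓ j) × count (β ℓ) ≡ count (β′ ℓ)) →
      (∀ ℓ → b ≤ ℓ → Prime ℓ → ℓ ∣ N → ∀ j → β ℓ j ≡ β′ ℓ j) → Reachable β → Reachable β′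
    go zero    β β′ alike agree r = reach-resp (λ ℓ → agree ℓ z≤n) r
    go (suc b) β β′ alike agree r = step (prime? b) (b ∣.∣? N)
      where
      -- This type copies β at b and β′ elsewhere. It agrees with β from b on, so the induction
      -- hypothesis reaches it; what remains is a permutation at the single prime b.
      β″ : Types n
      β″ = at b (β b) β′
      first : Reachable β″
      first = go b β β″ alike″ agree″ r
        where
        alike″ : ∀ ℓ → Prime ℓ → ℓ ∣ N → (∀ j → toℕ j < s → β ℓ j ≡ β″ ℓ j) × count (β ℓ) ≡ count (β″ ℓ)
        alike″ ℓ pℓ ℓ∣N with ℓ ℕ.≟ b
        ... | yes refl = (λ _ _ → refl) , refl
        ... | no  _    = alike ℓ pℓ ℓ∣N
        agree″ : ∀ ℓ → b ≤ ℓ → Prime ℓ → ℓ ∣ N → ∀ j → β ℓ j ≡ β″ ℓ j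
        agree″ ℓ b≤ℓ pℓ ℓ∣N j with ℓ ℕ.≟ b
        ... | yes refl = refl
        ... | no  ℓ≢b  = agree ℓ (ℕₚ.≤∧≢⇒< b≤ℓ (ℓ≢b ∘ sym)) pℓ ℓ∣N j
      at-self : ∀ ℓ j → at b (β′ b) β′ ℓ j ≡ β′ ℓ j
      at-self ℓ j with ℓ ℕ.≟ b
      ... | yes refl = refl
      ... | no  _    = refl
      at-vacuous : ¬ (Prime b × b ∣ N) → ∀ ℓ → Prime ℓ → ℓ ∣ N → ∀ j → β″ ℓ j ≡ β′ ℓ j
      at-vacuous h ℓ pℓ ℓ∣N j with ℓ ℕ.≟ b
      ... | yes refl = contradiction (pℓ , ℓ∣N) h
      ... | no  _    = refl
      at-cong : ∀ {f g : Fin n → Bool} → (∀ j → f j ≡ g j) → ∀ ℓ j → at b f β′ ℓ j ≡ at b g β′ ℓ j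
      at-cong eq ℓ j with ℓ ℕ.≟ b
      ... | yes _ = eq j
      ... | no  _ = refl
      step : Dec (Prime b) → Dec (b ∣ N) → Reachable β′
      step (no ¬p)  _        = reach-resp (at-vacuous (λ h → ¬p (proj₁ h))) first
      step (yes _)  (no ∤N)  = reach-resp (at-vacuous (λ h → ∤N (proj₂ h))) first
      step (yes pb) (yes b∣N) = reach-resp (λ ℓ _ _ → at-self ℓ)
        (transpositions-connect (λ f → Reachable (at b f β′))
          (λ eq → reach-resp (λ ℓ _ _ → at-cong eq ℓ)) (λ f i j → reach-swap b β′ f i j)
          s≤n (β b) (β′ b) (proj₁ (alike b pb b∣N)) (proj₂ (alike b pb b∣N)) first)

  equal-count⇒reachable : ∀ {β β′ : Types n} → HasType N τ β →
    (∀ ℓ → Prime ℓ → ℓ ∣ N → (∀ j → toℕ j < s → β ℓ j ≡ β′ ℓ j) × count (β ℓ) ≡ count (β′ ℓ)) → Reachable β′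
  -- Nothing above N divides N, so the required agreement from N + 1 on is vacuous.
  equal-count⇒reachable {β} {β′} tτ alike = go (suc N) β β′ alike
    (λ ℓ N<ℓ _ ℓ∣N → contradiction (∣.∣⇒≤ ℓ∣N) (ℕₚ.<⇒≱ N<ℓ))
    (idM , InP-idM , integral-idM , hasType-cong {A = τ} {τ ⊗ idM} {β} (λ i j → sym (⊗.identityʳ τ i j)) tτ)
    where instance _ = ℕ.>-nonZero 0<N

-- Once p has given σ p the type of τ, the left factor τ (σ p)⁻¹ lies in Γ₀(N) by `same-type⇒Γ0`.
equal-count⇒equivalent : ∀ {s N} → 0 < N → SquareFree N → s ≤ n → {σ τ : Mat2 n} {β β′ : Types n} →
  IsSp n σ → IntegralM σ → HasType N σ β → IsSp n τ → IntegralM τ → HasType N τ β′ →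
  (∀ ℓ → Prime ℓ → ℓ ∣ N → (∀ j → toℕ j < s → β ℓ j ≡ β′ ℓ j) × count (β ℓ) ≡ count (β′ ℓ)) →
  DC (InΓ0 N n) (InP n s) σ τ
equal-count⇒equivalent 0<N sf s≤n {σ} {τ} {β} {β′} spσ iσ tσ spτ iτ tτ alike
  with equal-count⇒reachable 0<N sf s≤n {σ} iσ {β} {β′} tσ alike
... | p , p∈ , ip , t = τ ⊗ adj (σ ⊗ p) , p
  , same-type⇒Γ0 0<N sf {σ ⊗ p} {τ} {β′} spσp (integral-⊗ {A = σ} {p} iσ ip) t spτ iτ tτ , p∈
  , λ i j → sym (trans (⊗-assoc (τ ⊗ adj (σ ⊗ p)) σ p i j)
      (trans (⊗-assoc τ (adj (σ ⊗ p)) (σ ⊗ p) i j)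
        (trans (⊗-congˡ τ (sp-inverseˡ (σ ⊗ p) spσp) i j)
               (⊗.identityʳ τ i j))))
  where
  spσp : IsSp _ (σ ⊗ p)
  spσp = sp-⊗ σ p spσ (proj₁ p∈)

-- Reduction to typed matrices

record Cleared {n} (v : Fin n → ℚ) : Set where
  field
    t D    : ℚ
    w      : Fin n → ℚ
    int-D  : IsInt D
    int-w  : ∀ i → IsInt (w i)
    tD≡1   : t * D ≡ 1ℚ
    v≡tw   : ∀ i → v i ≡ t * w i

clear-one : ∀ q → ∃[ t ] ∃[ D ] IsInt D × IsInt (D * q) × t * D ≡ 1ℚ
clear-one q@(mkℚ z d _) = 1/ D , D , (pos (suc d) , sym (/1≡mkℚ (pos (suc d)))) , (z , Dq≡z) , ℚₚ.*-inverseˡ D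
  where
  D = mkℚ (pos (suc d)) 0 (1-coprime (pos (suc d)))
  Dq≡z : D * q ≡ z / 1
  -- The product of the denominators 1 and d + 1 computes to the successor of d + 0, hence the
  -- trailing 0.
  Dq≡z = ℚₚ.fromℚᵘ-cong {ℚᵘ.mkℚᵘ (pos (suc d) ℤ.* z) (d ℕ.+ 0)} {ℚᵘ.mkℚᵘ z 0} (ℚᵘ.*≡* (begin
    (pos (suc d) ℤ.* z) ℤ.* pos 1  ≡⟨ ℤₚ.*-identityʳ (pos (suc d) ℤ.* z) ⟩
    pos (suc d) ℤ.* z              ≡⟨ ℤₚ.*-comm (pos (suc d)) z ⟩
    z ℤ.* pos (suc d)              ≡⟨ cong (λ x → z ℤ.* pos (suc x)) (ℕₚ.+-identityʳ d) ⟨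
    z ℤ.* pos (suc (d ℕ.+ 0))      ∎))
    where open ≡-Reasoning

clear : ∀ {n} (v : Fin n → ℚ) → Cleared v
clear {zero}  v = record { t = 1ℚ ; D = 1ℚ ; w = λ () ; int-D = int-1 ; int-w = λ () ; tD≡1 = *-identityˡ 1ℚ ; v≡tw = λ () }
clear {suc n} v with clear-one (v Fin.zero) | clear (v ∘ Fin.suc)
... | t₀ , D₀ , iD₀ , iDv , tD₀ | C = record
  { t = t₀ * t ; D = D₀ * D
  ; w = λ { Fin.zero → D * (D₀ * v Fin.zero) ; (Fin.suc i) → D₀ * w i }
  ; int-D = int-* iD₀ int-D
  ; int-w = λ { Fin.zero → int-* int-D iDv ; (Fin.suc i) → int-* iD₀ (int-w i) }
  ; tD≡1 = trans (l₁ t₀ t D₀ D) (trans (cong₂ _*_ tD₀ tD≡1) (*-identityˡ 1ℚ))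
  ; v≡tw = λ { Fin.zero → sym (trans (l₂ t₀ t D₀ D (v Fin.zero)) (trans (cong₂ (λ x y → x * y * v Fin.zero) tD₀ tD≡1) (l₃ (v Fin.zero))))
             ; (Fin.suc i) → trans (v≡tw i) (sym (trans (l₄ t₀ t D₀ (w i)) (trans (cong (_* (t * w i)) tD₀) (*-identityˡ (t * w i))))) } }
  where
  open Cleared C
  l₁ : ∀ t₀ t D₀ D → (t₀ * t) * (D₀ * D) ≡ (t₀ * D₀) * (t * D)
  l₁ = solve-∀ ℚ-ring
  l₂ : ∀ t₀ t D₀ D v → (t₀ * t) * (D * (D₀ * v)) ≡ (t₀ * D₀) * (t * D) * v
  l₂ = solve-∀ ℚ-ring
  l₃ : ∀ v → 1ℚ * 1ℚ * v ≡ v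
  l₃ = solve-∀ ℚ-ring
  l₄ : ∀ t₀ t D₀ w → (t₀ * t) * (D₀ * w) ≡ (t₀ * D₀) * (t * w)
  l₄ = solve-∀ ℚ-ring

-- Where b is invertible modulo ℓ, k = -a/b works. The lemma fixes the parameter left free when a
-- primitive vector is completed to a matrix in SL₂(ℤ): the two alternatives correspond to the two
-- ways of keeping a matrix typed.
affine-root : ∀ {N} → 0 < N → SquareFree N → (a b : ℕ → ℚ) → (∀ ℓ → IsInt (a ℓ)) → (∀ ℓ → IsInt (b ℓ)) →
  ∃[ k ] IsInt k × (∀ ℓ → Prime ℓ → ℓ ∣ N → Div ℓ (b ℓ) ⊎ Div ℓ (a ℓ + k * b ℓ))
affine-root 0<N sf a b ia ib = crt (λ ℓ k → Div ℓ (b ℓ) ⊎ Div ℓ (a ℓ + k * b ℓ)) transfer 0<N sf local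
  where
  l₁ : ∀ a b x y → (a + x * b) - (x - y) * b ≡ a + y * b
  l₁ = solve-∀ ℚ-ring
  transfer : ∀ {ℓ} x y → IsInt x → IsInt y → Div ℓ (x - y) →
    Div ℓ (b ℓ) ⊎ Div ℓ (a ℓ + x * b ℓ) → Div ℓ (b ℓ) ⊎ Div ℓ (a ℓ + y * b ℓ)
  transfer {ℓ} x y _ _ d = Sum.map₂ (λ h → div-resp (l₁ (a ℓ) (b ℓ) x y) (div-sub h (div-*ʳ d (ib ℓ))))
  l₂ : ∀ a b y → a * (1ℚ - b * y) ≡ a + (- (a * y)) * b
  l₂ = solve-∀ ℚ-ring
  local : ∀ ℓ → Prime ℓ → ℓ ∣ _ → ∃[ k ] IsInt k × (Div ℓ (b ℓ) ⊎ Div ℓ (a ℓ + k * b ℓ))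
  local ℓ pℓ _ with div? ℓ (ib ℓ)
  ... | yes d = 0ℚ , int-0 , inj₁ d
  ... | no ¬d with prime-inverse pℓ (ib ℓ) ¬d
  ...   | y , iy , h = - (a ℓ * y) , int-neg (int-* (ia ℓ) iy) , inj₂ (div-resp (l₂ (a ℓ) (b ℓ) y) (div-*ˡ (ia ℓ) h))

Turnable : SL₂ℤ → ℕ → Set
Turnable X ℓ = Div ℓ (SL₂ℤ.r X) ⊎ Div ℓ (SL₂ℤ.s X)

-- A type assigns a bit to every ℓ, while a reason is available only at the primes dividing N. So
-- the bit is decided first and the hypothesis B, later `Prime ℓ × ℓ ∣ N`, enters only its
-- correctness.
turn : ∀ (X : SL₂ℤ) ℓ {B : Set} → (B → Turnable X ℓ) → Σ[ t ∈ Bool ] (B → Turn ℓ X false t)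
turn X ℓ h with div? ℓ (SL₂ℤ.int-r X)
... | yes d = false , λ _ → ff d
... | no ¬d = true , λ B → ft ([ (λ d → contradiction d ¬d) , (λ d → d) ]′ (h B))

Exchangeable : SL₂ℤ → ℕ → Bool → Bool → Set
Exchangeable X ℓ false true  = Div ℓ (SL₂ℤ.s X) ⊎ Div ℓ (SL₂ℤ.r X)
Exchangeable X ℓ true  false = Div ℓ (SL₂ℤ.q X) ⊎ Div ℓ (SL₂ℤ.p X)
Exchangeable X ℓ _     _     = ⊤

exchange : ∀ (X : SL₂ℤ) ℓ u v {B : Set} → (B → Exchangeable X ℓ u v) →
  Σ[ u′ ∈ Bool ] Σ[ v′ ∈ Bool ] (B → Exchange ℓ X u v u′ v′)
exchange X ℓ false false h = false , false , λ _ → same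
exchange X ℓ true  true  h = true , true , λ _ → same
exchange X ℓ false true  h with div? ℓ (SL₂ℤ.int-s X)
... | yes d = true , false , λ _ → ft-tf d
... | no ¬d = false , true , λ B → ft-ft ([ (λ d → contradiction d ¬d) , (λ d → d) ]′ (h B))
exchange X ℓ true  false h with div? ℓ (SL₂ℤ.int-q X)
... | yes d = true , false , λ _ → tf-tf d
... | no ¬d = false , true , λ B → tf-ft ([ (λ d → contradiction d ¬d) , (λ d → d) ]′ (h B))

pairBlock-row : ∀ (i j : Fin n) p q r s (y : Fin n → ℚ) k →
  sumF (λ l → pairBlock i j p q r s k l * y l) ≡
  y k + (δ k i * ((p - 1ℚ) * y i + q * y j) + δ k j * (r * y i + (s - 1ℚ) * y j))
pairBlock-row i j p q r s y k = begin
  sumF (λ l → pairBlock i j p q r s k l * y l)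
    ≡⟨ sumF-cong (λ l → expand (δ k l) (δ k i) (δ k j) p q r s (δ i l) (δ j l) (y l)) ⟩
  sumF (λ l → δ k l * y l + (A * (δ i l * y l) + B * (δ j l * y l)))
    ≡⟨ sumF-+ (λ l → δ k l * y l) (λ l → A * (δ i l * y l) + B * (δ j l * y l)) ⟩
  sumF (λ l → δ k l * y l) + sumF (λ l → A * (δ i l * y l) + B * (δ j l * y l))
    ≡⟨ cong₂ _+_ (sumF-δˡ k y) (trans (sumF-+ (λ l → A * (δ i l * y l)) (λ l → B * (δ j l * y l)))
         (cong₂ _+_ (trans (sumF-*ˡ A (λ l → δ i l * y l)) (cong (A *_) (sumF-δˡ i y)))
                    (trans (sumF-*ˡ B (λ l → δ j l * y l)) (cong (B *_) (sumF-δˡ j y))))) ⟩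
  y k + (A * y i + B * y j)
    ≡⟨ regroup (δ k i) (δ k j) p q r s (y k) (y i) (y j) ⟩
  y k + (δ k i * ((p - 1ℚ) * y i + q * y j) + δ k j * (r * y i + (s - 1ℚ) * y j)) ∎
  where
  open ≡-Reasoning
  A = δ k i * (p - 1ℚ) + δ k j * r
  B = δ k i * q + δ k j * (s - 1ℚ)
  expand : ∀ d u v p q r s a b y →
    (d + (u * ((p - 1ℚ) * a + q * b) + v * (r * a + (s - 1ℚ) * b))) * y ≡
    d * y + ((u * (p - 1ℚ) + v * r) * (a * y) + (u * q + v * (s - 1ℚ)) * (b * y))
  expand = solve-∀ ℚ-ring
  regroup : ∀ u v p q r s x y z →
    x + ((u * (p - 1ℚ) + v * r) * y + (u * q + v * (s - 1ℚ)) * z) ≡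
    x + (u * ((p - 1ℚ) * y + q * z) + v * (r * y + (s - 1ℚ) * z))
  regroup = solve-∀ ℚ-ring

topVector : (Fin n → ℚ) → Idx n → ℚ
topVector c (inj₁ k) = c k
topVector c (inj₂ k) = 0ℚ

·-topVector : ∀ (A : Mat2 n) c i → (A · topVector c) i ≡ sumF (λ k → A i (top k) * c k)
·-topVector A c i = trans (cong (sumF (λ k → A i (top k) * c k) +_) (sumF-zero (λ k → *-zeroʳ (A i (bot k)))))
  (+-identityʳ (sumF (λ k → A i (top k) * c k)))

·-cong-vector : ∀ (A : Mat2 n) {y z : Idx n → ℚ} → (∀ k → y k ≡ z k) → ∀ i → (A · y) i ≡ (A · z) i
·-cong-vector A eq i = sumI-cong (λ k → cong (A i k *_) (eq k))

module _ {N : ℕ} (0<N : 0 < N) (sf : SquareFree N) where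

  -- The integral vector w is the image of a vector c in the span of the top basis vectors;
  -- simplifying c then changes τ only by right factors that keep it typed.
  record Presentation {n} (w : Idx n → ℚ) (c : Fin n → ℚ) : Set where
    field
      τ      : Mat2 n
      β      : Types n
      sp     : IsSp n τ
      int-τ  : IntegralM τ
      typed  : HasType N τ β
      int-c  : ∀ k → IsInt (c k)
      image  : ∀ i → w i ≡ (τ · topVector c) i

  -- In the k-th plane w is a multiple of a primitive vector (a₀, b₀), taken as first column of an
  -- SL₂(ℤ)-matrix. The second column is free up to a multiple h of the first, and h makes its lower
  -- entry vanish at each ℓ that does not divide b₀.
  present : (w : Idx n → ℚ) → (∀ i → IsInt (w i)) → Σ[ c ∈ (Fin n → ℚ) ] Presentation w c
  present {n} w iw = (λ k → Bezout.g (bz k)) , record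
    { τ = idM ⊗ coordinatewise X
    ; β = λ ℓ k → proj₁ (bit ℓ k)
    ; sp = sp-⊗ idM (coordinatewise X) sp-idM (sp-coordinatewise X)
    ; int-τ = integral-⊗ {A = idM} {coordinatewise X} integral-idM (integral-coordinatewise X)
    ; typed = coordinatewise-type X integral-idM (λ ℓ _ _ _ _ → div-0 ℓ) (λ ℓ pℓ ℓ∣N k → proj₂ (bit ℓ k) (pℓ , ℓ∣N))
    ; int-c = λ k → Bezout.int-g (bz k)
    ; image = λ i → sym (trans (·-cong (⊗.identityˡ (coordinatewise X)) (topVector c) i)
                          (trans (·-topVector (coordinatewise X) c i) (value i))) }
    where
    bz : ∀ k → Bezout (w (top k)) (w (bot k))
    bz k = bezout (iw (top k)) (iw (bot k))
    c : Fin n → ℚ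
    c k = Bezout.g (bz k)
    root : ∀ k → ∃[ h ] IsInt h × (∀ ℓ → Prime ℓ → ℓ ∣ N → Div ℓ (Bezout.b₀ (bz k)) ⊎ Div ℓ (Bezout.x (bz k) + h * Bezout.b₀ (bz k)))
    root k = affine-root 0<N sf (λ _ → Bezout.x (bz k)) (λ _ → Bezout.b₀ (bz k)) (λ _ → Bezout.int-x (bz k)) (λ _ → Bezout.int-b₀ (bz k))
    X : Fin n → SL₂ℤ
    X k = record
      { p = a₀ ; q = - y + h * a₀ ; r = b₀ ; s = x + h * b₀
      ; int-p = int-a₀ ; int-q = int-+ (int-neg int-y) (int-* ih int-a₀)
      ; int-r = int-b₀ ; int-s = int-+ int-x (int-* ih int-b₀)
      ; det = trans (l a₀ b₀ x y h) unit }
      where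
      open Bezout (bz k)
      h = proj₁ (root k)
      ih = proj₁ (proj₂ (root k))
      l : ∀ a b x y h → a * (x + h * b) - (- y + h * a) * b ≡ x * a + y * b
      l = solve-∀ ℚ-ring
    bit : ∀ ℓ k → Σ[ t ∈ Bool ] (Prime ℓ × ℓ ∣ N → Turn ℓ (X k) false t)
    bit ℓ k = turn (X k) ℓ (λ { (pℓ , ℓ∣N) → proj₂ (proj₂ (root k)) ℓ pℓ ℓ∣N })
    scaled : ∀ (k : Fin n) (f : Fin n → ℚ) → sumF (λ l → δ k l * f l * c l) ≡ f k * c k
    scaled k f = trans (sumF-cong (λ l → *-assoc (δ k l) (f l) (c l))) (sumF-δˡ k (λ l → f l * c l))
    value : ∀ i → sumF (λ k → coordinatewise X i (top k) * c k) ≡ w i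
    value (inj₁ k) = trans (scaled k (λ l → SL₂ℤ.p (X l))) (trans (*-comm (Bezout.a₀ (bz k)) (c k)) (sym (Bezout.a≡ (bz k))))
    value (inj₂ k) = trans (scaled k (λ l → SL₂ℤ.r (X l))) (trans (*-comm (Bezout.b₀ (bz k)) (c k)) (sym (Bezout.b≡ (bz k))))

  -- The coordinates i and j of c are replaced by 0 and their gcd, by an SL₂(ℤ) acting on both; it is
  -- determined up to a parameter k, chosen so that the type is preserved or exchanged at every prime.
  eliminate : ∀ {w : Idx n → ℚ} {c} {i j} → i ≢ j → Presentation w c →
    Σ[ c′ ∈ (Fin n → ℚ) ] Presentation w c′ × c′ i ≡ 0ℚ × (∀ k → k ≢ i → k ≢ j → c′ k ≡ c k)
  eliminate {n} {w} {c} {i} {j} i≢j P = c′ , record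
    { τ = τ ⊗ G
    ; β = β′
    ; sp = sp-⊗ τ G sp (sp-pairwise i≢j X)
    ; int-τ = integral-⊗ {A = τ} {G} int-τ (integral-pairwise i≢j X)
    ; typed = pairwise-type i≢j X int-τ typed (λ ℓ pℓ ℓ∣N →
        (λ k k≢i k≢j → sym (trans (update-≢ (update (β ℓ) i (proj₁ (bits ℓ))) (proj₁ (proj₂ (bits ℓ))) k≢j) (update-≢ (β ℓ) (proj₁ (bits ℓ)) k≢i))) ,
        subst₂ (Exchange ℓ X (β ℓ i) (β ℓ j))
          (sym (trans (update-≢ (update (β ℓ) i (proj₁ (bits ℓ))) (proj₁ (proj₂ (bits ℓ))) i≢j) (update-≡ (β ℓ) i (proj₁ (bits ℓ)))))
          (sym (update-≡ (update (β ℓ) i (proj₁ (bits ℓ))) j (proj₁ (proj₂ (bits ℓ)))))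
          (proj₂ (proj₂ (bits ℓ)) (pℓ , ℓ∣N)))
    ; int-c = int-c′
    ; image = λ a → trans (image a) (sym (trans (·-assoc τ G (topVector c′) a) (·-cong-vector τ moved a))) }
    , c′i , c′-≢
    where
    open Presentation P
    open Bezout (bezout (int-c i) (int-c j)) renaming (a₀ to c₁; b₀ to c₂; int-a₀ to int-c₁; int-b₀ to int-c₂)
    -- Up to sign, `b` and `a + k b` are the entries s and r of X for the bits 0, 1, and q and p for
    -- the bits 1, 0; one of the two must vanish modulo ℓ. Equal bits demand nothing, and k · 1 is a
    -- soluble filler.
    a b : Bool → Bool → ℚ
    a false true  = x
    a true  false = y
    a _     _     = 0ℚ
    b false true  = c₂
    b true  false = - c₁
    b _     _     = 1ℚ
    ia : ∀ u v → IsInt (a u v)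
    ia false true  = int-x
    ia true  false = int-y
    ia false false = int-0
    ia true  true  = int-0
    ib : ∀ u v → IsInt (b u v)
    ib false true  = int-c₂
    ib true  false = int-neg int-c₁
    ib false false = int-1
    ib true  true  = int-1
    root : ∃[ k ] IsInt k × (∀ ℓ → Prime ℓ → ℓ ∣ N → Div ℓ (b (β ℓ i) (β ℓ j)) ⊎ Div ℓ (a (β ℓ i) (β ℓ j) + k * b (β ℓ i) (β ℓ j)))
    root = affine-root 0<N sf (λ ℓ → a (β ℓ i) (β ℓ j)) (λ ℓ → b (β ℓ i) (β ℓ j)) (λ ℓ → ia (β ℓ i) (β ℓ j)) (λ ℓ → ib (β ℓ i) (β ℓ j))
    k = proj₁ root
    ik = proj₁ (proj₂ root)
    -- Its second column (c₁, c₂) sends (0, g) to the old coordinates (c i, c j); its first column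
    -- is the Bézout completion, shifted by k times the second.
    X : SL₂ℤ
    X = record
      { p = y + k * - c₁ ; q = c₁ ; r = - (x + k * c₂) ; s = c₂
      ; int-p = int-+ int-y (int-* ik (int-neg int-c₁)) ; int-q = int-c₁
      ; int-r = int-neg (int-+ int-x (int-* ik int-c₂)) ; int-s = int-c₂
      ; det = trans (l x y c₁ c₂ k) unit }
      where
      l : ∀ x y a b k → (y + k * - a) * b - a * (- (x + k * b)) ≡ x * a + y * b
      l = solve-∀ ℚ-ring
    G = pairwise i≢j X
    exchangeable : ∀ ℓ u v → Div ℓ (b u v) ⊎ Div ℓ (a u v + k * b u v) → Exchangeable X ℓ u v
    exchangeable ℓ false true  = Sum.map₂ div-neg
    exchangeable ℓ true  false = Sum.map₁ (λ d → div-resp (neg-involutive c₁) (div-neg d))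
    exchangeable ℓ false false _ = _
    exchangeable ℓ true  true  _ = _
    bits : ∀ ℓ → Σ[ u′ ∈ Bool ] Σ[ v′ ∈ Bool ] (Prime ℓ × ℓ ∣ N → Exchange ℓ X (β ℓ i) (β ℓ j) u′ v′)
    bits ℓ = exchange X ℓ (β ℓ i) (β ℓ j) (λ { (pℓ , ℓ∣N) → exchangeable ℓ (β ℓ i) (β ℓ j) (proj₂ (proj₂ root) ℓ pℓ ℓ∣N) })
    β′ : Types n
    β′ ℓ = update (update (β ℓ) i (proj₁ (bits ℓ))) j (proj₁ (proj₂ (bits ℓ)))
    c′ : Fin n → ℚ
    c′ k with k Fin.≟ i | k Fin.≟ j
    ... | yes _ | _     = 0ℚ
    ... | no _  | yes _ = g
    ... | no _  | no _  = c k
    c′i : c′ i ≡ 0ℚ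
    c′i with i Fin.≟ i
    ... | yes _  = refl
    ... | no i≢i = contradiction refl i≢i
    c′j : c′ j ≡ g
    c′j with j Fin.≟ i | j Fin.≟ j
    ... | yes refl | _      = contradiction refl i≢j
    ... | no _     | yes _  = refl
    ... | no _     | no j≢j = contradiction refl j≢j
    c′-≢ : ∀ k → k ≢ i → k ≢ j → c′ k ≡ c k
    c′-≢ k k≢i k≢j with k Fin.≟ i | k Fin.≟ j
    ... | yes k≡i | _       = contradiction k≡i k≢i
    ... | no _    | yes k≡j = contradiction k≡j k≢j
    ... | no _    | no _    = refl
    int-c′ : ∀ k → IsInt (c′ k)
    int-c′ k with k Fin.≟ i | k Fin.≟ j
    ... | yes _ | _     = int-0
    ... | no _  | yes _ = int-g
    ... | no _  | no _  = int-c k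
    row-value : ∀ l {u v ci cj cl} → δ l i ≡ u → δ l j ≡ v → c′ i ≡ ci → c′ j ≡ cj → c′ l ≡ cl →
      sumF (λ k → pairBlock i j (SL₂ℤ.p X) (SL₂ℤ.q X) (SL₂ℤ.r X) (SL₂ℤ.s X) l k * c′ k) ≡
      cl + (u * ((SL₂ℤ.p X - 1ℚ) * ci + SL₂ℤ.q X * cj) + v * (SL₂ℤ.r X * ci + (SL₂ℤ.s X - 1ℚ) * cj))
    row-value l refl refl refl refl refl = pairBlock-row i j (SL₂ℤ.p X) (SL₂ℤ.q X) (SL₂ℤ.r X) (SL₂ℤ.s X) c′ l
    moved-top : ∀ l → sumF (λ k → pairBlock i j (SL₂ℤ.p X) (SL₂ℤ.q X) (SL₂ℤ.r X) (SL₂ℤ.s X) l k * c′ k) ≡ c l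
    moved-top l = by-cases (l Fin.≟ i) (l Fin.≟ j)
      where
      f₁ : ∀ p q r s g → 0ℚ + (1ℚ * (p * 0ℚ + q * g) + 0ℚ * (r * 0ℚ + s * g)) ≡ g * q
      f₁ = solve-∀ ℚ-ring
      f₂ : ∀ p q r s g → g + (0ℚ * (p * 0ℚ + q * g) + 1ℚ * (r * 0ℚ + (s - 1ℚ) * g)) ≡ g * s
      f₂ = solve-∀ ℚ-ring
      f₃ : ∀ x u v → x + (0ℚ * u + 0ℚ * v) ≡ x
      f₃ = solve-∀ ℚ-ring
      by-cases : Dec (l ≡ i) → Dec (l ≡ j) → _
      by-cases (yes refl) _ = trans (row-value i (δ-refl i) (δ-≢ i≢j) c′i c′j c′i)
        (trans (f₁ (SL₂ℤ.p X - 1ℚ) (SL₂ℤ.q X) (SL₂ℤ.r X) (SL₂ℤ.s X - 1ℚ) g) (sym a≡))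
      by-cases (no _) (yes refl) = trans (row-value j (δ-≢ (i≢j ∘ sym)) (δ-refl j) c′i c′j c′j)
        (trans (f₂ (SL₂ℤ.p X - 1ℚ) (SL₂ℤ.q X) (SL₂ℤ.r X) (SL₂ℤ.s X) g) (sym b≡))
      by-cases (no l≢i) (no l≢j) = trans (row-value l (δ-≢ l≢i) (δ-≢ l≢j) c′i c′j (c′-≢ l l≢i l≢j))
        (f₃ (c l) ((SL₂ℤ.p X - 1ℚ) * 0ℚ + SL₂ℤ.q X * g) (SL₂ℤ.r X * 0ℚ + (SL₂ℤ.s X - 1ℚ) * g))
    moved : ∀ m → (G · topVector c′) m ≡ topVector c m
    moved (inj₁ l) = trans (·-topVector G c′ (top l)) (moved-top l)
    moved (inj₂ l) = trans (·-topVector G c′ (bot l)) (sumF-zero (λ k → *-zeroˡ (c′ k)))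

  fromℕ≢fromℕ< : ∀ {b m} (b<m : b < m) → fromℕ< (ℕₚ.m≤n⇒m≤1+n b<m) ≢ fromℕ m
  fromℕ≢fromℕ< {b} {m} b<m eq = ℕₚ.<-irrefl (trans (sym (Finₚ.toℕ-fromℕ< (ℕₚ.m≤n⇒m≤1+n b<m))) (trans (cong toℕ eq) (Finₚ.toℕ-fromℕ m))) b<m

  zeros-suc : ∀ {b m} (b<m : b < m) {c c′ : Fin (suc m) → ℚ} → (∀ k → toℕ k < b → c k ≡ 0ℚ) →
    c′ (fromℕ< (ℕₚ.m≤n⇒m≤1+n b<m)) ≡ 0ℚ → (∀ k → k ≢ fromℕ< (ℕₚ.m≤n⇒m≤1+n b<m) → k ≢ fromℕ m → c′ k ≡ c k) →
    ∀ k → toℕ k < suc b → c′ k ≡ 0ℚ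
  zeros-suc {b} {m} b<m zeros c′i c′-≢ k (s≤s k≤b) with ℕₚ.m≤n⇒m<n∨m≡n k≤b
  ... | inj₁ k<b = trans (c′-≢ k (λ { refl → ℕₚ.<-irrefl (Finₚ.toℕ-fromℕ< (ℕₚ.m≤n⇒m≤1+n b<m)) k<b })
                                 (λ { refl → ℕₚ.<-asym (subst (ℕ._< b) (Finₚ.toℕ-fromℕ m) k<b) b<m })) (zeros k k<b)
  ... | inj₂ k≡b with Finₚ.toℕ-injective (trans k≡b (sym (Finₚ.toℕ-fromℕ< (ℕₚ.m≤n⇒m≤1+n b<m))))
  ...   | refl = c′i

  -- Every coordinate is cleared against the last one, which accumulates the gcd, so zeros obtained
  -- earlier are not disturbed.
  concentrate : ∀ {m} {w : Idx (suc m) → ℚ} → (∀ i → IsInt (w i)) → ∀ b → b ≤ m →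
    Σ[ c ∈ (Fin (suc m) → ℚ) ] Presentation w c × (∀ k → toℕ k < b → c k ≡ 0ℚ)
  concentrate {w = w} iw zero    b≤m = proj₁ (present w iw) , proj₂ (present w iw) , λ _ ()
  concentrate {m} iw (suc b) b<m =
    let c , P , zeros = concentrate iw b (ℕₚ.<⇒≤ b<m)
        c′ , P′ , c′i , c′-≢ = eliminate (fromℕ≢fromℕ< b<m) P
    in c′ , P′ , zeros-suc b<m {c} {c′} zeros c′i c′-≢

sumF-last : ∀ {m} (f : Fin (suc m) → ℚ) → (∀ k → toℕ k < m → f k ≡ 0ℚ) → sumF f ≡ f (fromℕ m)
sumF-last {zero}  f h = +-identityʳ (f Fin.zero)
sumF-last {suc m} f h = trans (cong₂ _+_ (h Fin.zero (s≤s z≤n)) (sumF-last (f ∘ Fin.suc) (λ k k<m → h (Fin.suc k) (s≤s k<m))))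
  (+-identityˡ (f (Fin.suc (fromℕ m))))

corner : ∀ {m} → Mat2 (suc m) → Mat2 m
corner {m} q i j = q (embI (ℕₚ.n≤1+n m) i) (embI (ℕₚ.n≤1+n m) j)

extend-small : ∀ {r s} (r≤n : r ≤ n) → s ≤ r → {β : Fin r → Bool} {γ : Fin n → Bool} →
  (∀ a → toℕ a < s → β a ≡ false) → ∀ k → toℕ k < s → extend r≤n β γ k ≡ false
extend-small {s = s} r≤n s≤r {β} {γ} small k k<s = go (inner? r≤n k) k<s
  where
  go : ∀ {k} → Inner? r≤n k → toℕ k < s → extend r≤n β γ k ≡ false
  go (inner a) a<s = trans (extend-inner r≤n β γ a) (small a (subst (ℕ._< s) (Finₚ.toℕ-inject≤ a r≤n) a<s))
  go (outer h) k<s = contradiction (ℕₚ.≤-trans s≤r h) (ℕₚ.<⇒≱ k<s)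

module _ {N : ℕ} (0<N : 0 < N) (sf : SquareFree N) where

  -- The scalar `c` is rational, as it also carries the common denominator of v. Bits before the
  -- last are 0 so that τ can later be multiplied by `ξ` of a typed matrix of size m.
  record ColumnForm {m} (v : Idx (suc m) → ℚ) : Set where
    field
      τ       : Mat2 (suc m)
      β       : Types (suc m)
      c       : ℚ
      sp      : IsSp (suc m) τ
      int-τ   : IntegralM τ
      typed   : HasType N τ β
      β-small : ∀ ℓ k → toℕ k < m → β ℓ k ≡ false
      column≡ : ∀ i → v i ≡ c * τ i (top (fromℕ m))

  module _ {m} (β : Types (suc m)) where

    private
      e : ∀ k → ∃[ e ] IsInt e × (∀ ℓ → Prime ℓ → ℓ ∣ N → Bit (β ℓ k xor false) ℓ e)
      e k = idempotent 0<N sf (λ ℓ → β ℓ k xor false)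

      select : (k : Fin (suc m)) → Dec (toℕ k < m) → SL₂ℤ
      select k (yes _) = rotation (proj₁ (proj₂ (e k)))
      select k (no  _) = rotation int-0

      unchanged : ∀ ℓ x → Turn ℓ (rotation int-0) x x
      unchanged ℓ false = ff (div-0 ℓ)
      unchanged ℓ true  = tt (rotation-0 int-0 (div-0 ℓ))

      select-turn : ∀ ℓ → Prime ℓ → ℓ ∣ N → ∀ k (k<m? : Dec (toℕ k < m)) →
        Turn ℓ (select k k<m?) (β ℓ k) (window m (β ℓ) k)
      select-turn ℓ pℓ ℓ∣N k (yes k<m) = subst (Turn ℓ (select k (yes k<m)) (β ℓ k)) (sym (window-< m (β ℓ) k k<m))
        (rotation-turn (proj₁ (proj₂ (e k))) (β ℓ k) false (proj₂ (proj₂ (e k)) ℓ pℓ ℓ∣N))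
      select-turn ℓ pℓ ℓ∣N k (no k≮m) = subst (Turn ℓ (select k (no k≮m)) (β ℓ k)) (sym (window-≥ m (β ℓ) k (ℕₚ.≮⇒≥ k≮m)))
        (unchanged ℓ (β ℓ k))

    -- Rotates the planes before the last back to bit 0 and leaves the last plane alone, hence also
    -- the column that is proportional to the given vector.
    reset : Fin (suc m) → SL₂ℤ
    reset k = select k (toℕ k ℕ.<? m)

    reset-turn : ∀ ℓ → Prime ℓ → ℓ ∣ N → ∀ k → Turn ℓ (reset k) (β ℓ k) (window m (β ℓ) k)
    reset-turn ℓ pℓ ℓ∣N k = select-turn ℓ pℓ ℓ∣N k (toℕ k ℕ.<? m)

    reset-last : (x : Idx (suc m) → ℚ) →
      sumI (λ k → x k * coordinatewise reset k (top (fromℕ m))) ≡ x (top (fromℕ m))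
    reset-last x = trans (coordinatewise-columnˡ reset x (fromℕ m)) (go (toℕ (fromℕ m) ℕ.<? m))
      where
      l : ∀ x y → x * (1ℚ - 0ℚ * 0ℚ) + y * 0ℚ ≡ x
      l = solve-∀ ℚ-ring
      go : (d : Dec (toℕ (fromℕ m) < m)) →
        x (top (fromℕ m)) * SL₂ℤ.p (select (fromℕ m) d) + x (bot (fromℕ m)) * SL₂ℤ.r (select (fromℕ m) d) ≡ x (top (fromℕ m))
      go (yes lt) = contradiction (subst (ℕ._< m) (Finₚ.toℕ-fromℕ m) lt) (ℕₚ.<-irrefl refl)
      go (no _)   = l (x (top (fromℕ m))) (x (bot (fromℕ m)))

  columnForm : ∀ {m} (v : Idx (suc m) → ℚ) → ColumnForm v
  columnForm {m} v = record
    { τ = τ ⊗ coordinatewise X ; β = λ ℓ → window m (β ℓ) ; c = t * c (fromℕ m)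
    ; sp = sp-⊗ τ (coordinatewise X) sp (sp-coordinatewise X)
    ; int-τ = integral-⊗ {A = τ} {coordinatewise X} int-τ (integral-coordinatewise X)
    ; typed = coordinatewise-type X int-τ typed (reset-turn β)
    ; β-small = λ ℓ k k<m → window-< m (β ℓ) k k<m
    ; column≡ = λ i → begin
        v i                                    ≡⟨ cong v (Finₚ.splitAt-join (suc m) (suc m) i) ⟨
        v (splitAt (suc m) (join (suc m) (suc m) i)) ≡⟨ v≡tw (join (suc m) (suc m) i) ⟩
        t * W i                                ≡⟨ cong (t *_) (trans (image i) (trans (·-topVector τ c i)
                                                    (sumF-last (λ k → τ i (top k) * c k) (λ k k<m → trans (cong (τ i (top k) *_) (zeros k k<m)) (*-zeroʳ (τ i (top k))))))) ⟩
        t * (τ i (top (fromℕ m)) * c (fromℕ m)) ≡⟨ l t (τ i (top (fromℕ m))) (c (fromℕ m)) ⟩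
        t * c (fromℕ m) * τ i (top (fromℕ m))  ≡⟨ cong (t * c (fromℕ m) *_) (reset-last β (τ i)) ⟨
        t * c (fromℕ m) * (τ ⊗ coordinatewise X) i (top (fromℕ m)) ∎ }
    where
    open ≡-Reasoning
    open Cleared (clear (v ∘ splitAt (suc m)))
    W : Idx (suc m) → ℚ
    W i = w (join (suc m) (suc m) i)
    conc : Σ[ c ∈ (Fin (suc m) → ℚ) ] Presentation 0<N sf W c × (∀ k → toℕ k < m → c k ≡ 0ℚ)
    conc = concentrate 0<N sf {w = W} (λ i → int-w (join (suc m) (suc m) i)) m ℕₚ.≤-refl
    c = proj₁ conc
    zeros = proj₂ (proj₂ conc)
    open Presentation (proj₁ (proj₂ conc))
    X = reset β
    l : ∀ t x c → t * (x * c) ≡ t * c * x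
    l = solve-∀ ℚ-ring

  -- Factoring symplectic matrices as a typed matrix times an element of P

  record Decomposition {n} (s : ℕ) (g : Mat2 n) : Set where
    field
      τ       : Mat2 n
      β       : Types n
      p       : Mat2 n
      sp      : IsSp n τ
      int-τ   : IntegralM τ
      typed   : HasType N τ β
      β-small : ∀ ℓ k → toℕ k < s → β ℓ k ≡ false
      p∈P     : InP n s p
      g≈τp    : g ≈ τ ⊗ p

  -- A symplectic q preserving the line of the last top basis vector has the block shape of P_{m+1,m}.
  module Reduce {m} (q : Mat2 (suc m)) (spq : IsSp (suc m) q) (c : ℚ)
                (q-last : ∀ i → q i (top (fromℕ m)) ≡ c * idM i (top (fromℕ m))) where

    private
      last : Fin (suc m)
      last = fromℕ m
      m≤ : m ≤ suc m
      m≤ = ℕₚ.n≤1+n m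
      l0 : ∀ {x} y → x ≡ 0ℚ → x * y ≡ 0ℚ
      l0 y refl = *-zeroˡ y
      r0 : ∀ x {y} → y ≡ 0ℚ → x * y ≡ 0ℚ
      r0 x refl = *-zeroʳ x

    outer⇒last : ∀ k → m ≤ toℕ k → k ≡ last
    outer⇒last k m≤k = Finₚ.toℕ-injective (trans (ℕₚ.≤-antisym (ℕₚ.≤-pred (Finₚ.toℕ<n k)) m≤k) (sym (Finₚ.toℕ-fromℕ m)))

    -- Row `bot last` of q⁻¹ consists, up to sign, of the entries of column `top last` of q, which
    -- is c times a basis vector. The relation q⁻¹ q = 1 therefore determines row `bot last` of q
    -- and forces c ≠ 0.
    c*row : ∀ j → c * q (bot last) j ≡ idM (bot last) j
    c*row j = trans (sym value) (sp-inverseˡ q spq (bot last) j)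
      where
      term₁ : ∀ b → - q (bot b) (top last) * q (top b) j ≡ 0ℚ
      term₁ b = l0 (q (top b) j) (cong -_ (trans (q-last (bot b)) (*-zeroʳ c)))
      term₂ : ∀ b → q (top b) (top last) * q (bot b) j ≡ c * (δ last b * q (bot b) j)
      term₂ b = trans (cong (_* q (bot b) j) (trans (q-last (top b)) (cong (c *_) (δ-sym b last)))) (*-assoc c (δ last b) (q (bot b) j))
      value : (adj q ⊗ q) (bot last) j ≡ c * q (bot last) j
      value = trans (cong₂ _+_ (sumF-zero term₁) (trans (sumF-cong term₂)
                (trans (sumF-*ˡ c (λ b → δ last b * q (bot b) j)) (cong (c *_) (sumF-δˡ last (λ b → q (bot b) j))))))
              (+-identityˡ (c * q (bot last) j))

    c≢0 : c ≢ 0ℚ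
    c≢0 c≡0 = ℚₚ.1≢0 (trans (sym (trans (c*row (bot last)) (δ-refl last))) (l0 {c} (q (bot last) (bot last)) c≡0))

    row-zero : ∀ j → bot last ≢ j → q (bot last) j ≡ 0ℚ
    row-zero j ≢j = *-cancelʳ-≢0 (q (bot last) j) 0ℚ c c≢0
      (trans (*-comm (q (bot last) j) c) (trans (c*row j) (trans (off j ≢j) (sym (*-zeroˡ c)))))
      where
      off : ∀ j → bot last ≢ j → idM (bot last) j ≡ 0ℚ
      off (inj₁ b) _  = refl
      off (inj₂ b) ≢j = δ-≢ {k = last} {b} (≢j ∘ cong bot)

    last≢emb : ∀ a → last ≢ emb m≤ a
    last≢emb a eq = ℕₚ.<-irrefl (trans (cong toℕ (sym eq)) (Finₚ.toℕ-fromℕ m)) (emb-< m≤ a)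

    row-zero-emb : ∀ i → q (bot last) (embI m≤ i) ≡ 0ℚ
    row-zero-emb (inj₁ a) = row-zero (top (emb m≤ a)) (λ ())
    row-zero-emb (inj₂ a) = row-zero (bot (emb m≤ a)) (λ eq → last≢emb a (cong ix eq))

    column-zero-emb : ∀ i → q (embI m≤ i) (top last) ≡ 0ℚ
    column-zero-emb i = trans (q-last (embI m≤ i)) (r0 c (off i))
      where
      off : ∀ i → idM (embI m≤ i) (top last) ≡ 0ℚ
      off (inj₁ a) = δ-≢ {k = emb m≤ a} {last} (last≢emb a ∘ sym)
      off (inj₂ a) = refl

    h : Mat2 m
    h = corner q

    -- In the inner entries of q⁻¹ q the terms through the last plane drop out, because row
    -- `bot last` of q is zero on inner indices; what is left is h⁻¹ h.
    sp-h : IsSp m h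
    sp-h = adj-inverse⇒IsSp h λ i j → trans (sym (trans (sumI-emb m≤ (λ k → adj q (embI m≤ i) k * q k (embI m≤ j)) (vanish i j))
        (sumI-cong (λ k → cong (_* q (embI m≤ k) (embI m≤ j)) (adj-emb i k)))))
      (trans (sp-inverseˡ q spq (embI m≤ i) (embI m≤ j)) (idM-embI m≤ i j))
      where
      adj-emb : ∀ i k → adj q (embI m≤ i) (embI m≤ k) ≡ adj h i k
      adj-emb (inj₁ a) (inj₁ b) = refl
      adj-emb (inj₁ a) (inj₂ b) = refl
      adj-emb (inj₂ a) (inj₁ b) = refl
      adj-emb (inj₂ a) (inj₂ b) = refl
      adj-last : ∀ i → adj q (embI m≤ i) (top last) ≡ 0ℚ
      adj-last (inj₁ a) = row-zero-emb (bot a)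
      adj-last (inj₂ a) = cong -_ (row-zero-emb (top a))
      vanish : ∀ i j k → m ≤ toℕ (ix k) → adj q (embI m≤ i) k * q k (embI m≤ j) ≡ 0ℚ
      vanish i j (inj₁ k) m≤k = l0 (q (top k) (embI m≤ j)) (trans (cong (λ z → adj q (embI m≤ i) (top z)) (outer⇒last k m≤k)) (adj-last i))
      vanish i j (inj₂ k) m≤k = r0 (adj q (embI m≤ i) (bot k)) (trans (cong (λ z → q (bot z) (embI m≤ j)) (outer⇒last k m≤k)) (row-zero-emb j))

    module _ {s} (s≤m : s ≤ m) (k p : Mat2 m) (sp-k : IsSp m k) (p∈ : InP m s p) (kh≈p : k ⊗ h ≈ p) where

      private
        x : Mat2 (suc m)
        x = ξ m (suc m) k ⊗ q
        inner-value : ∀ i j → x (embI m≤ i) (embI m≤ j) ≡ p i j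
        inner-value i j = trans (ξ-row-inner m≤ k (λ l → q l (embI m≤ j)) i) (kh≈p i j)
        outer-value : ∀ i j → m ≤ toℕ (ix i) → x i j ≡ q i j
        outer-value i j h = ξ-row-outer m≤ k (λ l → q l j) i h
        column-value : ∀ i b → m ≤ toℕ b → x (embI m≤ i) (top b) ≡ 0ℚ
        column-value i b m≤b = trans (ξ-row-inner m≤ k (λ l → q l (top b)) i)
          (cong₂ _+_ (sumF-zero (λ l → r0 (k i (top l)) (vanish (top l)))) (sumF-zero (λ l → r0 (k i (bot l)) (vanish (bot l)))))
          where
          vanish : ∀ l → q (embI m≤ l) (top b) ≡ 0ℚ
          vanish l = trans (cong (λ z → q (embI m≤ l) (top z)) (outer⇒last b m≤b)) (column-zero-emb l)
        row-value : ∀ a j → m ≤ toℕ a → bot a ≢ j → x (bot a) j ≡ 0ℚ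
        row-value a j m≤a a≢j = trans (outer-value (bot a) j m≤a) (go (outer⇒last a m≤a))
          where
          go : a ≡ last → q (bot a) j ≡ 0ℚ
          go refl = row-zero j a≢j
        down : ∀ a → s ≤ toℕ (emb m≤ a) → s ≤ toℕ a
        down a = subst (s ≤_) (Finₚ.toℕ-inject≤ a m≤)
        down< : ∀ a → toℕ (emb m≤ a) < s → toℕ a < s
        down< a = subst (ℕ._< s) (Finₚ.toℕ-inject≤ a m≤)
        A : ∀ (a b : Fin (suc m)) → toℕ a < s → s ≤ toℕ b → x (top a) (top b) ≡ 0ℚ
        A a b a<s s≤b = go (inner? m≤ a) (inner? m≤ b) a<s s≤b
          where
          go : ∀ {a b} → Inner? m≤ a → Inner? m≤ b → toℕ a < s → s ≤ toℕ b → x (top a) (top b) ≡ 0ℚ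
          go (inner a) (inner b) a<s s≤b = trans (inner-value (top a) (top b)) (proj₁ (proj₂ p∈) a b (down< a a<s) (down b s≤b))
          go (inner a) (outer {b} h) _ _ = column-value (top a) b h
          go (outer h) _ a<s _ = contradiction (ℕₚ.≤-trans s≤m h) (ℕₚ.<⇒≱ a<s)
        C : ∀ (a b : Fin (suc m)) → s ≤ toℕ a ⊎ s ≤ toℕ b → x (bot a) (top b) ≡ 0ℚ
        C a b h = go (inner? m≤ a) (inner? m≤ b) h
          where
          go : ∀ {a b} → Inner? m≤ a → Inner? m≤ b → s ≤ toℕ a ⊎ s ≤ toℕ b → x (bot a) (top b) ≡ 0ℚ
          go (inner a) (inner b) h = trans (inner-value (bot a) (top b)) (proj₁ (proj₂ (proj₂ p∈)) a b (Sum.map (down a) (down b) h))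
          go (inner a) (outer {b} h) _ = column-value (bot a) b h
          go {b = b} (outer {a} h) _ _ = row-value a (top b) h (λ ())
        D : ∀ (a b : Fin (suc m)) → s ≤ toℕ a → toℕ b < s → x (bot a) (bot b) ≡ 0ℚ
        D a b s≤a b<s = go (inner? m≤ a) (inner? m≤ b) s≤a b<s
          where
          go : ∀ {a b} → Inner? m≤ a → Inner? m≤ b → s ≤ toℕ a → toℕ b < s → x (bot a) (bot b) ≡ 0ℚ
          go (inner a) (inner b) s≤a b<s = trans (inner-value (bot a) (bot b)) (proj₂ (proj₂ (proj₂ p∈)) a b (down a s≤a) (down< b b<s))
          go _ (outer h) _ b<s = contradiction (ℕₚ.≤-trans s≤m h) (ℕₚ.<⇒≱ b<s)
          go (outer {a} h) (inner b) _ b<s = row-value a (bot (emb m≤ b)) h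
            (λ eq → ℕₚ.<⇒≱ (emb-< m≤ b) (subst (λ z → m ≤ toℕ (ix z)) eq h))

      reduced∈P : InP (suc m) s (ξ m (suc m) k ⊗ q)
      reduced∈P = sp-⊗ (ξ m (suc m) k) q (sp-ξ m≤ k sp-k) spq , A , C , D

  -- P_{n,n} is the whole symplectic group, because no index reaches n.
  decompose-top : (g : Mat2 n) → IsSp n g → Decomposition n g
  decompose-top {n} g sp-g = record
    { τ = idM ; β = λ _ _ → false ; p = g ; sp = sp-idM ; int-τ = integral-idM
    ; typed = λ ℓ _ _ _ _ → div-0 ℓ ; β-small = λ _ _ _ → refl
    ; p∈P = sp-g , (λ a b _ n≤b → contradiction n≤b (ℕₚ.<⇒≱ (Finₚ.toℕ<n b)))
          , (λ { a b (inj₁ n≤a) → contradiction n≤a (ℕₚ.<⇒≱ (Finₚ.toℕ<n a)) ; a b (inj₂ n≤b) → contradiction n≤b (ℕₚ.<⇒≱ (Finₚ.toℕ<n b)) })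
          , (λ a b n≤a _ → contradiction n≤a (ℕₚ.<⇒≱ (Finₚ.toℕ<n a)))
    ; g≈τp = λ i j → sym (⊗.identityˡ g i j) }

  module _ {m} (g : Mat2 (suc m)) (sp-g : IsSp (suc m) g) (F : ColumnForm (λ i → g i (top (fromℕ m)))) where

    private
      module F = ColumnForm F
      q : Mat2 (suc m)
      q = adj F.τ ⊗ g

    reduced-last : ∀ i → q i (top (fromℕ m)) ≡ F.c * idM i (top (fromℕ m))
    reduced-last i = trans
      (sumI-cong (λ k → trans (cong (adj F.τ i k *_) (F.column≡ k)) (move (adj F.τ i k) F.c (F.τ k (top (fromℕ m))))))
      (trans (sumI-*ˡ F.c (λ k → adj F.τ i k * F.τ k (top (fromℕ m)))) (cong (F.c *_) (sp-inverseˡ F.τ F.sp i (top (fromℕ m)))))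
      where
      move : ∀ x c y → x * (c * y) ≡ c * (x * y)
      move = solve-∀ ℚ-ring

    module R = Reduce q (sp-⊗ (adj F.τ) g (sp-adj F.τ F.sp) sp-g) F.c reduced-last

    -- The first factor brings the last top column of g to a multiple of a basis vector, so the
    -- induction runs in the symplectic corner of what remains. `ξ-type` applies with κ = 0, as the
    -- first factor has type 0 before the last coordinate.
    decompose-step : ∀ {s} → s ≤ m → Decomposition s (corner (adj (ColumnForm.τ F) ⊗ g)) → Decomposition s g
    decompose-step {s} s≤m D = record
      { τ = F.τ ⊗ ξ m (suc m) τ ; β = λ ℓ → extend m≤ (β ℓ) (F.β ℓ) ; p = ξ m (suc m) (adj τ) ⊗ q
      ; sp = sp-⊗ F.τ (ξ m (suc m) τ) F.sp (sp-ξ m≤ τ sp)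
      ; int-τ = integral-⊗ {A = F.τ} {ξ m (suc m) τ} F.int-τ (integral-ξ m≤ {τ} int-τ)
      ; typed = ξ-type m≤ {γ = F.τ} {τ} {F.β} {λ _ → false} {β} F.int-τ int-τ F.typed (λ ℓ a → F.β-small ℓ (emb m≤ a) (emb-< m≤ a)) typed
      ; β-small = λ ℓ → extend-small m≤ s≤m (β-small ℓ)
      ; p∈P = R.reduced∈P s≤m (adj τ) p (sp-adj τ sp) p∈P (λ i j →
          trans (⊗-congˡ (adj τ) g≈τp i j) (⊗-Inverses.cancelˡ {a = τ} {adj τ} p (sp-inverseˡ τ sp) i j))
      ; g≈τp = ⊗-Inverses.insert-inverses {a = F.τ} {adj F.τ} {ξ m (suc m) τ} {ξ m (suc m) (adj τ)} g
          (sp-inverseʳ F.τ F.sp) (ξ-inverse m≤ τ (adj τ) (sp-inverseʳ τ sp)) }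
      where
      m≤ : m ≤ suc m
      m≤ = ℕₚ.n≤1+n m
      open Decomposition D

  decompose : ∀ {n s} → s ≤ n → (g : Mat2 n) → IsSp n g → Decomposition s g
  decompose {n} {s} s≤n g sp-g with ℕₚ.m≤n⇒m<n∨m≡n s≤n
  ... | inj₂ refl = decompose-top g sp-g
  decompose {suc m} {s} s≤n g sp-g | inj₁ (s≤s s≤m) =
    decompose-step g sp-g F s≤m (decompose s≤m (corner (adj (ColumnForm.τ F) ⊗ g)) (R.sp-h g sp-g F))
    where
    F = columnForm (λ i → g i (top (fromℕ m)))

-- Tuples and their representatives

count-emb : ∀ {r n} (r≤n : r ≤ n) (b : Fin n → Bool) → count b ≡ count (b ∘ emb r≤n) ℕ.+ count (window r b)
count-emb {zero} r≤n b = count-cong (λ j → sym (window-≥ 0 b j z≤n))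
count-emb {suc r} {suc n} (s≤s r≤n) b = trans
  (cong (#ᵇ (b Fin.zero) ℕ.+_) (trans (count-emb r≤n (b ∘ Fin.suc))
    (cong (count (b ∘ Fin.suc ∘ emb r≤n) ℕ.+_) (count-cong shift))))
  (sym (ℕₚ.+-assoc (#ᵇ (b Fin.zero)) _ _))
  where
  shift : ∀ j → window r (b ∘ Fin.suc) j ≡ window (suc r) b (Fin.suc j)
  shift j = go (toℕ j ℕ.<? r)
    where
    go : Dec (toℕ j < r) → window r (b ∘ Fin.suc) j ≡ window (suc r) b (Fin.suc j)
    go (yes j<r) = trans (window-< r (b ∘ Fin.suc) j j<r) (sym (window-< (suc r) b (Fin.suc j) (s≤s j<r)))
    go (no j≮r)  = trans (window-≥ r (b ∘ Fin.suc) j (ℕₚ.≮⇒≥ j≮r)) (sym (window-≥ (suc r) b (Fin.suc j) (s≤s (ℕₚ.≮⇒≥ j≮r))))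

window-cong : ∀ s {b c : Fin n → Bool} → (∀ j → s ≤ toℕ j → b j ≡ c j) → ∀ j → window s b j ≡ window s c j
window-cong s eq j with toℕ j ℕ.<? s
... | yes _ = refl
... | no j≮s = eq j (ℕₚ.≮⇒≥ j≮s)

window-false : ∀ s (j : Fin n) → window s (λ _ → false) j ≡ false
window-false s j with toℕ j ℕ.<? s
... | yes _ = refl
... | no _  = refl

count-extend : ∀ {r n} s (r≤n : r ≤ n) → s ≤ r → (β : Fin r → Bool) (γ : Fin n → Bool) →
  count (window s (extend r≤n β γ)) ≡ count (window s β) ℕ.+ count (window r γ)
count-extend {r} s r≤n s≤r β γ = trans (count-emb r≤n (window s (extend r≤n β γ)))
  (cong₂ ℕ._+_ (count-cong inside) (count-cong outside))
  where
  inside : ∀ a → window s (extend r≤n β γ) (emb r≤n a) ≡ window s β a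
  inside a = go (toℕ a ℕ.<? s)
    where
    go : Dec (toℕ a < s) → window s (extend r≤n β γ) (emb r≤n a) ≡ window s β a
    go (yes a<s) = trans (window-< s (extend r≤n β γ) (emb r≤n a) (subst (ℕ._< s) (sym (Finₚ.toℕ-inject≤ a r≤n)) a<s))
      (sym (window-< s β a a<s))
    go (no a≮s)  = trans (window-≥ s (extend r≤n β γ) (emb r≤n a) (subst (s ≤_) (sym (Finₚ.toℕ-inject≤ a r≤n)) (ℕₚ.≮⇒≥ a≮s)))
      (trans (extend-inner r≤n β γ a) (sym (window-≥ s β a (ℕₚ.≮⇒≥ a≮s))))
  outside : ∀ j → window r (window s (extend r≤n β γ)) j ≡ window r γ j
  outside = window-cong r λ j r≤j → trans (window-≥ s (extend r≤n β γ) j (ℕₚ.≤-trans s≤r r≤j)) (extend-outer r≤n β γ j r≤j)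

count-window-true : ∀ {s n k} → s ℕ.+ k ≡ n → count {n} (window s (λ _ → true)) ≡ k
count-window-true {s} {n} {k} eq = ℕₚ.+-cancelˡ-≡ s _ _ (begin
  s ℕ.+ count {n} (window s (λ _ → true))
    ≡⟨ cong (ℕ._+ count {n} (window s (λ _ → true))) (count-const-true {s} (λ _ → refl)) ⟨
  count {s} (λ _ → true) ℕ.+ count {n} (window s (λ _ → true))
    ≡⟨ count-emb (ℕₚ.m+n≤o⇒m≤o s (ℕₚ.≤-reflexive eq)) (λ _ → true) ⟨
  count {n} (λ _ → true)                           ≡⟨ count-const-true {n} (λ _ → refl) ⟩
  n                                                ≡⟨ eq ⟨
  s ℕ.+ k ∎)
  where open ≡-Reasoning

dvd : ℕ → ℕ → Bool
dvd ℓ l = does (ℓ ∣.∣? l)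

-- A tuple (l_k, …, l_1) has rank i at the primes dividing l_i.
rank : ℕ → List ℕ → ℕ
rank ℓ []      = 0
rank ℓ (l ∷ L) = if dvd ℓ l then suc (length L) else rank ℓ L

rank-∣ : ∀ {ℓ l} L → ℓ ∣ l → rank ℓ (l ∷ L) ≡ suc (length L)
rank-∣ {ℓ} {l} L ℓ∣l with ℓ ∣.∣? l
... | yes _  = refl
... | no ℓ∤l = contradiction ℓ∣l ℓ∤l

rank-∤ : ∀ {ℓ l} L → ¬ ℓ ∣ l → rank ℓ (l ∷ L) ≡ rank ℓ L
rank-∤ {ℓ} {l} L ℓ∤l with ℓ ∣.∣? l
... | yes ℓ∣l = contradiction ℓ∣l ℓ∤l
... | no _    = refl

rank≤length : ∀ ℓ L → rank ℓ L ≤ length L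
rank≤length ℓ []      = z≤n
rank≤length ℓ (l ∷ L) with ℓ ∣.∣? l
... | yes _ = ℕₚ.≤-refl
... | no _  = ℕₚ.m≤n⇒m≤1+n (rank≤length ℓ L)

rank-zero : ∀ {ℓ L} → All (λ l → ¬ ℓ ∣ l) L → rank ℓ L ≡ 0
rank-zero []                = refl
rank-zero {L = l ∷ L} (∤ ∷ ∤s) = trans (rank-∤ L ∤) (rank-zero ∤s)

rank-full : ∀ {ℓ l} L → suc (length L) ≤ rank ℓ (l ∷ L) → ℓ ∣ l
rank-full {ℓ} {l} L le with ℓ ∣.∣? l
... | yes ℓ∣l = ℓ∣l
... | no _    = contradiction (ℕₚ.≤-trans le (rank≤length ℓ L)) (ℕₚ.<⇒≱ (ℕₚ.n<1+n _))

coprime⇒∤ : ∀ {ℓ l L} → Prime ℓ → ℓ ∣ l → All (Coprime l) L → All (λ m → ¬ ℓ ∣ m) L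
coprime⇒∤ pℓ ℓ∣l = All.map (λ cop ℓ∣m → ¬prime[1] (subst Prime (cop (ℓ∣l , ℓ∣m)) pℓ))

-- The constant bit κ that a representative of an r-cusp has on the first r coordinates.
anyDvd : ℕ → List ℕ → Bool
anyDvd ℓ []      = false
anyDvd ℓ (l ∷ L) = if dvd ℓ l then true else anyDvd ℓ L

-- If ℓ divides l, the outermost factor is J modulo ℓ and turns every coordinate; otherwise it is 1
-- modulo ℓ, and the inner tuple can turn only the first m coordinates.
repBit : List ℕ → ∀ n → Types n
repBit []      n       ℓ j = false
repBit (l ∷ L) (suc m) ℓ j = if dvd ℓ l then true else extend (ℕₚ.n≤1+n m) (repBit L m ℓ) (λ _ → false) j

repBit-below : ∀ {s} L n ℓ → s ℕ.+ length L ≡ n → ∀ j → toℕ j < s → repBit L n ℓ j ≡ anyDvd ℓ L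
repBit-below []      n       ℓ eq j j<s = refl
repBit-below {s} (l ∷ L) zero ℓ eq ()
repBit-below {s} (l ∷ L) (suc m) ℓ eq j j<s with dvd ℓ l
... | true  = refl
... | false = go (inner? m≤ j) j<s
  where
  m≤ : m ≤ suc m
  m≤ = ℕₚ.n≤1+n m
  eq′ : s ℕ.+ length L ≡ m
  eq′ = ℕₚ.suc-injective (trans (sym (ℕₚ.+-suc s (length L))) eq)
  go : ∀ {j} → Inner? m≤ j → toℕ j < s → extend m≤ (repBit L m ℓ) (λ _ → false) j ≡ anyDvd ℓ L
  go (inner a) a<s = trans (extend-inner m≤ (repBit L m ℓ) (λ _ → false) a)
    (repBit-below L m ℓ eq′ a (subst (ℕ._< s) (Finₚ.toℕ-inject≤ a m≤) a<s))
  go (outer h) j<s = contradiction (ℕₚ.≤-trans (ℕₚ.m+n≤o⇒m≤o s (ℕₚ.≤-reflexive eq′)) h) (ℕₚ.<⇒≱ j<s)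

count-repBit : ∀ {s} L n ℓ → s ℕ.+ length L ≡ n → count (window s (repBit L n ℓ)) ≡ rank ℓ L
count-repBit {s} []      n ℓ eq = count-const-false {n} (window-false s)
count-repBit {s} (l ∷ L) zero    ℓ eq with () ← trans (sym (ℕₚ.+-suc s (length L))) eq
count-repBit {s} (l ∷ L) (suc m) ℓ eq with dvd ℓ l
... | true  = count-window-true eq
... | false = trans (count-extend s (ℕₚ.n≤1+n m) (ℕₚ.m+n≤o⇒m≤o s (ℕₚ.≤-reflexive eq′)) (repBit L m ℓ) (λ _ → false))
  (trans (cong₂ ℕ._+_ (count-repBit L m ℓ eq′) (count-const-false (window-false m))) (ℕₚ.+-identityʳ (rank ℓ L)))
  where
  eq′ : s ℕ.+ length L ≡ m
  eq′ = ℕₚ.suc-injective (trans (sym (ℕₚ.+-suc s (length L))) eq)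

congruent-ξ : ∀ {r n ℓ} (r≤n : r ≤ n) (h : Mat2 r) → (∀ i j → Div ℓ (h i j - idM i j)) →
  ∀ i j → Div ℓ (ξ r n h i j - idM i j)
congruent-ξ {r} {n} {ℓ} r≤n h h≡1 i j = go (innerI? r≤n i) (innerI? r≤n j)
  where
  l : ∀ x → 0ℚ ≡ x - x
  l = solve-∀ ℚ-ring
  go : ∀ {i j} → InnerI? r≤n i → InnerI? r≤n j → Div ℓ (ξ r n h i j - idM i j)
  go (inner i) (inner j) = div-resp (sym (cong₂ _-_ (ξ-inner r≤n h i j) (idM-embI r≤n i j))) (h≡1 i j)
  go {j = j} (outer {i} p) _ = div-resp (trans (l (idM i j)) (cong (λ z → z - idM i j) (sym (ξ-outer r≤n h i j (inj₁ p))))) (div-0 ℓ)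
  go {i} (inner _) (outer {j} p) = div-resp (trans (l (idM i j)) (cong (λ z → z - idM i j) (sym (ξ-outer r≤n h i j (inj₂ p))))) (div-0 ℓ)

congruent-⊗ : ∀ {ℓ} (g h : Mat2 n) → IntegralM h → (∀ i j → Div ℓ (g i j - idM i j)) → (∀ i j → Div ℓ (h i j - idM i j)) →
  ∀ i j → Div ℓ ((g ⊗ h) i j - idM i j)
congruent-⊗ {ℓ = ℓ} g h ih g≡1 h≡1 i j = div-resp eq (div-+ (div-+ (div-sumF λ k → term (inj₁ k)) (div-sumF λ k → term (inj₂ k))) (h≡1 i j))
  where
  term : ∀ k → Div ℓ ((g i k - idM i k) * h k j)
  term k = div-*ʳ (g≡1 i k) (ih k j)
  l₁ : ∀ x y z → (x - y) * z ≡ x * z + (- 1ℚ) * (y * z)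
  l₁ = solve-∀ ℚ-ring
  l₂ : ∀ x y z → x + (- 1ℚ) * y + (y - z) ≡ x - z
  l₂ = solve-∀ ℚ-ring
  sum : sumI (λ k → (g i k - idM i k) * h k j) ≡ (g ⊗ h) i j + (- 1ℚ) * h i j
  sum = trans (sumI-cong (λ k → l₁ (g i k) (idM i k) (h k j)))
    (trans (sumI-+ (λ k → g i k * h k j) (λ k → (- 1ℚ) * (idM i k * h k j)))
      (cong ((g ⊗ h) i j +_) (trans (sumI-*ˡ (- 1ℚ) (λ k → idM i k * h k j)) (cong ((- 1ℚ) *_) (sumI-idˡ i (λ k → h k j))))))
  eq : sumI (λ k → (g i k - idM i k) * h k j) + (h i j - idM i j) ≡ (g ⊗ h) i j - idM i j
  eq = trans (cong (_+ (h i j - idM i j)) sum) (l₂ ((g ⊗ h) i j) (h i j) (idM i j))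

-- The field `trivial` strengthens the induction: at a prime dividing the head of a tuple, the
-- product is typed because coprimality makes all remaining factors 1 modulo that prime.
record RepFacts (N n : ℕ) (L : List ℕ) (γ : Mat2 n) : Set where
  field
    sp      : IsSp n γ
    int-γ   : IntegralM γ
    typed   : HasType N γ (repBit L n)
    trivial : ∀ ℓ → Prime ℓ → ℓ ∣ N → All (λ l → ¬ ℓ ∣ l) L → ∀ i j → Div ℓ (γ i j - idM i j)

congMod-prime : ∀ {ℓ m} (A B : Mat2 n) → ℓ ∣ m → CongMod (m ℕ.* m) A B → ∀ i j → Div ℓ (A i j - B i j)
congMod-prime {m = m} A B ℓ∣m A≡B i j = div-∣ (∣.∣-trans ℓ∣m (∣.m∣m*n m)) (⟨_⟩ {m ℕ.* m} (A≡B i j))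

repFacts : ∀ N n L γ → ValidTuple N L → IsRep N n L γ → RepFacts N n L γ
repFacts N n [] γ _ γ≈1 = record
  { sp = sp-cong (λ i j → sym (γ≈1 i j)) sp-idM
  ; int-γ = λ i j → subst IsInt (sym (γ≈1 i j)) (integral-idM i j)
  ; typed = λ ℓ _ _ j k → div-resp (sym (γ≈1 (bot k) (top j))) (div-0 ℓ)
  ; trivial = λ ℓ _ _ _ i j → div-resp (trans (l (idM i j)) (cong (λ z → z - idM i j) (sym (γ≈1 i j)))) (div-0 ℓ) }
  where
  l : ∀ x → 0ℚ ≡ x - x
  l = solve-∀ ℚ-ring
repFacts N (suc m) (l ∷ L) γ ((0<l , divides l′ N≡l′l) ∷ vs , cop ∷ cops) (g , h , (spg , ig , cong-g) , rep , γ≈gh) = record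
  { sp = sp-cong (λ i j → sym (γ≈gh i j)) (sp-⊗ g ξh spg (sp-ξ m≤ h sp))
  ; int-γ = λ i j → subst IsInt (sym (γ≈gh i j)) (integral-⊗ {A = g} {ξh} ig iξh i j)
  ; typed = hasType-cong {A = g ⊗ ξh} {γ} {repBit (l ∷ L) (suc m)} (λ i j → sym (γ≈gh i j)) typed′
  ; trivial = λ { ℓ pℓ ℓ∣N (ℓ∤l ∷ ℓ∤L) i j → div-resp (cong (λ z → z - idM i j) (sym (γ≈gh i j)))
      (congruent-⊗ g ξh iξh (g≡1 ℓ pℓ ℓ∣N ℓ∤l) (congruent-ξ m≤ h (trivial ℓ pℓ ℓ∣N ℓ∤L)) i j) } }
  where
  open RepFacts (repFacts N m L h (vs , cops) rep) renaming (int-γ to int-h)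
  m≤ : m ≤ suc m
  m≤ = ℕₚ.n≤1+n m
  ξh : Mat2 (suc m)
  ξh = ξ m (suc m) h
  iξh : IntegralM ξh
  iξh = integral-ξ m≤ {h} int-h
  ll′ : l ℕ.* l′ ≡ N
  ll′ = trans (ℕₚ.*-comm l l′) (sym N≡l′l)
  g≡J : ∀ ℓ → ℓ ∣ l → ∀ i j → Div ℓ (g i j - J (suc m) i j)
  g≡J ℓ ℓ∣l = congMod-prime g (J (suc m)) ℓ∣l (proj₁ (cong-g l′ ll′))
  g≡1 : ∀ ℓ → Prime ℓ → ℓ ∣ N → ¬ ℓ ∣ l → ∀ i j → Div ℓ (g i j - idM i j)
  g≡1 ℓ pℓ ℓ∣N ℓ∤l with euclidsLemma l l′ pℓ (subst (ℓ ∣_) (sym ll′) ℓ∣N)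
  ... | inj₁ ℓ∣l  = contradiction ℓ∣l ℓ∤l
  ... | inj₂ ℓ∣l′ = congMod-prime g idM ℓ∣l′ (proj₂ (cong-g l′ ll′))
  minus-0 : ∀ x → x - 0ℚ ≡ x
  minus-0 = solve-∀ ℚ-ring
  typed-ξh : HasType N ξh (λ ℓ → extend m≤ (repBit L m ℓ) (λ _ → false))
  typed-ξh = hasType-cong {A = idM ⊗ ξh} {ξh} {λ ℓ → extend m≤ (repBit L m ℓ) (λ _ → false)} (⊗.identityˡ ξh)
    (ξ-type m≤ {γ = idM} {h} {λ _ _ → false} {λ _ → false} {repBit L m} integral-idM int-h (λ ℓ _ _ _ _ → div-0 ℓ) (λ _ _ → refl) typed)
  typed′ : HasType N (g ⊗ ξh) (repBit (l ∷ L) (suc m))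
  typed′ ℓ pℓ ℓ∣N j k with ℓ ∣.∣? l
  -- The D-block of the product is C_g B + D_g D, with B the upper right block of ξ h. Modulo ℓ, B
  -- vanishes as ξ h ≡ 1, and D_g vanishes as g ≡ J.
  ... | yes ℓ∣l = div-+
    (div-sumF λ a → div-*ˡ (ig (bot k) (top a)) (div-resp (minus-0 (ξh (top a) (bot j)))
      (congruent-ξ m≤ h (trivial ℓ pℓ ℓ∣N (coprime⇒∤ pℓ ℓ∣l cop)) (top a) (bot j))))
    (div-sumF λ a → div-*ʳ (div-resp (minus-0 (g (bot k) (bot a))) (g≡J ℓ ℓ∣l (bot k) (bot a))) (iξh (bot a) (bot j)))
  ... | no ℓ∤l = div-+
    (div-sumF λ a → div-*ʳ (div-resp (minus-0 (g (bot k) (top a))) (g≡1 ℓ pℓ ℓ∣N ℓ∤l (bot k) (top a))) (iξh (top a) (col j)))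
    (div-sumF λ a → div-*ˡ (ig (bot k) (bot a)) (typed-ξh ℓ pℓ ℓ∣N j a))
    where
    col : Fin (suc m) → Idx (suc m)
    col j = column (extend m≤ (repBit L m ℓ) (λ _ → false) j) j

coprime-* : ∀ {a b c} → Coprime a c → Coprime b c → Coprime (a ℕ.* b) c
coprime-* {a} {b} {c} ca cb {d} (d∣ab , d∣c) = cb (Coprimality.coprime-divisor
  (λ { (e∣d , e∣a) → ca (e∣a , ∣.∣-trans e∣d d∣c) }) d∣ab , d∣c)

coprime-∣ : ∀ {d m n} → d ∣ m → Coprime m n → Coprime d n
coprime-∣ d∣m cop (e∣d , e∣n) = cop (∣.∣-trans e∣d d∣m , e∣n)

-- The rotation by e ≡ 1 mod l² , e ≡ 0 mod (N/l)² in every coordinate.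
gammaL-exists : ∀ {N} m l → SquareFree N → 0 < l → l ∣ N → ∃[ g ] IsGammaL N m l g
gammaL-exists {N} m l sf 0<l (divides l′ N≡l′l) =
  coordinatewise X , sp-coordinatewise X , integral-coordinatewise X , λ l″ eq →
    (λ i j → divQ (≡J i j)) , (λ i j → divQ (subst (λ z → Div (z ℕ.* z) (coordinatewise X i j - idM i j)) (unique l″ eq) (≡1 i j)))
  where
  instance _ = ℕ.>-nonZero 0<l
  unique : ∀ l″ → l ℕ.* l″ ≡ N → l′ ≡ l″
  unique l″ eq = ℕₚ.*-cancelˡ-≡ l′ l″ l (trans (trans (ℕₚ.*-comm l l′) (sym N≡l′l)) (sym eq))
  cop : Coprime l l′
  cop {d} (d∣l , d∣l′) = sf d (subst (d ℕ.* d ∣_) (sym N≡l′l) (∣.*-pres-∣ d∣l′ d∣l))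
  cop² : Coprime (l ℕ.* l) (l′ ℕ.* l′)
  cop² = Coprimality.sym (coprime-* c c)
    where
    c : Coprime l′ (l ℕ.* l)
    c = Coprimality.sym (coprime-* cop cop)
  comb = coprime-combination cop²
  u v e : ℚ
  u = proj₁ comb
  v = proj₁ (proj₂ comb)
  iu = proj₁ (proj₂ (proj₂ comb))
  iv = proj₁ (proj₂ (proj₂ (proj₂ comb)))
  -- From u l² + v l′² = 1: e is 0 modulo l′², and 1 - e = u l² is 0 modulo l².
  e = v * (pos (l′ ℕ.* l′) / 1)
  ie : IsInt e
  ie = int-* iv (int (pos (l′ ℕ.* l′)))
  e≡0 : Div (l′ ℕ.* l′) e
  e≡0 = div-*ˡ iv (∣⇒div (pos (l′ ℕ.* l′)) ∣.∣-refl)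
  e≡1 : Div (l ℕ.* l) (1ℚ - e)
  e≡1 = div-resp (trans (f (u * (pos (l ℕ.* l) / 1)) e) (cong (λ z → z - e) (proj₂ (proj₂ (proj₂ (proj₂ comb))))))
    (div-*ˡ iu (∣⇒div (pos (l ℕ.* l)) ∣.∣-refl))
    where
    f : ∀ x e → x ≡ (x + e) - e
    f = solve-∀ ℚ-ring
  X : Fin m → SL₂ℤ
  X _ = rotation ie
  f₁ : ∀ d e → (1ℚ - e) * ((1ℚ + e) * d) ≡ d * (1ℚ - e * e) - 0ℚ
  f₁ = solve-∀ ℚ-ring
  f₂ : ∀ d e → (1ℚ - e) * ((1ℚ - e * e - e) * d) ≡ d * (e * e * e - (e + e)) - - d
  f₂ = solve-∀ ℚ-ring
  f₃ : ∀ d e → (1ℚ - e) * - d ≡ d * e - d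
  f₃ = solve-∀ ℚ-ring
  ≡J : ∀ i j → Div (l ℕ.* l) (coordinatewise X i j - J m i j)
  ≡J (inj₁ a) (inj₁ b) = div-resp (f₁ (δ a b) e) (div-*ʳ e≡1 (int-* (int-+ int-1 ie) (int-δ a b)))
  ≡J (inj₁ a) (inj₂ b) = div-resp (f₂ (δ a b) e) (div-*ʳ e≡1 (int-* (int-sub (int-sub int-1 (int-* ie ie)) ie) (int-δ a b)))
  ≡J (inj₂ a) (inj₁ b) = div-resp (f₃ (δ a b) e) (div-*ʳ e≡1 (int-neg (int-δ a b)))
  ≡J (inj₂ a) (inj₂ b) = div-resp (f₁ (δ a b) e) (div-*ʳ e≡1 (int-* (int-+ int-1 ie) (int-δ a b)))
  g₁ : ∀ d e → e * - (e * d) ≡ d * (1ℚ - e * e) - d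
  g₁ = solve-∀ ℚ-ring
  g₂ : ∀ d e → e * ((e * e - (1ℚ + 1ℚ)) * d) ≡ d * (e * e * e - (e + e)) - 0ℚ
  g₂ = solve-∀ ℚ-ring
  g₃ : ∀ d e → e * d ≡ d * e - 0ℚ
  g₃ = solve-∀ ℚ-ring
  ≡1 : ∀ i j → Div (l′ ℕ.* l′) (coordinatewise X i j - idM i j)
  ≡1 (inj₁ a) (inj₁ b) = div-resp (g₁ (δ a b) e) (div-*ʳ e≡0 (int-neg (int-* ie (int-δ a b))))
  ≡1 (inj₁ a) (inj₂ b) = div-resp (g₂ (δ a b) e) (div-*ʳ e≡0 (int-* (int-sub (int-* ie ie) (int-+ int-1 int-1)) (int-δ a b)))
  ≡1 (inj₂ a) (inj₁ b) = div-resp (g₃ (δ a b) e) (div-*ʳ e≡0 (int-δ a b))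
  ≡1 (inj₂ a) (inj₂ b) = div-resp (g₁ (δ a b) e) (div-*ʳ e≡0 (int-neg (int-* ie (int-δ a b))))

-- `LiesOn` quantifies over all representatives, so drawing a conclusion from it requires at least
-- one.
rep-exists : ∀ {N} n L → SquareFree N → All (λ l → 0 < l × l ∣ N) L → length L ≤ n → ∃[ γ ] IsRep N n L γ
rep-exists n       []      sf _                 _        = idM , λ _ _ → refl
rep-exists (suc m) (l ∷ L) sf ((0<l , l∣N) ∷ vs) (s≤s le) =
  let g , isγ = gammaL-exists (suc m) l sf 0<l l∣N
      h , rep = rep-exists m L sf vs le
  in g ⊗ ξ m (suc m) h , g , h , isγ , rep , λ _ _ → refl

-- Tuples whose ranks differ by at most one

squarefree-∣ : ∀ {m N} → m ∣ N → SquareFree N → SquareFree m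
squarefree-∣ m∣N sf d dd∣m = sf d (∣.∣-trans dd∣m m∣N)

divisor-positive : ∀ {m N} → 0 < N → m ∣ N → 0 < m
divisor-positive {zero}  0<N 0∣N = contradiction (subst (0 <_) (∣.0∣⇒≡0 0∣N) 0<N) (λ ())
divisor-positive {suc m} 0<N _   = s≤s z≤n

prime-divisors⇒∣ : ∀ {m k N} → 0 < N → SquareFree N → m ∣ N → (∀ ℓ → Prime ℓ → ℓ ∣ m → ℓ ∣ k) → m ∣ k
prime-divisors⇒∣ {m} {k} 0<N sf m∣N h = div⇒∣ (pos k)
  (div-squarefree (divisor-positive 0<N m∣N) (squarefree-∣ m∣N sf) (int (pos k)) (λ ℓ pℓ ℓ∣m → ∣⇒div (pos k) (h ℓ pℓ ℓ∣m)))

prime²∤ : ∀ {ℓ a b N} → SquareFree N → Prime ℓ → a ℕ.* b ∣ N → ℓ ∣ a → ¬ ℓ ∣ b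
prime²∤ {ℓ} sf pℓ ab∣N ℓ∣a ℓ∣b = ¬prime[1] (subst Prime (sf ℓ (∣.∣-trans (∣.*-pres-∣ ℓ∣a ℓ∣b) ab∣N)) pℓ)

-- The isotropic subspace of an s-cusp exceeds that of an (s+1)-cusp carrying it by one line, and a
-- line adds 0 or 1 to the rank modulo ℓ.
Adjacent : ℕ → List ℕ → List ℕ → Set
Adjacent ℓ L M = rank ℓ M ≤ rank ℓ L × rank ℓ L ≤ suc (rank ℓ M)

Factors : List (ℕ × ℕ) → List ℕ → Set
Factors = Pointwise (λ cd li → proj₁ cd ℕ.* proj₂ cd ≡ li)

length-formula : ∀ h {cds Ls} → Factors cds Ls → length (formula h cds) ≡ length Ls
length-formula h []       = refl
length-formula h (_∷_ {x = cd} _ fs) = cong suc (length-formula (proj₂ cd) fs)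

formula⇒adjacent : ∀ {ℓ} → Prime ℓ → ∀ h {cds Ls} → Factors cds Ls → Adjacent ℓ (h ∷ Ls) (formula h cds)
formula⇒adjacent {ℓ} pℓ h [] = z≤n , rank≤length ℓ (h ∷ [])
formula⇒adjacent {ℓ} pℓ h {(c , d) ∷ cds} {_ ∷ Ls} (refl ∷ fs) = go (ℓ ∣.∣? h) (ℓ ∣.∣? c)
  where
  M = formula d cds
  len : length M ≡ length Ls
  len = length-formula d fs
  adj-resp : ∀ {x x′ y y′} → x ≡ x′ → y ≡ y′ → y ≤ x × x ≤ suc y → y′ ≤ x′ × x′ ≤ suc y′
  adj-resp refl refl h = h
  go : Dec (ℓ ∣ h) → Dec (ℓ ∣ c) → Adjacent ℓ (h ∷ c ℕ.* d ∷ Ls) (h ℕ.* c ∷ M)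
  go (yes ℓ∣h) _ = adj-resp (sym (rank-∣ (c ℕ.* d ∷ Ls) ℓ∣h)) (sym (trans (rank-∣ M (∣.∣m⇒∣m*n c ℓ∣h)) (cong suc len)))
    (ℕₚ.n≤1+n _ , ℕₚ.≤-refl)
  go (no ℓ∤h) (yes ℓ∣c) = adj-resp (sym (trans (rank-∤ (c ℕ.* d ∷ Ls) ℓ∤h) (rank-∣ Ls (∣.∣m⇒∣m*n d ℓ∣c))))
    (sym (trans (rank-∣ M (∣.∣n⇒∣m*n h ℓ∣c)) (cong suc len))) (ℕₚ.≤-refl , ℕₚ.n≤1+n _)
  go (no ℓ∤h) (no ℓ∤c) = adj-resp (sym (trans (rank-∤ (c ℕ.* d ∷ Ls) ℓ∤h) (same-rank (ℓ ∣.∣? d))))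
    (sym (rank-∤ M (λ ℓ∣hc → [ ℓ∤h , ℓ∤c ]′ (euclidsLemma h c pℓ ℓ∣hc)))) (formula⇒adjacent pℓ d fs)
    where
    same-rank : Dec (ℓ ∣ d) → rank ℓ (c ℕ.* d ∷ Ls) ≡ rank ℓ (d ∷ Ls)
    same-rank (yes ℓ∣d) = trans (rank-∣ Ls (∣.∣n⇒∣m*n c ℓ∣d)) (sym (rank-∣ Ls ℓ∣d))
    same-rank (no ℓ∤d)  = trans (rank-∤ Ls (λ ℓ∣cd → [ ℓ∤c , ℓ∤d ]′ (euclidsLemma c d pℓ ℓ∣cd))) (sym (rank-∤ Ls ℓ∤d))

-- l ∣ m since rank M ≥ rank (l ∷ Ls) − 1; with m = l c, a prime divisor of c cannot divide l, so it divides l₂.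
adjacent⇒formula : ∀ {N} → 0 < N → SquareFree N → ∀ l Ls M → ValidTuple N (l ∷ Ls) → ValidTuple N M →
  length Ls ≡ length M → (∀ ℓ → Prime ℓ → ℓ ∣ N → Adjacent ℓ (l ∷ Ls) M) →
  ∃[ cds ] Factors cds Ls × M ≡ formula l cds
adjacent⇒formula 0<N sf l [] [] _ _ _ _ = [] , [] , refl
adjacent⇒formula {N} 0<N sf l (l₂ ∷ Ls) (m ∷ M) (((_ , l∣N) ∷ (_ , l₂∣N) ∷ vs) , (cop-l ∷ cop-l₂ ∷ cops)) (((_ , m∣N) ∷ vM) , (cop-m ∷ copM)) len adj
  with prime-divisors⇒∣ {l} {m} 0<N sf l∣N l-primes
  where
  l-primes : ∀ ℓ → Prime ℓ → ℓ ∣ l → ℓ ∣ m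
  l-primes ℓ pℓ ℓ∣l = rank-full M (ℕₚ.≤-trans (ℕₚ.≤-reflexive (sym len))
    (ℕₚ.≤-pred (ℕₚ.≤-trans (ℕₚ.≤-reflexive (sym (rank-∣ (l₂ ∷ Ls) ℓ∣l))) (proj₂ (adj ℓ pℓ (∣.∣-trans ℓ∣l l∣N))))))
... | divides c refl with prime-divisors⇒∣ {c} {l₂} 0<N sf (∣.∣-trans (∣.m∣m*n l) m∣N) c-primes
  where
  c-primes : ∀ ℓ → Prime ℓ → ℓ ∣ c → ℓ ∣ l₂
  c-primes ℓ pℓ ℓ∣c = rank-full Ls (ℕₚ.≤-trans (ℕₚ.≤-reflexive (trans len (sym (rank-∣ M (∣.∣m⇒∣m*n l ℓ∣c)))))
    (ℕₚ.≤-trans (proj₁ (adj ℓ pℓ (∣.∣-trans ℓ∣c (∣.∣-trans (∣.m∣m*n l) m∣N))))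
      (ℕₚ.≤-reflexive (rank-∤ (l₂ ∷ Ls) (prime²∤ sf pℓ m∣N ℓ∣c)))))
... | divides d refl = finish (adjacent⇒formula 0<N sf d Ls M
        (((divisor-positive 0<N d∣N , d∣N) ∷ vs) , (All.map (λ {x} → coprime-∣ {d} {d ℕ.* c} {x} (∣.m∣m*n c)) cop-l₂ ∷ cops))
        (vM , copM) (ℕₚ.suc-injective len) adj′)
  where
  d∣N : d ∣ N
  d∣N = ∣.∣-trans (∣.m∣m*n c) l₂∣N
  finish : ∃[ cds ] Factors cds Ls × M ≡ formula d cds → ∃[ cds ] Factors cds (d ℕ.* c ∷ Ls) × c ℕ.* l ∷ M ≡ formula l cds
  finish (cds , fs , refl) = (c , d) ∷ cds , ℕₚ.*-comm c d ∷ fs , cong (_∷ M) (ℕₚ.*-comm c l)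
  -- At a prime dividing c l both remaining tuples have rank 0, by coprimality; at any other prime,
  -- dropping the heads changes neither rank.
  adj′ : ∀ ℓ → Prime ℓ → ℓ ∣ N → Adjacent ℓ (d ∷ Ls) M
  adj′ ℓ pℓ ℓ∣N = go (ℓ ∣.∣? d) (ℓ ∣.∣? (c ℕ.* l))
    where
    adj-resp : ∀ {x x′ y y′} → x ≡ x′ → y ≡ y′ → y ≤ x × x ≤ suc y → y′ ≤ x′ × x′ ≤ suc y′
    adj-resp refl refl h = h
    go : Dec (ℓ ∣ d) → Dec (ℓ ∣ c ℕ.* l) → Adjacent ℓ (d ∷ Ls) M
    go (yes ℓ∣d) _ = adj-resp
      (trans (rank-∤ (d ℕ.* c ∷ Ls) ℓ∤l) (trans (rank-∣ Ls (∣.∣m⇒∣m*n c ℓ∣d)) (sym (rank-∣ Ls ℓ∣d))))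
      (rank-∤ M (λ ℓ∣cl → [ prime²∤ sf pℓ l₂∣N ℓ∣d , ℓ∤l ]′ (euclidsLemma c l pℓ ℓ∣cl))) (adj ℓ pℓ ℓ∣N)
      where
      ℓ∤l : ¬ ℓ ∣ l
      ℓ∤l ℓ∣l = All.head (coprime⇒∤ pℓ ℓ∣l cop-l) (∣.∣m⇒∣m*n c ℓ∣d)
    go (no ℓ∤d) (yes ℓ∣cl) = adj-resp
      (sym (trans (rank-∤ Ls ℓ∤d) (rank-zero (avoid (euclidsLemma c l pℓ ℓ∣cl))))) (sym (rank-zero (coprime⇒∤ pℓ ℓ∣cl cop-m))) (z≤n , z≤n)
      where
      avoid : ℓ ∣ c ⊎ ℓ ∣ l → All (λ x → ¬ ℓ ∣ x) Ls
      avoid (inj₁ ℓ∣c) = coprime⇒∤ pℓ (∣.∣n⇒∣m*n d ℓ∣c) cop-l₂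
      avoid (inj₂ ℓ∣l) = All.tail (coprime⇒∤ pℓ ℓ∣l cop-l)
    go (no ℓ∤d) (no ℓ∤cl) = adj-resp
      (trans (rank-∤ (d ℕ.* c ∷ Ls) (λ ℓ∣l → ℓ∤cl (∣.∣n⇒∣m*n c ℓ∣l)))
        (trans (rank-∤ Ls (λ ℓ∣dc → [ ℓ∤d , (λ ℓ∣c → ℓ∤cl (∣.∣m⇒∣m*n l ℓ∣c)) ]′ (euclidsLemma d c pℓ ℓ∣dc))) (sym (rank-∤ Ls ℓ∤d))))
      (rank-∤ M ℓ∤cl) (adj ℓ pℓ ℓ∣N)

-- Cusps of a boundary component

module MonoidTransfers (M : Monoid 0ℓ 0ℓ) where
  open Monoid M using (_∙_; ε; assoc; ∙-congʳ; ∙-congˡ)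
    renaming (_≈_ to _≋_; trans to ≋-trans; setoid to ≋-setoid)
  open MonoidInverses M
  open SetoidReasoning ≋-setoid

  -- Passes from an equivalence of two matrices to one of their typed factors t and t′.
  transfer : ∀ {d h h′ p p₁ p₂ p₂′ t t′} → h ≋ t ∙ p₁ → h′ ≋ t′ ∙ p₂ → p₂ ∙ p₂′ ≋ ε → h′ ≋ (d ∙ h) ∙ p →
    t′ ≋ (d ∙ t) ∙ ((p₁ ∙ p) ∙ p₂′)
  transfer {d} {h} {h′} {p = p} {p₁} {p₂} {p₂′} {t} {t′} eq eq′ inv eq″ = begin
    t′                            ≈⟨ cancelʳ t′ inv ⟨
    (t′ ∙ p₂) ∙ p₂′               ≈⟨ ∙-congʳ eq′ ⟨
    h′ ∙ p₂′                      ≈⟨ ∙-congʳ eq″ ⟩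
    ((d ∙ h) ∙ p) ∙ p₂′           ≈⟨ ∙-congʳ (∙-congʳ (∙-congˡ eq)) ⟩
    ((d ∙ (t ∙ p₁)) ∙ p) ∙ p₂′    ≈⟨ ∙-congʳ (∙-congʳ (assoc d t p₁)) ⟨
    (((d ∙ t) ∙ p₁) ∙ p) ∙ p₂′    ≈⟨ ∙-congʳ (assoc (d ∙ t) p₁ p) ⟩
    ((d ∙ t) ∙ (p₁ ∙ p)) ∙ p₂′    ≈⟨ assoc (d ∙ t) (p₁ ∙ p) p₂′ ⟩
    (d ∙ t) ∙ ((p₁ ∙ p) ∙ p₂′)    ∎

  -- Applied with g = γ, x = ξ(z⁻¹), w = ξ(d′) and a′ = σ⁻¹: conjugating ξ(z⁻¹ d′ z) by γ gives σ
  -- ξ(d′) σ⁻¹.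
  conjugate : ∀ {a′ g w x z} → a′ ∙ (g ∙ x) ≋ ε → x ∙ z ≋ ε →
    g ∙ ((x ∙ w) ∙ z) ≋ (((g ∙ x) ∙ w) ∙ a′) ∙ g
  conjugate {a′} {g} {w} {x} {z} inv xz = begin
    g ∙ ((x ∙ w) ∙ z)                    ≈⟨ assoc g (x ∙ w) z ⟨
    (g ∙ (x ∙ w)) ∙ z                    ≈⟨ ∙-congʳ (assoc g x w) ⟨
    ((g ∙ x) ∙ w) ∙ z                    ≈⟨ ∙-congˡ (cancelˡ z inv) ⟨
    ((g ∙ x) ∙ w) ∙ (a′ ∙ ((g ∙ x) ∙ z)) ≈⟨ ∙-congˡ (∙-congˡ (cancelʳ g xz)) ⟩
    ((g ∙ x) ∙ w) ∙ (a′ ∙ g)             ≈⟨ assoc ((g ∙ x) ∙ w) a′ g ⟨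
    (((g ∙ x) ∙ w) ∙ a′) ∙ g             ∎

  -- Returns from the typed factors of z ρ₁ and z ρ₂ to ρ₁ and ρ₂; on the way the left factor d is
  -- conjugated into z⁻¹ d z.
  pull-back : ∀ {d p p₁ p₁′ p₂ ρ₁ ρ₂ t₁ t₂ x z} → x ∙ z ≋ ε → z ∙ ρ₁ ≋ t₁ ∙ p₁ → z ∙ ρ₂ ≋ t₂ ∙ p₂ →
    p₁ ∙ p₁′ ≋ ε → t₂ ≋ (d ∙ t₁) ∙ p → ρ₂ ≋ (((x ∙ d) ∙ z) ∙ ρ₁) ∙ ((p₁′ ∙ p) ∙ p₂)
  pull-back {d} {p} {p₁} {p₁′} {p₂} {ρ₁} {ρ₂} {t₁} {t₂} {x} {z} xz eq₁ eq₂ inv eq = begin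
    ρ₂                                           ≈⟨ cancelˡ ρ₂ xz ⟨
    x ∙ (z ∙ ρ₂)                                 ≈⟨ ∙-congˡ (≋-trans eq₂ (∙-congʳ eq)) ⟩
    x ∙ (((d ∙ t₁) ∙ p) ∙ p₂)                    ≈⟨ ∙-congˡ (∙-congʳ (∙-congʳ (∙-congˡ (≋-trans (∙-congʳ eq₁) (cancelʳ t₁ inv))))) ⟨
    x ∙ (((d ∙ ((z ∙ ρ₁) ∙ p₁′)) ∙ p) ∙ p₂)      ≈⟨ ∙-congˡ (assoc (d ∙ ((z ∙ ρ₁) ∙ p₁′)) p p₂) ⟩
    x ∙ ((d ∙ ((z ∙ ρ₁) ∙ p₁′)) ∙ (p ∙ p₂))      ≈⟨ assoc x _ _ ⟨
    (x ∙ (d ∙ ((z ∙ ρ₁) ∙ p₁′))) ∙ (p ∙ p₂)      ≈⟨ ∙-congʳ (∙-congˡ (assoc d (z ∙ ρ₁) p₁′)) ⟨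
    (x ∙ ((d ∙ (z ∙ ρ₁)) ∙ p₁′)) ∙ (p ∙ p₂)      ≈⟨ ∙-congʳ (assoc x (d ∙ (z ∙ ρ₁)) p₁′) ⟨
    ((x ∙ (d ∙ (z ∙ ρ₁))) ∙ p₁′) ∙ (p ∙ p₂)      ≈⟨ ∙-congʳ (∙-congʳ (≋-trans (∙-congʳ (assoc x d z)) (≋-trans (assoc x (d ∙ z) ρ₁) (∙-congˡ (assoc d z ρ₁))))) ⟨
    ((((x ∙ d) ∙ z) ∙ ρ₁) ∙ p₁′) ∙ (p ∙ p₂)      ≈⟨ assoc (((x ∙ d) ∙ z) ∙ ρ₁) p₁′ (p ∙ p₂) ⟩
    (((x ∙ d) ∙ z) ∙ ρ₁) ∙ (p₁′ ∙ (p ∙ p₂))      ≈⟨ ∙-congˡ (assoc p₁′ p p₂) ⟨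
    (((x ∙ d) ∙ z) ∙ ρ₁) ∙ ((p₁′ ∙ p) ∙ p₂)      ∎

module ⊗-Transfers {n} = MonoidTransfers (⊗-monoid n)

-- The boundary component of γ, straightened: since γ has constant type κ on the first r coordinates,
-- σ = γ ξ(z⁻¹) has type 0 there for an integral z of constant type κ.
record Straightening {N n r : ℕ} (r≤n : r ≤ n) (γ : Mat2 n) (β : Types n) : Set where
  field
    z       : Mat2 r
    sp-z    : IsSp r z
    sp-γ    : IsSp n γ
    int-z   : IntegralM z
    int-γ   : IntegralM γ
    typed   : HasType N (γ ⊗ ξ r n (adj z)) (λ ℓ → extend r≤n (λ _ → false) (β ℓ))

  σ : Mat2 n
  σ = γ ⊗ ξ r n (adj z)

  βσ : Types n
  βσ ℓ = extend r≤n (λ _ → false) (β ℓ)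

  sp-σ : IsSp n σ
  sp-σ = sp-⊗ γ (ξ r n (adj z)) sp-γ (sp-ξ r≤n (adj z) (sp-adj z sp-z))

  int-σ : IntegralM σ
  int-σ = integral-⊗ {A = γ} {ξ r n (adj z)} int-γ (integral-ξ r≤n {adj z} (integral-adj int-z))

  below : ∀ ℓ (a : Fin r) → βσ ℓ (emb r≤n a) ≡ false
  below ℓ a = extend-inner r≤n (λ _ → false) (β ℓ) a

  sp-σξ : ∀ τ → IsSp r τ → IsSp n (σ ⊗ ξ r n τ)
  sp-σξ τ sp = sp-⊗ σ (ξ r n τ) sp-σ (sp-ξ r≤n τ sp)

  int-σξ : ∀ τ → IntegralM τ → IntegralM (σ ⊗ ξ r n τ)
  int-σξ τ iτ = integral-⊗ {A = σ} {ξ r n τ} int-σ (integral-ξ r≤n {τ} iτ)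

  typed-σξ : ∀ τ {βτ} → IntegralM τ → HasType N τ βτ → HasType N (σ ⊗ ξ r n τ) (λ ℓ → extend r≤n (βτ ℓ) (βσ ℓ))
  typed-σξ τ {βτ} iτ tτ = ξ-type r≤n {γ = σ} {τ} {βσ} {λ _ → false} {βτ} int-σ iτ typed below tτ

  count-σξ : ∀ {s} → s ≤ r → (βτ : Types r) → ∀ ℓ →
    count (window s (extend r≤n (βτ ℓ) (βσ ℓ))) ≡ count (window s (βτ ℓ)) ℕ.+ count (window r (β ℓ))
  count-σξ {s} s≤r βτ ℓ = trans (count-extend s r≤n s≤r (βτ ℓ) (βσ ℓ))
    (cong (count (window s (βτ ℓ)) ℕ.+_) (count-cong (window-cong r (λ j r≤j → extend-outer r≤n (λ _ → false) (β ℓ) j r≤j))))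

  factor : ∀ {ρ τ p} → z ⊗ ρ ≈ τ ⊗ p → γ ⊗ ξ r n ρ ≈ (σ ⊗ ξ r n τ) ⊗ ξ r n p
  factor {ρ} {τ} {p} zρ≈τp = begin
    γ ⊗ ξ r n ρ                      ≈⟨ ⊗-congˡ γ (begin
        ξ r n ρ                        ≈⟨ ξ-cong r≤n {ρ} {adj z ⊗ (τ ⊗ p)} (λ i j → trans
            (sym (⊗-Inverses.cancelˡ {a = z} {adj z} ρ (sp-inverseˡ z sp-z) i j))
            (⊗-congˡ (adj z) zρ≈τp i j)) ⟩
        ξ r n (adj z ⊗ (τ ⊗ p))        ≈⟨ ξ-⊗ r≤n (adj z) (τ ⊗ p) ⟩
        ξ r n (adj z) ⊗ ξ r n (τ ⊗ p)  ∎) ⟩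
    γ ⊗ (ξ r n (adj z) ⊗ ξ r n (τ ⊗ p)) ≈⟨ ⊗-assoc γ (ξ r n (adj z)) (ξ r n (τ ⊗ p)) ⟨
    σ ⊗ ξ r n (τ ⊗ p)                ≈⟨ ⊗-congˡ σ (ξ-⊗ r≤n τ p) ⟩
    σ ⊗ (ξ r n τ ⊗ ξ r n p)          ≈⟨ ⊗-assoc σ (ξ r n τ) (ξ r n p) ⟨
    (σ ⊗ ξ r n τ) ⊗ ξ r n p          ∎
    where open ⊗-Reasoning {n}

straighten : ∀ {N n r} → 0 < N → SquareFree N → (r≤n : r ≤ n) → ∀ {γ β} (κ : ℕ → Bool) →
  IsSp n γ → IntegralM γ → HasType N γ β → (∀ ℓ a → β ℓ (emb r≤n a) ≡ κ ℓ) → Straightening {N} r≤n γ β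
straighten {N} {n} {r} 0<N sf r≤n {γ} {β} κ spγ iγ tγ const = build (sp-of-type {r} 0<N sf (λ ℓ _ → κ ℓ))
  where
  -- The C- and D-columns of z reappear, up to sign, as rows of z⁻¹; so type κ of z is precisely the
  -- condition that `ξ-type` puts on the rows of z⁻¹ for the new type 0.
  turn-row : ∀ z ℓ t j k → Div ℓ (z (bot j) (column t k)) → Div ℓ (adj z (row t k) (top j))
  turn-row z ℓ true  j k h = h
  turn-row z ℓ false j k h = div-neg h
  build : (∃[ z ] IsSp r z × IntegralM z × HasType N z (λ ℓ _ → κ ℓ)) → Straightening {N} r≤n γ β
  build (z , spz , iz , tz) = record
    { z = z ; sp-z = spz ; sp-γ = spγ ; int-z = iz ; int-γ = iγ
    ; typed = ξ-type r≤n {γ = γ} {adj z} {β} {κ} {λ _ _ → false} iγ (integral-adj iz) tγ const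
        (λ ℓ pℓ ℓ∣N j k → turn-row z ℓ (κ ℓ) j k (tz ℓ pℓ ℓ∣N k j)) }

straighten-rep : ∀ {N n r} → 0 < N → SquareFree N → (r≤n : r ≤ n) → ∀ {L γ} → r ℕ.+ length L ≡ n →
  RepFacts N n L γ → Straightening {N} r≤n γ (repBit L n)
straighten-rep {n = n} 0<N sf r≤n {L} len R = straighten 0<N sf r≤n (λ ℓ → anyDvd ℓ L) sp int-γ typed
  (λ ℓ a → repBit-below L n ℓ len (emb r≤n a) (emb-< r≤n a))
  where open RepFacts R

length-∸ : ∀ {n r} {L : List ℕ} → r ≤ n → length L ≡ n ∸ r → r ℕ.+ length L ≡ n
length-∸ {n} {r} r≤n eq = trans (cong (r ℕ.+_) eq) (ℕₚ.m+[n∸m]≡n r≤n)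

window-small : ∀ {n} s (b : Fin n → Bool) → (∀ j → toℕ j < s → b j ≡ false) → count b ≡ count (window s b)
window-small s b small = count-cong go
  where
  go : ∀ j → b j ≡ window s b j
  go j with toℕ j ℕ.<? s
  ... | yes j<s = small j j<s
  ... | no _    = refl

module _ {N n r s : ℕ} (0<N : 0 < N) (sf : SquareFree N) (s≤r : s ≤ r) (r≤n : r ≤ n) {γ β}
         (S : Straightening {N} r≤n γ β) where

  open Straightening S

  -- The rank contributed by γ is common to both sides and cancels, so the typed factors of z ρ₁ and
  -- z ρ₂ have equal counts. Their bits before s are 0 by construction, which makes them equivalent
  -- in degree r.
  self-intersection-free : ∀ ρ₁ ρ₂ (D₁ : Decomposition 0<N sf s (z ⊗ ρ₁)) (D₂ : Decomposition 0<N sf s (z ⊗ ρ₂)) →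
    DC (InΓ0 N n) (InP n s) (γ ⊗ ξ r n ρ₁) (γ ⊗ ξ r n ρ₂) → DC (InΓγ N n r r≤n γ) (InP r s) ρ₁ ρ₂
  self-intersection-free ρ₁ ρ₂ D₁ D₂ (d , p , d∈ , p∈ , eq) = finish
    (equal-count⇒equivalent 0<N sf s≤r {D₁.τ} {D₂.τ} {D₁.β} {D₂.β} D₁.sp D₁.int-τ D₁.typed D₂.sp D₂.int-τ D₂.typed
      (λ ℓ pℓ ℓ∣N → (λ j j<s → trans (D₁.β-small ℓ j j<s) (sym (D₂.β-small ℓ j j<s))) , counts ℓ pℓ ℓ∣N))
    where
    module D₁ = Decomposition D₁
    module D₂ = Decomposition D₂
    T₁ T₂ P₁ P₂ : Mat2 n
    T₁ = σ ⊗ ξ r n D₁.τ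
    T₂ = σ ⊗ ξ r n D₂.τ
    P₁ = ξ r n D₁.p
    P₂ = ξ r n D₂.p
    P₁∈ : InP n s P₁
    P₁∈ = InP-ξ r≤n s≤r D₁.p D₁.p∈P
    P₂∈ : InP n s P₂
    P₂∈ = InP-ξ r≤n s≤r D₂.p D₂.p∈P
    T₂≈ : T₂ ≈ (d ⊗ T₁) ⊗ ((P₁ ⊗ p) ⊗ adj P₂)
    T₂≈ = ⊗-Transfers.transfer {d = d} {γ ⊗ ξ r n ρ₁} {γ ⊗ ξ r n ρ₂} {p} {P₁} {P₂} {adj P₂} {T₁} {T₂}
      (factor {ρ₁} {D₁.τ} {D₁.p} D₁.g≈τp) (factor {ρ₂} {D₂.τ} {D₂.p} D₂.g≈τp) (sp-inverseʳ P₂ (proj₁ P₂∈)) eq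
    counts : ∀ ℓ → Prime ℓ → ℓ ∣ N → count (D₁.β ℓ) ≡ count (D₂.β ℓ)
    counts ℓ pℓ ℓ∣N = begin
      count (D₁.β ℓ)            ≡⟨ window-small s (D₁.β ℓ) (D₁.β-small ℓ) ⟩
      count (window s (D₁.β ℓ)) ≡⟨ ℕₚ.+-cancelʳ-≡ (count (window r (β ℓ))) _ _
          (trans (sym (count-σξ s≤r D₁.β ℓ)) (trans invariant (count-σξ s≤r D₂.β ℓ))) ⟩
      count (window s (D₂.β ℓ)) ≡⟨ window-small s (D₂.β ℓ) (D₂.β-small ℓ) ⟨
      count (D₂.β ℓ)            ∎
      where
      open ≡-Reasoning
      invariant : count (window s (extend r≤n (D₁.β ℓ) (βσ ℓ))) ≡ count (window s (extend r≤n (D₂.β ℓ) (βσ ℓ)))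
      invariant = count-invariant {s = s} {σ = T₁} {T₂} {d} {(P₁ ⊗ p) ⊗ adj P₂} {λ ℓ → extend r≤n (D₁.β ℓ) (βσ ℓ)} {λ ℓ → extend r≤n (D₂.β ℓ) (βσ ℓ)}
        (sp-σξ D₁.τ D₁.sp) (int-σξ D₁.τ D₁.int-τ) (typed-σξ D₁.τ {D₁.β} D₁.int-τ D₁.typed)
        (sp-σξ D₂.τ D₂.sp) (int-σξ D₂.τ D₂.int-τ) (typed-σξ D₂.τ {D₂.β} D₂.int-τ D₂.typed)
        d∈ (InP-⊗ (P₁ ⊗ p) (adj P₂) (InP-⊗ P₁ p P₁∈ p∈) (InP-adj P₂ P₂∈)) T₂≈ ℓ pℓ ℓ∣N
    finish : DC (InΓ0 N r) (InP r s) D₁.τ D₂.τ → DC (InΓγ N n r r≤n γ) (InP r s) ρ₁ ρ₂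
    finish (d′ , p′ , d′∈@(sp-d′ , int-d′ , C-d′) , p′∈ , τ₂≈) = (adj z ⊗ d′) ⊗ z , (adj D₁.p ⊗ p′) ⊗ D₂.p
      -- As ξ splits ω, ξ(z⁻¹ d′ z) is a preimage in P. Its conjugate by γ is σ ξ(d′) σ⁻¹, which
      -- lies in Γ₀(N) because multiplication by ξ(d′) does not change the type of σ.
      , (ξ r n ((adj z ⊗ d′) ⊗ z) , ξ∈P r≤n ((adj z ⊗ d′) ⊗ z) sp-e , ω-ξ r≤n ((adj z ⊗ d′) ⊗ z) , (σ ⊗ ξ r n d′) ⊗ adj σ , e∈ , intertwines)
      , InP-⊗ (adj D₁.p ⊗ p′) D₂.p (InP-⊗ (adj D₁.p) p′ (InP-adj D₁.p D₁.p∈P) p′∈) D₂.p∈P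
      , ⊗-Transfers.pull-back {d = d′} {p′} {D₁.p} {adj D₁.p} {D₂.p} {ρ₁} {ρ₂} {D₁.τ} {D₂.τ} {adj z} {z}
          (sp-inverseˡ z sp-z) D₁.g≈τp D₂.g≈τp (sp-inverseʳ D₁.p (proj₁ D₁.p∈P)) τ₂≈
      where
      sp-e : IsSp r ((adj z ⊗ d′) ⊗ z)
      sp-e = sp-⊗ (adj z ⊗ d′) z (sp-⊗ (adj z) d′ (sp-adj z sp-z) sp-d′) sp-z
      βσ′ : ∀ ℓ j → extend r≤n (λ _ → false) (βσ ℓ) j ≡ βσ ℓ j
      βσ′ ℓ j = go (inner? r≤n j)
        where
        go : ∀ {j} → Inner? r≤n j → extend r≤n (λ _ → false) (βσ ℓ) j ≡ βσ ℓ j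
        go (inner a) = trans (extend-inner r≤n (λ _ → false) (βσ ℓ) a) (sym (below ℓ a))
        go (outer {j} h) = extend-outer r≤n (λ _ → false) (βσ ℓ) j h
      typed-d′ : HasType N d′ (λ _ _ → false)
      typed-d′ ℓ _ ℓ∣N j k = div-∣ ℓ∣N (⟨_⟩ {N} (C-d′ k j))
      e∈ : InΓ0 N n ((σ ⊗ ξ r n d′) ⊗ adj σ)
      e∈ = same-type⇒Γ0 0<N sf {σ} {σ ⊗ ξ r n d′} {βσ} sp-σ int-σ typed (sp-σξ d′ sp-d′) (int-σξ d′ int-d′)
        (λ ℓ pℓ ℓ∣N j k → subst (λ t → Div ℓ ((σ ⊗ ξ r n d′) (bot k) (column t j))) (βσ′ ℓ j)
          (typed-σξ d′ {λ _ _ → false} int-d′ typed-d′ ℓ pℓ ℓ∣N j k))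
      intertwines : γ ⊗ ξ r n ((adj z ⊗ d′) ⊗ z) ≈ ((σ ⊗ ξ r n d′) ⊗ adj σ) ⊗ γ
      intertwines i j = trans
        (⊗-congˡ γ (λ i j → trans (ξ-⊗ r≤n (adj z ⊗ d′) z i j)
            (⊗-congʳ (ξ r n z) (ξ-⊗ r≤n (adj z) d′) i j)) i j)
        (⊗-Transfers.conjugate {a′ = adj σ} {γ} {ξ r n d′} {ξ r n (adj z)} {ξ r n z}
          (sp-inverseˡ σ sp-σ) (ξ-inverse r≤n (adj z) z (sp-inverseˡ z sp-z)) i j)

no-self-intersection : ∀ (N n r s : ℕ) → 0 < N → SquareFree N → 1 ≤ n → s ≤ r → (r≤n : r ≤ n) →
  (L : List ℕ) → ValidTuple N L → length L ≡ n ∸ r →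
  (γ : Mat2 n) → IsRep N n L γ → (ρ₁ ρ₂ : Mat2 r) → IsSp r ρ₁ → IsSp r ρ₂ →
  DC (InΓ0 N n) (InP n s) (γ ⊗ ξ r n ρ₁) (γ ⊗ ξ r n ρ₂) → DC (InΓγ N n r r≤n γ) (InP r s) ρ₁ ρ₂
no-self-intersection N n r s 0<N sf _ s≤r r≤n L valid len γ rep ρ₁ ρ₂ sp₁ sp₂ =
  self-intersection-free 0<N sf s≤r r≤n S ρ₁ ρ₂
    (decompose 0<N sf s≤r (z ⊗ ρ₁) (sp-⊗ z ρ₁ sp-z sp₁)) (decompose 0<N sf s≤r (z ⊗ ρ₂) (sp-⊗ z ρ₂ sp-z sp₂))
  where
  S : Straightening {N} r≤n γ (repBit L n)
  S = straighten-rep 0<N sf r≤n (length-∸ {L = L} r≤n len) (repFacts N n L γ valid rep)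
  open Straightening S using (z; sp-z)

-- Incidence of s-cusps and (s+1)-cusps

exceeds : ℕ → ℕ → Bool
exceeds x y with x ℕ.≟ suc y
... | yes _ = true
... | no  _ = false

exceeds-spec : ∀ {x y} → y ≤ x × x ≤ suc y → x ≡ #ᵇ (exceeds x y) ℕ.+ y
exceeds-spec {x} {y} (y≤x , x≤1+y) with x ℕ.≟ suc y
... | yes eq = eq
... | no ≢   = ℕₚ.≤-antisym (ℕₚ.≤-pred (ℕₚ.≤∧≢⇒< x≤1+y ≢)) y≤x

count-window-one : ∀ s (b : Fin (suc s) → Bool) → count (window s b) ≤ 1
count-window-one s b = subst (count (window s b) ≤_) (count-window-true {s} {suc s} {1} (ℕₚ.+-comm s 1))
  (count-mono (λ j eq → window-≥ s (λ _ → true) j (proj₁ (window-true s b j eq))))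

module _ {N n s : ℕ} (0<N : 0 < N) (sf : SquareFree N) (s<n : suc s ≤ n) {L M : List ℕ} {γL γM : Mat2 n}
         (RL : RepFacts N n L γL) (RM : RepFacts N n M γM)
         (lenL : s ℕ.+ length L ≡ n) (lenM : suc s ℕ.+ length M ≡ n) where

  private
    module RL = RepFacts RL
    module RM = RepFacts RM
    S : Straightening {N} s<n γM (repBit M n)
    S = straighten-rep 0<N sf s<n lenM RM
    open Straightening S

  module _ (ρ : Mat2 (suc s)) (D : Decomposition 0<N sf s (z ⊗ ρ)) where

    -- The typed factor of z ρ has size s + 1, so beyond s a single coordinate is left, and its bit
    -- is the difference of the two ranks.
    lies-on⇒adjacent-of : DC (InΓ0 N n) (InP n s) γL (γM ⊗ ξ (suc s) n ρ) →
      ∀ ℓ → Prime ℓ → ℓ ∣ N → Adjacent ℓ L M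
    lies-on⇒adjacent-of (d , p , d∈ , p∈ , eq) ℓ pℓ ℓ∣N = adjacent (count-window-one s (D.β ℓ))
      (trans (sym (count-repBit L n ℓ lenL)) (trans invariant (trans (count-σξ (ℕₚ.n≤1+n s) D.β ℓ)
        (cong (count (window s (D.β ℓ)) ℕ.+_) (count-repBit M n ℓ lenM)))))
      where
      module D = Decomposition D
      T P : Mat2 n
      T = σ ⊗ ξ (suc s) n D.τ
      P = ξ (suc s) n D.p
      P∈ : InP n s P
      P∈ = InP-ξ s<n (ℕₚ.n≤1+n s) D.p D.p∈P
      T≈ : T ≈ (d ⊗ γL) ⊗ ((idM ⊗ p) ⊗ adj P)
      -- The representative `γL` is already typed, so its factor in P is `idM`.
      T≈ = ⊗-Transfers.transfer {d = d} {γL} {γM ⊗ ξ (suc s) n ρ} {p} {idM} {P} {adj P} {γL} {T}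
        (λ i j → sym (⊗.identityʳ γL i j)) (factor {ρ} {D.τ} {D.p} D.g≈τp) (sp-inverseʳ P (proj₁ P∈)) eq
      invariant : count (window s (repBit L n ℓ)) ≡ count (window s (extend s<n (D.β ℓ) (βσ ℓ)))
      invariant = count-invariant {s = s} {σ = γL} {T} {d} {(idM ⊗ p) ⊗ adj P} {repBit L n} {λ ℓ → extend s<n (D.β ℓ) (βσ ℓ)}
        RL.sp RL.int-γ RL.typed (sp-σξ D.τ D.sp) (int-σξ D.τ D.int-τ) (typed-σξ D.τ {D.β} D.int-τ D.typed)
        d∈ (InP-⊗ (idM ⊗ p) (adj P) (InP-⊗ idM p InP-idM p∈) (InP-adj P P∈)) T≈ ℓ pℓ ℓ∣N
      adjacent : ∀ {k x y} → k ≤ 1 → x ≡ k ℕ.+ y → y ≤ x × x ≤ suc y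
      adjacent {k} {y = y} k≤1 refl = ℕₚ.m≤n+m y k , ℕₚ.+-monoˡ-≤ y k≤1

  lies-on⇒adjacent : (∃[ ρ ] IsSp (suc s) ρ × DC (InΓ0 N n) (InP n s) γL (γM ⊗ ξ (suc s) n ρ)) →
    ∀ ℓ → Prime ℓ → ℓ ∣ N → Adjacent ℓ L M
  lies-on⇒adjacent (ρ , sp-ρ , dc) = lies-on⇒adjacent-of ρ
    (decompose 0<N sf (ℕₚ.n≤1+n s) (z ⊗ ρ) (sp-⊗ z ρ sp-z sp-ρ)) dc

  -- The line added to the isotropic subspace of M must raise the rank exactly at the primes
  -- where the ranks of L and M differ.
  module _ (adj-LM : ∀ ℓ → Prime ℓ → ℓ ∣ N → Adjacent ℓ L M) where

    private
      differ : ℕ → Bool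
      differ ℓ = exceeds (rank ℓ L) (rank ℓ M)
      -- The bits before s copy those of the representative of L, since `equal-count⇒equivalent`
      -- compares types that agree there.
      β′ : Types (suc s)
      β′ ℓ = extend (ℕₚ.n≤1+n s) (λ _ → anyDvd ℓ L) (λ _ → differ ℓ)
      rank-differ : ∀ ℓ → Prime ℓ → ℓ ∣ N → rank ℓ L ≡ #ᵇ (differ ℓ) ℕ.+ rank ℓ M
      rank-differ ℓ pℓ ℓ∣N = exceeds-spec (adj-LM ℓ pℓ ℓ∣N)
      count-last : ∀ t → count {suc s} (window s (λ _ → t)) ≡ #ᵇ t
      count-last true  = count-window-true (ℕₚ.+-comm s 1)
      count-last false = count-const-false {suc s} (window-false s)
      count-β′ : ∀ ℓ → count (window s (β′ ℓ)) ≡ #ᵇ (differ ℓ)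
      count-β′ ℓ = trans (count-cong (window-cong s λ j s≤j → extend-outer (ℕₚ.n≤1+n s) (λ _ → anyDvd ℓ L) (λ _ → differ ℓ) j s≤j))
        (count-last (differ ℓ))
      s≤n : s ≤ n
      s≤n = ℕₚ.<⇒≤ s<n
      βT : Types n
      βT ℓ = extend s<n (β′ ℓ) (βσ ℓ)
      β′-small : ∀ ℓ a → toℕ a < s → β′ ℓ a ≡ anyDvd ℓ L
      β′-small ℓ a a<s = go (inner? (ℕₚ.n≤1+n s) a) a<s
        where
        go : ∀ {a} → Inner? (ℕₚ.n≤1+n s) a → toℕ a < s → β′ ℓ a ≡ anyDvd ℓ L
        go (inner b) _   = extend-inner (ℕₚ.n≤1+n s) (λ _ → anyDvd ℓ L) (λ _ → differ ℓ) b
        go (outer h) a<s = contradiction h (ℕₚ.<⇒≱ a<s)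
      βT-small : ∀ ℓ j → toℕ j < s → βT ℓ j ≡ anyDvd ℓ L
      βT-small ℓ j j<s = go (inner? s<n j) j<s
        where
        go : ∀ {j} → Inner? s<n j → toℕ j < s → βT ℓ j ≡ anyDvd ℓ L
        go (inner a) a<s = trans (extend-inner s<n (β′ ℓ) (βσ ℓ) a) (β′-small ℓ a (subst (_< s) (Finₚ.toℕ-inject≤ a s<n) a<s))
        go (outer h) j<s = contradiction (ℕₚ.<⇒≤ h) (ℕₚ.<⇒≱ j<s)
      agree : ∀ ℓ j → toℕ j < s → repBit L n ℓ j ≡ βT ℓ j
      agree ℓ j j<s = trans (repBit-below L n ℓ lenL j j<s) (sym (βT-small ℓ j j<s))
      alike : ∀ ℓ → Prime ℓ → ℓ ∣ N → (∀ j → toℕ j < s → repBit L n ℓ j ≡ βT ℓ j) × count (repBit L n ℓ) ≡ count (βT ℓ)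
      alike ℓ pℓ ℓ∣N = agree ℓ , trans (count-emb s≤n (repBit L n ℓ)) (trans (cong₂ ℕ._+_
        (count-cong (λ a → agree ℓ (emb s≤n a) (emb-< s≤n a)))
        (begin
          count (window s (repBit L n ℓ)) ≡⟨ count-repBit L n ℓ lenL ⟩
          rank ℓ L                        ≡⟨ rank-differ ℓ pℓ ℓ∣N ⟩
          #ᵇ (differ ℓ) ℕ.+ rank ℓ M      ≡⟨ cong₂ ℕ._+_ (count-β′ ℓ) (count-repBit M n ℓ lenM) ⟨
          count (window s (β′ ℓ)) ℕ.+ count (window (suc s) (repBit M n ℓ)) ≡⟨ count-σξ (ℕₚ.n≤1+n s) β′ ℓ ⟨
          count (window s (βT ℓ))         ∎))
        (sym (count-emb s≤n (βT ℓ))))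
        where open ≡-Reasoning

    adjacent⇒lies-on : ∃[ ρ ] IsSp (suc s) ρ × DC (InΓ0 N n) (InP n s) γL (γM ⊗ ξ (suc s) n ρ)
    adjacent⇒lies-on = build (sp-of-type {suc s} 0<N sf β′)
      where
      build : (∃[ τ ] IsSp (suc s) τ × IntegralM τ × HasType N τ β′) →
        ∃[ ρ ] IsSp (suc s) ρ × DC (InΓ0 N n) (InP n s) γL (γM ⊗ ξ (suc s) n ρ)
      -- The witness is ρ = z⁻¹ τ, because γM ξ(z⁻¹ τ) = σ ξ(τ) is typed.
      build (τ , sp-τ , int-τ , typed-τ) = adj z ⊗ τ , sp-⊗ (adj z) τ (sp-adj z sp-z) sp-τ ,
        move (equal-count⇒equivalent 0<N sf s≤n {γL} {σ ⊗ ξ (suc s) n τ} {repBit L n} {βT}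
          RL.sp RL.int-γ RL.typed (sp-σξ τ sp-τ) (int-σξ τ int-τ) (typed-σξ τ {β′} int-τ typed-τ) alike)
        where
        move : DC (InΓ0 N n) (InP n s) γL (σ ⊗ ξ (suc s) n τ) → DC (InΓ0 N n) (InP n s) γL (γM ⊗ ξ (suc s) n (adj z ⊗ τ))
        move (d , p , d∈ , p∈ , eq) = d , p , d∈ , p∈ , λ i j → trans
          (⊗-congˡ γM (ξ-⊗ s<n (adj z) τ) i j)
          (trans (sym (⊗-assoc γM (ξ (suc s) n (adj z)) (ξ (suc s) n τ) i j)) (eq i j))

incidence : ∀ (N n s : ℕ) → 0 < N → SquareFree N → suc (suc s) ≤ n →
  (l : ℕ) (Ls : List ℕ) → ValidTuple N (l ∷ Ls) → length (l ∷ Ls) ≡ n ∸ s →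
  (M : List ℕ) → ValidTuple N M → length M ≡ n ∸ suc s →
  (LiesOn N n s (l ∷ Ls) M ⇔ (∃[ cds ] Pointwise (λ cd li → proj₁ cd ℕ.* proj₂ cd ≡ li) cds Ls × M ≡ formula l cds))
incidence N n s 0<N sf s+2≤n l Ls validL lenL M validM lenM = mk⇔ to from
  where
  s<n : suc s ≤ n
  s<n = ℕₚ.<⇒≤ s+2≤n
  lenL′ : s ℕ.+ length (l ∷ Ls) ≡ n
  lenL′ = length-∸ {L = l ∷ Ls} (ℕₚ.<⇒≤ s<n) lenL
  lenM′ : suc s ℕ.+ length M ≡ n
  lenM′ = length-∸ {L = M} s<n lenM
  lengths : length Ls ≡ length M
  lengths = ℕₚ.+-cancelˡ-≡ (suc s) _ _ (trans (sym (ℕₚ.+-suc s (length Ls))) (trans lenL′ (sym lenM′)))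
  to : LiesOn N n s (l ∷ Ls) M → ∃[ cds ] Factors cds Ls × M ≡ formula l cds
  to on = adjacent⇒formula 0<N sf l Ls M validL validM lengths
    (lies-on⇒adjacent 0<N sf s<n {l ∷ Ls} {M} (repFacts N n (l ∷ Ls) γL validL repL) (repFacts N n M γM validM repM) lenL′ lenM′
      (on γL γM repL repM))
    where
    existsL = rep-exists n (l ∷ Ls) sf (proj₁ validL) (ℕₚ.m+n≤o⇒n≤o s (ℕₚ.≤-reflexive lenL′))
    existsM = rep-exists n M sf (proj₁ validM) (ℕₚ.m+n≤o⇒n≤o (suc s) (ℕₚ.≤-reflexive lenM′))
    γL = proj₁ existsL
    repL = proj₂ existsL
    γM = proj₁ existsM
    repM = proj₂ existsM
  from : (∃[ cds ] Factors cds Ls × M ≡ formula l cds) → LiesOn N n s (l ∷ Ls) M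
  from (cds , fs , refl) γL γM repL repM =
    adjacent⇒lies-on 0<N sf s<n {l ∷ Ls} {M} (repFacts N n (l ∷ Ls) γL validL repL) (repFacts N n M γM validM repM) lenL′ lenM′
      (λ ℓ pℓ _ → formula⇒adjacent pℓ l fs)

theorem6p3 : (∀ (N n r s : ℕ) → 0 < N → SquareFree N → 1 ≤ n → s ≤ r → (r≤n : r ≤ n) →
    (L : List ℕ) → ValidTuple N L → length L ≡ n ∸ r →
    (γ : Mat2 n) → IsRep N n L γ →
    (ρ₁ ρ₂ : Mat2 r) → IsSp r ρ₁ → IsSp r ρ₂ →
    DC (InΓ0 N n) (InP n s) (γ ⊗ ξ r n ρ₁) (γ ⊗ ξ r n ρ₂) →
    DC (InΓγ N n r r≤n γ) (InP r s) ρ₁ ρ₂)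
    ×
    (∀ (N n s : ℕ) → 0 < N → SquareFree N → suc (suc s) ≤ n →
    (l : ℕ) (Ls : List ℕ) → ValidTuple N (l ∷ Ls) → length (l ∷ Ls) ≡ n ∸ s →
    (M : List ℕ) → ValidTuple N M → length M ≡ n ∸ suc s →
    (LiesOn N n s (l ∷ Ls) M
    ⇔ (∃[ cds ] Pointwise (λ cd li → proj₁ cd ℕ.* proj₂ cd ≡ li) cds Ls
    × M ≡ formula l cds)))
theorem6p3 = no-self-intersection , incidence
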